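{- Let $n_0\ge d_0\ge1$ and let $f\in\mathfrak{E}^+(n_0,d_0)$. Then for all integers $n,d$ with $n\ge d\ge1$, $$A^+(n,d)\le s\,\big((d_0+1)\,\mathbf{R}(f)\big)^{\lceil d/d_0\rceil},$$ where $$s=\sigma\big(n+\lceil d/d_0\rceil d_0-d,\ \lceil d/d_0\rceil d_0,\ n_0,\ d_0\big).$$
   Context: For a homogeneous $g\in\mathbb{C}[x_1,\ldots,x_n]_d$ of degree $d$, the Waring rank $\mathbf{R}(g)$ is the minimum $r$ such that $g=\ell_1^d+\cdots+\ell_r^d$ for some complex linear forms $\ell_1,\ldots,\ell_r$ in $x_1,\ldots,x_n$. $\mathfrak{E}^+(n,d)$ is the set of $g\in\mathbb{R}_{\ge0}[x_1,\ldots,x_n]_d$ (nonnegative real coefficients) whose set of monomials with nonzero coefficient is exactly the set of all multilinear monomials $x_{i_1}\cdots x_{i_d}$, $1\le i_1<\cdots<i_d\le n$; and $A^+(n,d):=\min\{\mathbf{R}(g):g\in\mathfrak{E}^+(n,d)\}$. For $n\ge d$, $n_0\ge d_0$ and $d_0\mid d$, $$\sigma(n,d,n_0,d_0):=\left\lceil\left(\frac{n_0^{d_0}}{(n_0)_{d_0}}\right)^{d/d_0}\frac{d_0!^{\,d/d_0}\,(d/d_0)^d}{d!}\,d\log n\right\rceil,$$ where $(m)_k=m(m-1)\cdots(m-k+1)$ is the falling factorial and $\log$ is the natural logarithm.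
   Formalization: The case n = d = d₀ = 1 is excluded: there s = σ(1,1,n₀,1) = 0 because log 1 = 0, so the printed bound would say A⁺(1,1) ≤ 0, whereas A⁺(1,1) = 1. -}

module Defs where

open import Algebra.Bundles using (CommutativeRing; RawRing)
import Algebra.Definitions.RawSemiring as RawSemiringDefs
open import Data.Fin.Base using (Fin; toℕ)
open import Data.Nat.Base as ℕ using (ℕ; zero; suc; NonZero; _!)
open import Data.Nat.Combinatorics using (_P_)
open import Data.Nat.DivMod using (_/_)
open import Data.Product.Base using (∃; _×_; _,_)
open import Data.Vec.Base as Vec using (Vec; []; _∷_)
open import Data.Vec.Relation.Unary.All using (All)
open import Function.Bundles using (_⇔_)
open import Level using (0ℓ)
open import Relation.Binary.Core using (Rel)
open import Relation.Binary.PropositionalEquality.Core using (_≡_; _≢_)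
open import Relation.Binary.Structures using (IsTotalOrder)
open import Relation.Nullary.Negation.Core using (¬_)
open import Relation.Unary using (Pred)

-- The real numbers enter as an arbitrary Dedekind-complete ordered field,
-- which classically is unique up to isomorphism.
record CompleteOrderedField : Set₁ where
  infix 4 _≤_ _<_
  infix 9 _⁻¹
  field
    commutativeRing : CommutativeRing 0ℓ 0ℓ
  open CommutativeRing commutativeRing public
  field
    _≤_          : Rel Carrier 0ℓ
    isTotalOrder : IsTotalOrder _≈_ _≤_
    +-monoˡ-≤    : ∀ z {x y} → x ≤ y → x + z ≤ y + z
    *-nonNeg     : ∀ {x y} → 0# ≤ x → 0# ≤ y → 0# ≤ x * y
    0≉1          : ¬ (0# ≈ 1#)
    -- The value of 0# ⁻¹ is unconstrained.
    _⁻¹          : Carrier → Carrier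
    ⁻¹-inverseʳ  : ∀ {x} → ¬ (x ≈ 0#) → x * x ⁻¹ ≈ 1#

  UpperBound : Pred Carrier 0ℓ → Pred Carrier 0ℓ
  UpperBound S b = ∀ x → S x → x ≤ b

  field
    supremum : (S : Pred Carrier 0ℓ) → ∃ S → ∃ (UpperBound S) →
               ∃ λ s → UpperBound S s × (∀ b → UpperBound S b → s ≤ b)

  _<_ : Rel Carrier 0ℓ
  x < y = x ≤ y × ¬ (x ≈ y)

-- A polynomial is given by its coefficients, indexed by exponent vectors.
-- Finite support is not imposed here, so the operations are those of the
-- power series ring; it is automatic for the homogeneous elements, which
-- are the only ones used below.
module Polynomials (K : RawRing 0ℓ 0ℓ) where
  open RawRing K
  open RawSemiringDefs rawSemiring using (sum)

  Coeffs : ℕ → Set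
  Coeffs n = Vec ℕ n → Carrier

  one : ∀ {n} → Coeffs n
  one []          = 1#
  one (zero  ∷ α) = one α
  one (suc _ ∷ α) = 0#

  -- The coefficient of p q at α is the sum of p β * q γ over all β + γ = α.
  mul : ∀ {n} → Coeffs n → Coeffs n → Coeffs n
  mul p q []      = p [] * q []
  mul p q (a ∷ α) = sum {suc a} λ i →
    mul (λ β → p (toℕ i ∷ β)) (λ γ → q (a ℕ.∸ toℕ i ∷ γ)) α

  polynomialRing : ℕ → RawRing 0ℓ 0ℓ
  polynomialRing n = record
    { Carrier = Coeffs n
    ; _≈_     = λ p q → ∀ α → p α ≈ q α
    ; _+_     = λ p q α → p α + q α
    ; _*_     = mul
    ; -_      = λ p α → - p α
    ; 0#      = λ _ → 0#
    ; 1#      = one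
    }

  record Form (n d : ℕ) : Set where
    field
      coeff       : Coeffs n
      homogeneous : ∀ α → Vec.sum α ≢ d → coeff α ≈ 0#

  open Form public

  IsSumOfPowers : ∀ {n d} → Form n d → ℕ → Set
  IsSumOfPowers {n} {d} g r =
    ∃ λ (ℓ : Fin r → Form n 1) → coeff g ≈ₚ Σₚ (λ i → coeff (ℓ i) ^ₚ d)
    where
    open RawRing (polynomialRing n) using ()
      renaming (_≈_ to _≈ₚ_; rawSemiring to semiringₚ)
    open RawSemiringDefs semiringₚ using ()
      renaming (_^_ to _^ₚ_; sum to Σₚ)

IsMinimum : Pred ℕ 0ℓ → Pred ℕ 0ℓ
IsMinimum Q m = Q m × (∀ k → Q k → m ℕ.≤ k)

⌈_/_⌉ : (m k : ℕ) .{{_ : NonZero k}} → ℕ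
⌈ m / k ⌉ = (m ℕ.+ ℕ.pred k) / k

module _ (ℝ : CompleteOrderedField) where
  open CompleteOrderedField ℝ
  open RawSemiringDefs (RawRing.rawSemiring rawRing) using (_^_; sum)
    renaming (_×_ to _·_)

  ℂ : RawRing 0ℓ 0ℓ
  ℂ = record
    { Carrier = Carrier × Carrier
    ; _≈_     = λ (a , b) (c , d) → a ≈ c × b ≈ d
    ; _+_     = λ (a , b) (c , d) → a + c , b + d
    ; _*_     = λ (a , b) (c , d) → a * c - b * d , a * d + b * c
    ; -_      = λ (a , b) → - a , - b
    ; 0#      = 0# , 0#
    ; 1#      = 1# , 0#
    }

  module ℝ[x] = Polynomials rawRing
  module ℂ[x] = Polynomials ℂ

  complexify : ∀ {n d} → ℝ[x].Form n d → ℂ[x].Form n d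
  complexify g = record
    { coeff       = λ α → ℝ[x].coeff g α , 0#
    ; homogeneous = λ α α≢d → ℝ[x].homogeneous g α α≢d , refl
    }

  IsWaringRank : ∀ {n d} → ℂ[x].Form n d → ℕ → Set
  IsWaringRank g = IsMinimum (ℂ[x].IsSumOfPowers g)

  𝔈⁺ : ∀ n d → Pred (ℝ[x].Form n d) 0ℓ
  𝔈⁺ n d g =
    (∀ α → 0# ≤ ℝ[x].coeff g α) ×
    (∀ α → (¬ (ℝ[x].coeff g α ≈ 0#)) ⇔ (All (ℕ._≤ 1) α × Vec.sum α ≡ d))

  IsA⁺ : ℕ → ℕ → ℕ → Set
  IsA⁺ n d = IsMinimum λ r → ∃ λ g → 𝔈⁺ n d g × IsWaringRank (complexify g) r

  ι : ℕ → Carrier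
  ι m = m · 1#

  infixl 7 _÷_
  _÷_ : Carrier → Carrier → Carrier
  x ÷ y = x * y ⁻¹

  Converges : (ℕ → Carrier) → Carrier → Set
  Converges u l = ∀ ε → 0# < ε →
    ∃ λ M → ∀ m → M ℕ.≤ m → l - ε < u m × u m < l + ε

  IsExp : Carrier → Carrier → Set
  IsExp x = Converges λ m → sum {m} λ k → x ^ toℕ k ÷ ι (toℕ k !)

  -- y is the logarithm of x when the exponential series at y converges to x.
  IsLog : Carrier → Carrier → Set
  IsLog x y = IsExp y x

  -- For 0# ≤ x the ceiling of x is a natural number.
  IsCeiling : Carrier → ℕ → Set
  IsCeiling x = IsMinimum λ s → x ≤ ι s

  Isσ : (n d n₀ d₀ : ℕ) .{{_ : NonZero d₀}} → ℕ → Set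
  Isσ n d n₀ d₀ s = ∃ λ logn → IsLog (ι n) logn ×
    IsCeiling ((ι (n₀ ℕ.^ d₀) ÷ ι (n₀ P d₀)) ^ m
               * (ι ((d₀ !) ℕ.^ m ℕ.* m ℕ.^ d) ÷ ι (d !))
               * ι d * logn) s
    where
    m : ℕ
    m = d / d₀

-- Write m = ⌈ d / d₀ ⌉, e = m d₀ and N = n + e - d.  Up to multinomial coefficients, a sum
-- Σ w ℓ^k of k-th powers of linear forms is given by its moments Σ w ℓ^α, where ℓ^α is the
-- product of the coefficients of ℓ raised to the exponents α.
--
-- Take the r linear forms of a Waring decomposition of f, scaled by d₀ + 1 nodes x with
-- Lagrange weights for which Σ w x^k is 0 for k < d₀ and 1 for k = d₀.  Of this family of
-- (d₀ + 1) r weighted forms all moments of degree < d₀ vanish, and those of degree d₀ are, up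
-- to positive factors, the coefficients of f.  Hence the moments of degree e of the m-fold
-- product family detect exactly the product f(y₁) ⋯ f(yₘ): in any other multidegree one block
-- has degree < d₀.
--
-- A placement of x₁, …, x_N into the m n₀ variables y turns this product into a form with
-- nonnegative coefficients and multilinear monomials only, and a random placement produces a
-- given monomial with probability p = e! (n₀)_{d₀}^m / (d₀!^m (m n₀)^e).  As
-- s ≥ p⁻¹ e log N, some s placements together produce all of the fewer than N^e monomials
-- (for e = 1 every placement does), because (1 - p)^s N^e ≤ 1.  The sum of these s forms is
-- finally differentiated in the last N - n variables, which neither creates zeros nor increases
-- the number of powers.  The remaining constants are absorbed by complex d-th roots.

module Submission where

open import Defs
open import Algebra.Bundles using (CommutativeRing; CommutativeSemiring; RawRing)
import Algebra.Definitions.RawSemiring as RawSemiringDefs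
import Algebra.Properties.CommutativeSemiring.Exp as Exp
import Algebra.Properties.Ring as RingProperties
import Algebra.Properties.Semiring.Mult as Mult
import Algebra.Properties.Semiring.Sum as SemiringSum
import Algebra.Solver.Ring as RingSolver
open import Algebra.Solver.Ring.AlmostCommutativeRing using (fromCommutativeRing; _-Raw-AlmostCommutative⟶_)
open import Axiom.ExcludedMiddle using (ExcludedMiddle)
open import Data.Bool.Base using (true)
open import Data.Fin.Base as Fin using (Fin; toℕ; zero; suc)
import Data.Fin.Properties as Fin
open import Data.List.Base as List using (List; []; _∷_; length)
open import Data.List.Membership.Propositional using (_∈_)
open import Data.List.Membership.Propositional.Properties using (∈-filter⁺; ∈-map⁺; ∈-++⁺ˡ; ∈-++⁺ʳ)
import Data.List.Properties as List
open import Data.List.Relation.Unary.All as All using (All; []; _∷_)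
import Data.List.Relation.Unary.All.Properties as All
open import Data.List.Relation.Unary.Any as Any using (Any; here; there)
open import Data.Maybe.Base as Maybe using (Maybe)
open import Data.Nat.Base as ℕ using (ℕ; zero; suc; NonZero; z≤n; s≤s; _!)
open import Data.Nat.Combinatorics using (_P_)
open import Data.Nat.Combinatorics.Base using (_P′_)
open import Data.Nat.Combinatorics.Specification using (nP′k≡n[n∸1P′k∸1])
open import Data.Nat.DivMod using (_/_; _%_; m≡m%n+[m/n]*n; m%n<n; m*n/n≡m)
import Data.Nat.Properties as ℕ
open import Data.Nat.Tactic.RingSolver using (solve-∀)
open import Data.Product.Base using (∃; _×_; _,_; proj₁; proj₂)
open import Data.Sum.Base using (_⊎_; inj₁; inj₂)
open import Data.Vec.Base as Vec using (Vec; []; _∷_; lookup; updateAt)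
import Data.Vec.Properties as Vec
open import Data.Vec.Relation.Unary.All as VecAll using ([]; _∷_) renaming (All to VecAll)
import Data.Vec.Relation.Unary.All.Properties as VecAll
open import Function.Base using (_∘_; id)
open import Function.Bundles using (Equivalence; mk⇔)
open import Level using (0ℓ)
open import Relation.Binary.Bundles using (Poset)
open import Relation.Binary.Consequences using (dec⇒weaklyDec)
open import Relation.Binary.Definitions using (Tri; tri<; tri≈; tri>)
open import Relation.Binary.PropositionalEquality as ≡ using (_≡_; _≢_)
import Relation.Binary.Reasoning.PartialOrder as PosetReasoning
import Relation.Binary.Reasoning.Setoid as SetoidReasoning
open import Relation.Binary.Structures using (IsTotalOrder)
open import Relation.Nullary.Decidable.Core using (Dec; yes; no; ¬?; _×-dec_)
open import Relation.Nullary.Negation.Core using (¬_; contradiction)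

-- The pair (a , b), one of whose entries is zero, stands for the integer a - b.
module IntegerCoefficients (R : CommutativeRing 0ℓ 0ℓ) where
  open CommutativeRing R
  open Mult semiring using (×-homo-+; ×1-homo-*) renaming (_×_ to _·_)
  open RingProperties ring
  open SetoidReasoning setoid

  private
    ⟦_⟧ : ℕ → Carrier
    ⟦ n ⟧ = n · 1#

    cancel : ℕ → ℕ → ℕ × ℕ
    cancel (suc a) (suc b) = cancel a b
    cancel a       b       = a , b

    differences : RawRing 0ℓ 0ℓ
    differences = record
      { Carrier = ℕ × ℕ
      ; _≈_     = _≡_
      ; _+_     = λ (a , b) (c , d) → cancel (a ℕ.+ c) (b ℕ.+ d)
      ; _*_     = λ (a , b) (c , d) → cancel (a ℕ.* c ℕ.+ b ℕ.* d) (a ℕ.* d ℕ.+ b ℕ.* c)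
      ; -_      = λ (a , b) → b , a
      ; 0#      = 0 , 0
      ; 1#      = 1 , 0
      }

    difference : ℕ × ℕ → Carrier
    difference (a , b) = ⟦ a ⟧ - ⟦ b ⟧

    interchange : ∀ w x y z → (w + x) + (y + z) ≈ (w + y) + (x + z)
    interchange w x y z = begin
      (w + x) + (y + z) ≈⟨ +-assoc w x (y + z) ⟩
      w + (x + (y + z)) ≈⟨ +-congˡ (+-assoc x y z) ⟨
      w + ((x + y) + z) ≈⟨ +-congˡ (+-congʳ (+-comm x y)) ⟩
      w + ((y + x) + z) ≈⟨ +-congˡ (+-assoc y x z) ⟩
      w + (y + (x + z)) ≈⟨ +-assoc w y (x + z) ⟨
      (w + y) + (x + z) ∎

    +-interchange-minus : ∀ w x y z → (w + x) - (y + z) ≈ (w - y) + (x - z)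
    +-interchange-minus w x y z = begin
      (w + x) - (y + z)     ≈⟨ +-congˡ (-‿+-comm y z) ⟨
      (w + x) + (- y + - z) ≈⟨ interchange w x (- y) (- z) ⟩
      (w - y) + (x - z)     ∎

    difference-+ : ∀ ((a , b) (c , d) : ℕ × ℕ) →
      difference (a ℕ.+ c , b ℕ.+ d) ≈ difference (a , b) + difference (c , d)
    difference-+ (a , b) (c , d) = begin
      ⟦ a ℕ.+ c ⟧ - ⟦ b ℕ.+ d ⟧         ≈⟨ +-cong (×-homo-+ 1# a c) (-‿cong (×-homo-+ 1# b d)) ⟩
      (⟦ a ⟧ + ⟦ c ⟧) - (⟦ b ⟧ + ⟦ d ⟧) ≈⟨ +-interchange-minus _ _ _ _ ⟩
      (⟦ a ⟧ - ⟦ b ⟧) + (⟦ c ⟧ - ⟦ d ⟧) ∎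

    minus-*-minus : ∀ a b c d → (a * c + b * d) - (a * d + b * c) ≈ (a - b) * (c - d)
    minus-*-minus a b c d = begin
      (a * c + b * d) - (a * d + b * c)           ≈⟨ +-interchange-minus _ _ _ _ ⟩
      (a * c - a * d) + (b * d - b * c)           ≈⟨ +-cong (x[y-z]≈xy-xz a c d) (x[y-z]≈xy-xz b d c) ⟨
      a * (c - d) + b * (d - c)                   ≈⟨ +-congˡ (*-congˡ (⁻¹-anti-homo‿- c d)) ⟨
      a * (c - d) + b * - (c - d)                 ≈⟨ +-congˡ (-‿distribʳ-* b _) ⟨
      a * (c - d) - b * (c - d)                   ≈⟨ [y-z]x≈yx-zx (c - d) a b ⟨
      (a - b) * (c - d)                           ∎

    difference-* : ∀ ((a , b) (c , d) : ℕ × ℕ) →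
      difference (a ℕ.* c ℕ.+ b ℕ.* d , a ℕ.* d ℕ.+ b ℕ.* c) ≈ difference (a , b) * difference (c , d)
    difference-* (a , b) (c , d) = begin
      ⟦ a ℕ.* c ℕ.+ b ℕ.* d ⟧ - ⟦ a ℕ.* d ℕ.+ b ℕ.* c ⟧
        ≈⟨ +-cong (homo a c b d) (-‿cong (homo a d b c)) ⟩
      (⟦ a ⟧ * ⟦ c ⟧ + ⟦ b ⟧ * ⟦ d ⟧) - (⟦ a ⟧ * ⟦ d ⟧ + ⟦ b ⟧ * ⟦ c ⟧)
        ≈⟨ minus-*-minus _ _ _ _ ⟩
      (⟦ a ⟧ - ⟦ b ⟧) * (⟦ c ⟧ - ⟦ d ⟧) ∎
      where
      homo : ∀ a c b d → ⟦ a ℕ.* c ℕ.+ b ℕ.* d ⟧ ≈ ⟦ a ⟧ * ⟦ c ⟧ + ⟦ b ⟧ * ⟦ d ⟧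
      homo a c b d = trans (×-homo-+ 1# (a ℕ.* c) _) (+-cong (×1-homo-* a c) (×1-homo-* b d))

    difference-neg : ∀ x → difference (RawRing.-_ differences x) ≈ - difference x
    difference-neg (a , b) = sym (⁻¹-anti-homo‿- ⟦ a ⟧ ⟦ b ⟧)

    difference-cong : ∀ a b c d → a ℕ.+ d ≡ c ℕ.+ b → difference (a , b) ≈ difference (c , d)
    difference-cong a b c d a+d≡c+b = begin
      ⟦ a ⟧ - ⟦ b ⟧                       ≈⟨ +-identityʳ _ ⟨
      (⟦ a ⟧ - ⟦ b ⟧) + 0#                ≈⟨ +-congˡ (-‿inverseʳ ⟦ d ⟧) ⟨
      (⟦ a ⟧ - ⟦ b ⟧) + (⟦ d ⟧ - ⟦ d ⟧)   ≈⟨ difference-+ (a , b) (d , d) ⟨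
      ⟦ a ℕ.+ d ⟧ - ⟦ b ℕ.+ d ⟧           ≡⟨ ≡.cong₂ (λ x y → ⟦ x ⟧ - ⟦ y ⟧) a+d≡c+b (ℕ.+-comm b d) ⟩
      ⟦ c ℕ.+ b ⟧ - ⟦ d ℕ.+ b ⟧           ≈⟨ difference-+ (c , d) (b , b) ⟩
      (⟦ c ⟧ - ⟦ d ⟧) + (⟦ b ⟧ - ⟦ b ⟧)   ≈⟨ +-congˡ (-‿inverseʳ ⟦ b ⟧) ⟩
      (⟦ c ⟧ - ⟦ d ⟧) + 0#                ≈⟨ +-identityʳ _ ⟩
      ⟦ c ⟧ - ⟦ d ⟧                       ∎

    difference-cancel : ∀ a b → difference (cancel a b) ≈ difference (a , b)
    difference-cancel zero    b       = refl
    difference-cancel (suc a) zero    = refl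
    difference-cancel (suc a) (suc b) =
      trans (difference-cancel a b) (difference-cong a b (suc a) (suc b) (ℕ.+-suc a b))

    -- Unlike difference, sends the integers 0 and 1 to 0# and 1# definitionally.
    ⟦_⟧′ : ℕ × ℕ → Carrier
    ⟦ 0 , 0 ⟧′ = 0#
    ⟦ 1 , 0 ⟧′ = 1#
    ⟦ x     ⟧′ = difference x

    ⟦⟧′≈difference : ∀ x → ⟦ x ⟧′ ≈ difference x
    ⟦⟧′≈difference (0 , 0)           = sym (-‿inverseʳ 0#)
    ⟦⟧′≈difference (1 , 0)           = sym (trans (+-congˡ -0#≈0#) (trans (+-identityʳ _) (+-identityʳ 1#)))
    ⟦⟧′≈difference (0 , suc _)       = refl
    ⟦⟧′≈difference (1 , suc _)       = refl
    ⟦⟧′≈difference (suc (suc _) , _) = refl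

    homomorphism : differences -Raw-AlmostCommutative⟶ fromCommutativeRing R
    homomorphism = record
      { ⟦_⟧    = ⟦_⟧′
      ; +-homo = λ x@(a , b) y@(c , d) → trans (⟦⟧′≈difference (RawRing._+_ differences x y)) (trans (trans (difference-cancel (a ℕ.+ c) (b ℕ.+ d)) (difference-+ x y))
                           (sym (+-cong (⟦⟧′≈difference x) (⟦⟧′≈difference y))))
      ; *-homo = λ x@(a , b) y@(c , d) → trans (⟦⟧′≈difference (RawRing._*_ differences x y)) (trans (trans (difference-cancel (a ℕ.* c ℕ.+ b ℕ.* d) (a ℕ.* d ℕ.+ b ℕ.* c)) (difference-* x y))
                           (sym (*-cong (⟦⟧′≈difference x) (⟦⟧′≈difference y))))
      ; -‿homo = λ x → trans (⟦⟧′≈difference (RawRing.-_ differences x)) (trans (difference-neg x) (-‿cong (sym (⟦⟧′≈difference x))))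
      ; 0-homo = refl
      ; 1-homo = refl
      }

    _≟_ : ∀ x y → Maybe (⟦ x ⟧′ ≈ ⟦ y ⟧′)
    x@(a , b) ≟ y@(c , d) = Maybe.map
      (λ eq → trans (⟦⟧′≈difference x) (trans (difference-cong a b c d eq) (sym (⟦⟧′≈difference y))))
      (dec⇒weaklyDec ℕ._≟_ (a ℕ.+ d) (c ℕ.+ b))

  open RingSolver differences (fromCommutativeRing R) homomorphism _≟_ public
    using (Polynomial; solve; _:=_; _:+_; _:*_; _:-_; :-_)
  open RingSolver differences (fromCommutativeRing R) homomorphism _≟_ using (con)

  :1 : ∀ {n} → Polynomial n
  :1 = con (1 , 0)


  :0 : ∀ {n} → Polynomial n
  :0 = con (0 , 0)

module ListSum (S : CommutativeSemiring 0ℓ 0ℓ) where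
  open CommutativeSemiring S
  open SetoidReasoning setoid
  open RawSemiringDefs rawSemiring using (sum)

  private variable A B C : Set

  ∑ : List A → (A → Carrier) → Carrier
  ∑ []       f = 0#
  ∑ (x ∷ xs) f = f x + ∑ xs f

  ∑-cong : (xs : List A) {f g : A → Carrier} → (∀ x → f x ≈ g x) → ∑ xs f ≈ ∑ xs g
  ∑-cong []       f≈g = refl
  ∑-cong (x ∷ xs) f≈g = +-cong (f≈g x) (∑-cong xs f≈g)

  ∑-0 : (xs : List A) {f : A → Carrier} → (∀ x → f x ≈ 0#) → ∑ xs f ≈ 0#
  ∑-0 []       f≈0 = refl
  ∑-0 (x ∷ xs) f≈0 = trans (+-cong (f≈0 x) (∑-0 xs f≈0)) (+-identityˡ 0#)

  ∑-++ : (xs ys : List A) {f : A → Carrier} → ∑ (xs List.++ ys) f ≈ ∑ xs f + ∑ ys f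
  ∑-++ []       ys = sym (+-identityˡ _)
  ∑-++ (x ∷ xs) ys = trans (+-congˡ (∑-++ xs ys)) (sym (+-assoc _ _ _))

  ∑-map : (g : A → B) (xs : List A) {f : B → Carrier} → ∑ (List.map g xs) f ≈ ∑ xs (f ∘ g)
  ∑-map g []       = refl
  ∑-map g (x ∷ xs) = +-congˡ (∑-map g xs)

  *-distribˡ-∑ : (c : Carrier) (xs : List A) {f : A → Carrier} → c * ∑ xs f ≈ ∑ xs (λ x → c * f x)
  *-distribˡ-∑ c []       = zeroʳ c
  *-distribˡ-∑ c (x ∷ xs) = trans (distribˡ c _ _) (+-congˡ (*-distribˡ-∑ c xs))

  *-distribʳ-∑ : (c : Carrier) (xs : List A) {f : A → Carrier} → ∑ xs f * c ≈ ∑ xs (λ x → f x * c)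
  *-distribʳ-∑ c xs = trans (*-comm _ c) (trans (*-distribˡ-∑ c xs) (∑-cong xs (λ x → *-comm c _)))

  ∑-distrib-+ : (xs : List A) {f g : A → Carrier} → ∑ xs (λ x → f x + g x) ≈ ∑ xs f + ∑ xs g
  ∑-distrib-+ []                   = sym (+-identityˡ 0#)
  ∑-distrib-+ (x ∷ xs) {f} {g} = begin
    (f x + g x) + ∑ xs (λ x → f x + g x) ≈⟨ +-congˡ (∑-distrib-+ xs) ⟩
    (f x + g x) + (∑ xs f + ∑ xs g)      ≈⟨ interchange (f x) (g x) _ _ ⟩
    (f x + ∑ xs f) + (g x + ∑ xs g)      ∎
    where open import Algebra.Properties.CommutativeSemigroup +-commutativeSemigroup using (interchange)

  ∑-comm : (xs : List A) (ys : List B) {f : A → B → Carrier} →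
           ∑ xs (λ x → ∑ ys (f x)) ≈ ∑ ys (λ y → ∑ xs (λ x → f x y))
  ∑-comm []       ys = sym (∑-0 ys (λ _ → refl))
  ∑-comm (x ∷ xs) ys = trans (+-congˡ (∑-comm xs ys)) (sym (∑-distrib-+ ys))

  ∑-cartesianProductWith : (h : A → B → C) (xs : List A) (ys : List B) {f : C → Carrier} →
    ∑ (List.cartesianProductWith h xs ys) f ≈ ∑ xs (λ x → ∑ ys (λ y → f (h x y)))
  ∑-cartesianProductWith h []       ys = refl
  ∑-cartesianProductWith h (x ∷ xs) ys =
    trans (∑-++ (List.map (h x) ys) _) (+-cong (∑-map (h x) ys) (∑-cartesianProductWith h xs ys))

  ∑-tabulate : ∀ {n} (g : Fin n → A) (f : A → Carrier) → ∑ (List.tabulate g) f ≈ sum (f ∘ g)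
  ∑-tabulate {n = zero}  g f = refl
  ∑-tabulate {n = suc n} g f = +-congˡ (∑-tabulate (g ∘ suc) f)

length-cartesianProductWith : {A B C : Set} (h : A → B → C) (xs : List A) (ys : List B) →
  length (List.cartesianProductWith h xs ys) ≡ length xs ℕ.* length ys
length-cartesianProductWith h []       ys = ≡.refl
length-cartesianProductWith h (x ∷ xs) ys = ≡.trans (List.length-++ (List.map (h x) ys))
  (≡.cong₂ ℕ._+_ (List.length-map (h x) ys) (length-cartesianProductWith h xs ys))

-- shiftSum c lists the coefficients of (x₁ + ⋯ + xₙ) q if c lists those of q.
shiftSum : ∀ {n} → (Vec ℕ n → ℕ) → Vec ℕ n → ℕ
shiftSum c []          = 0
shiftSum c (zero  ∷ α) = shiftSum (c ∘ (zero ∷_)) α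
shiftSum c (suc a ∷ α) = shiftSum (c ∘ (suc a ∷_)) α ℕ.+ c (a ∷ α)

multinomial : ∀ {n} → ℕ → Vec ℕ n → ℕ
multinomial zero    []          = 1
multinomial zero    (zero  ∷ α) = multinomial zero α
multinomial zero    (suc _ ∷ α) = 0
multinomial (suc d) α           = shiftSum (multinomial d) α

shiftSum-zero : ∀ {n} (c : Vec ℕ n → ℕ) k d → (∀ β → k ℕ.+ Vec.sum β ≢ d → c β ≡ 0) →
  ∀ α → k ℕ.+ Vec.sum α ≢ suc d → shiftSum c α ≡ 0
shiftSum-zero c k d c≡0 []          α≢d = ≡.refl
shiftSum-zero c k d c≡0 (zero  ∷ α) α≢d = shiftSum-zero _ k d (c≡0 ∘ (zero ∷_)) α α≢d
shiftSum-zero c k d c≡0 (suc a ∷ α) α≢d = ≡.cong₂ ℕ._+_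
  (shiftSum-zero _ (k ℕ.+ suc a) d
    (λ β β≢d → c≡0 (suc a ∷ β) (β≢d ∘ ≡.trans (ℕ.+-assoc k _ _)))
    α (α≢d ∘ ≡.trans (≡.sym (ℕ.+-assoc k _ _))))
  (c≡0 (a ∷ α) (α≢d ∘ λ eq → ≡.trans (ℕ.+-suc k _) (≡.cong suc eq)))

shiftSum-pos : ∀ {n} (c : Vec ℕ n → ℕ) k d → k ℕ.≤ d → (∀ β → k ℕ.+ Vec.sum β ≡ d → 0 ℕ.< c β) →
  ∀ α → k ℕ.+ Vec.sum α ≡ suc d → 0 ℕ.< shiftSum c α
shiftSum-pos c k d k≤d c>0 []          α≡d =
  contradiction (≡.trans (≡.sym α≡d) (ℕ.+-identityʳ k)) (ℕ.>⇒≢ (s≤s k≤d))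
shiftSum-pos c k d k≤d c>0 (zero  ∷ α) α≡d = shiftSum-pos _ k d k≤d (c>0 ∘ (zero ∷_)) α α≡d
shiftSum-pos c k d k≤d c>0 (suc a ∷ α) α≡d = ℕ.≤-trans
  (c>0 (a ∷ α) (ℕ.suc-injective (≡.trans (≡.sym (ℕ.+-suc k _)) α≡d)))
  (ℕ.m≤n+m _ _)

multinomial-zero : ∀ {n} d (α : Vec ℕ n) → Vec.sum α ≢ d → multinomial d α ≡ 0
multinomial-zero zero    []          α≢d = contradiction ≡.refl α≢d
multinomial-zero zero    (zero  ∷ α) α≢d = multinomial-zero zero α α≢d
multinomial-zero zero    (suc _ ∷ α) α≢d = ≡.refl
multinomial-zero (suc d) α           α≢d = shiftSum-zero _ 0 d (multinomial-zero d) α α≢d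

multinomial-pos : ∀ {n} d (α : Vec ℕ n) → Vec.sum α ≡ d → 0 ℕ.< multinomial d α
multinomial-pos zero    []          α≡d = s≤s z≤n
multinomial-pos zero    (zero  ∷ α) α≡d = multinomial-pos zero α α≡d
multinomial-pos (suc d) α           α≡d = shiftSum-pos _ 0 d z≤n (multinomial-pos d) α α≡d

module PowersOfLinearForms (R : CommutativeRing 0ℓ 0ℓ) where
  open CommutativeRing R hiding (zero)
  open Mult semiring using (×-homo-+; ×-congʳ; ×-comm-*) renaming (_×_ to _·_)
  open Polynomials rawRing
  open RawSemiringDefs (RawRing.rawSemiring rawRing) using (sum; _^_)
  open SetoidReasoning setoid
  open IntegerCoefficients R

  mon : ∀ {n} → Vec Carrier n → Vec ℕ n → Carrier
  mon []       []      = 1#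
  mon (x ∷ xs) (a ∷ α) = x ^ a * mon xs α

  IsLinear : ∀ {n} → Coeffs n → Vec Carrier n → Set
  IsLinear p []      = p [] ≈ 0#
  IsLinear p (x ∷ L) = IsLinear (p ∘ (0 ∷_)) L
                     × (∀ α → p (1 ∷ α) ≈ x * one α)
                     × (∀ k α → p (suc (suc k) ∷ α) ≈ 0#)

  one-zero : ∀ {n} (α : Vec ℕ n) → Vec.sum α ≢ 0 → one α ≈ 0#
  one-zero []          α≢0 = contradiction ≡.refl α≢0
  one-zero (zero  ∷ α) α≢0 = one-zero α α≢0
  one-zero (suc _ ∷ α) α≢0 = refl

  linear : ∀ {n} → Vec Carrier n → Coeffs n
  linear []      _                 = 0#
  linear (x ∷ L) (0 ∷ α)           = linear L α
  linear (x ∷ L) (1 ∷ α)           = x * one α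
  linear (x ∷ L) (suc (suc _) ∷ α) = 0#

  linear-isLinear : ∀ {n} (L : Vec Carrier n) → IsLinear (linear L) L
  linear-isLinear []      = refl
  linear-isLinear (x ∷ L) = linear-isLinear L , (λ _ → refl) , (λ _ _ → refl)

  linearForm : ∀ {n} → Vec Carrier n → Form n 1
  linearForm L = record { coeff = linear L ; homogeneous = homogeneous′ L }
    where
    homogeneous′ : ∀ {n} (L : Vec Carrier n) α → Vec.sum α ≢ 1 → linear L α ≈ 0#
    homogeneous′ []      α                 α≢1 = refl
    homogeneous′ (x ∷ L) (0 ∷ α)           α≢1 = homogeneous′ L α α≢1
    homogeneous′ (x ∷ L) (1 ∷ α)           α≢1 = trans (*-congˡ (one-zero α (α≢1 ∘ ≡.cong suc))) (zeroʳ x)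
    homogeneous′ (x ∷ L) (suc (suc _) ∷ α) α≢1 = refl

  linear-coefficients : ∀ {n} (p : Coeffs n) → (∀ α → Vec.sum α ≢ 1 → p α ≈ 0#) → ∃ (IsLinear p)
  linear-coefficients {zero}  p hom = [] , hom [] λ ()
  linear-coefficients {suc n} p hom =
    let L , isLinear = linear-coefficients (p ∘ (0 ∷_)) (hom ∘ (0 ∷_))
    in p (1 ∷ Vec.replicate n 0) ∷ L , isLinear , constant (p ∘ (1 ∷_)) (λ α α≢0 → hom (1 ∷ α) (α≢0 ∘ ℕ.suc-injective))
       , λ k α → hom (suc (suc k) ∷ α) λ ()
    where
    constant : ∀ {n} (q : Coeffs n) → (∀ α → Vec.sum α ≢ 0 → q α ≈ 0#) →
               ∀ α → q α ≈ q (Vec.replicate n 0) * one α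
    constant q hom []          = sym (*-identityʳ _)
    constant q hom (zero  ∷ α) = constant (q ∘ (0 ∷_)) (hom ∘ (0 ∷_)) α
    constant q hom (suc a ∷ α) = trans (hom (suc a ∷ α) λ ()) (sym (zeroʳ _))

  sum-zero : ∀ {n} (t : Fin n → Carrier) → (∀ i → t i ≈ 0#) → sum t ≈ 0#
  sum-zero {zero}  t t≈0 = refl
  sum-zero {suc n} t t≈0 = trans (+-cong (t≈0 zero) (sum-zero (t ∘ suc) (t≈0 ∘ suc))) (+-identityˡ 0#)

  mul-zeroˡ : ∀ {n} {p q : Coeffs n} → (∀ β → p β ≈ 0#) → ∀ α → mul p q α ≈ 0#
  mul-zeroˡ p≈0 []      = trans (*-congʳ (p≈0 [])) (zeroˡ _)
  mul-zeroˡ {q = q} p≈0 (a ∷ α) = sum-zero {suc a} _ (λ i → mul-zeroˡ {q = q ∘ (a ℕ.∸ toℕ i ∷_)} (p≈0 ∘ (toℕ i ∷_)) α)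

  mul-constˡ : ∀ {n} x {p q : Coeffs n} → (∀ β → p β ≈ x * one β) → ∀ α → mul p q α ≈ x * q α
  mul-constˡ x p≈x []      = *-congʳ (trans (p≈x []) (*-identityʳ x))
  mul-constˡ x p≈x (a ∷ α) = trans
    (+-cong (mul-constˡ x (p≈x ∘ (0 ∷_)) α)
            (sum-zero {a} _ (λ i → mul-zeroˡ (λ β → trans (p≈x (suc (toℕ i) ∷ β)) (zeroʳ x)) α)))
    (+-identityʳ _)

  mul-linear : ∀ {n} {p q : Coeffs n} (L : Vec Carrier n) (c : Vec ℕ n → ℕ) u → IsLinear p L →
    (∀ β → q β ≈ c β · (u * mon L β)) → ∀ α → mul p q α ≈ shiftSum c α · (u * mon L α)
  mul-linear [] c u p[]≈0 q≈ [] = trans (*-congʳ p[]≈0) (zeroˡ _)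
  mul-linear {p = p} {q} (x ∷ L) c u (p₀ , p₁ , p₂) q≈ (zero ∷ α) = begin
    mul (p ∘ (0 ∷_)) (q ∘ (0 ∷_)) α + 0#
      ≈⟨ +-identityʳ _ ⟩
    mul (p ∘ (0 ∷_)) (q ∘ (0 ∷_)) α
      ≈⟨ mul-linear L (c ∘ (0 ∷_)) u p₀
           (λ β → trans (q≈ (0 ∷ β)) (×-congʳ (c (0 ∷ β)) (*-congˡ (*-identityˡ _)))) α ⟩
    shiftSum (c ∘ (0 ∷_)) α · (u * mon L α)
      ≈⟨ ×-congʳ (shiftSum (c ∘ (0 ∷_)) α) (*-congˡ (*-identityˡ _)) ⟨
    shiftSum (c ∘ (0 ∷_)) α · (u * (1# * mon L α)) ∎
  mul-linear {p = p} {q} (x ∷ L) c u (p₀ , p₁ , p₂) q≈ (suc a ∷ α) = begin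
    mul (p ∘ (0 ∷_)) (q ∘ (suc a ∷_)) α + (mul (p ∘ (1 ∷_)) (q ∘ (a ∷_)) α + rest)
      ≈⟨ +-cong first (trans (+-cong second (sum-zero {a} _ (λ i → mul-zeroˡ (p₂ (toℕ i)) α))) (+-identityʳ _)) ⟩
    shiftSum (c ∘ (suc a ∷_)) α · y + c (a ∷ α) · y
      ≈⟨ ×-homo-+ y (shiftSum (c ∘ (suc a ∷_)) α) (c (a ∷ α)) ⟨
    (shiftSum (c ∘ (suc a ∷_)) α ℕ.+ c (a ∷ α)) · y ∎
    where
    y rest : Carrier
    y    = u * (x ^ suc a * mon L α)
    rest = sum {a} (λ i → mul (p ∘ (suc (suc (toℕ i)) ∷_)) (q ∘ (a ℕ.∸ suc (toℕ i) ∷_)) α)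

    first : mul (p ∘ (0 ∷_)) (q ∘ (suc a ∷_)) α ≈ shiftSum (c ∘ (suc a ∷_)) α · y
    first = trans
      (mul-linear L (c ∘ (suc a ∷_)) (u * x ^ suc a) p₀
        (λ β → trans (q≈ (suc a ∷ β)) (×-congʳ (c (suc a ∷ β)) (sym (*-assoc u _ _)))) α)
      (×-congʳ (shiftSum (c ∘ (suc a ∷_)) α) (*-assoc u _ _))

    second : mul (p ∘ (1 ∷_)) (q ∘ (a ∷_)) α ≈ c (a ∷ α) · y
    second = begin
      mul (p ∘ (1 ∷_)) (q ∘ (a ∷_)) α                 ≈⟨ mul-constˡ x p₁ α ⟩
      x * q (a ∷ α)                                   ≈⟨ *-congˡ (q≈ (a ∷ α)) ⟩
      x * c (a ∷ α) · (u * (x ^ a * mon L α))         ≈⟨ ×-comm-* (c (a ∷ α)) x _ ⟩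
      c (a ∷ α) · (x * (u * (x ^ a * mon L α)))       ≈⟨ ×-congʳ (c (a ∷ α)) (solve 4 (λ x u v w →
                                                           x :* (u :* (v :* w)) := u :* ((x :* v) :* w))
                                                           refl x u (x ^ a) (mon L α)) ⟩
      c (a ∷ α) · y                                   ∎

  module _ {n : ℕ} where
    open RawSemiringDefs (RawRing.rawSemiring (polynomialRing n)) public using ()
      renaming (_^_ to _^ₚ_; sum to Σₚ)

  power-coefficient : ∀ {n} {p : Coeffs n} (L : Vec Carrier n) → IsLinear p L → ∀ d α →
    (p ^ₚ d) α ≈ multinomial d α · mon L α
  power-coefficient []      lin zero []          = sym (+-identityʳ 1#)
  power-coefficient {p = p} (x ∷ L) lin zero (zero ∷ α)  =
    trans (power-coefficient {p = p ∘ (0 ∷_)} L (proj₁ lin) zero α)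
      (×-congʳ (multinomial zero α) (sym (*-identityˡ _)))
  power-coefficient (x ∷ L) lin zero (suc _ ∷ α) = refl
  power-coefficient {p = p} L lin (suc d) α = trans
    (mul-linear {p = p} {p ^ₚ d} L (multinomial d) 1# lin
      (λ β → trans (power-coefficient L lin d β) (×-congʳ (multinomial d β) (sym (*-identityˡ _)))) α)
    (×-congʳ (shiftSum (multinomial d) α) (*-identityˡ _))

module OrderedField (ℝ : CompleteOrderedField) where
  open CompleteOrderedField ℝ public
    renaming (refl to ≈-refl; sym to ≈-sym; trans to ≈-trans)
    hiding (zero; UpperBound; supremum; _<_)
  open CompleteOrderedField ℝ using (_<_) public
  open IsTotalOrder isTotalOrder public
    using (total; antisym; isPartialOrder)
    renaming (reflexive to ≤-reflexive; refl to ≤-refl; trans to ≤-trans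
             ; ≤-respˡ-≈ to ≤-respˡ; ≤-respʳ-≈ to ≤-respʳ)
  open RawSemiringDefs (RawRing.rawSemiring rawRing) public using (_^_; sum)
  open Exp commutativeSemiring public using (^-congˡ; ^-homo-*; ^-assocʳ; ^-distrib-*)
  open Mult semiring public using (×-homo-+; ×-homo-1; ×1-homo-*) renaming (_×_ to _·_)
  open IntegerCoefficients commutativeRing public

  poset : Poset 0ℓ 0ℓ 0ℓ
  poset = record { isPartialOrder = isPartialOrder }

  module ≤-Reasoning = PosetReasoning poset
  module ≈-Reasoning = SetoidReasoning setoid

  nat : ℕ → Carrier
  nat = ι ℝ

  ≤-from : ∀ {x y} d → 0# ≤ d → x + d ≈ y → x ≤ y
  ≤-from {x} {y} d 0≤d x+d≈y = begin
    x      ≈⟨ +-identityˡ x ⟨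
    0# + x ≤⟨ +-monoˡ-≤ x 0≤d ⟩
    d + x  ≈⟨ +-comm d x ⟩
    x + d  ≈⟨ x+d≈y ⟩
    y      ∎
    where open ≤-Reasoning

  0≤y-x : ∀ {x y} → x ≤ y → 0# ≤ y - x
  0≤y-x {x} x≤y = ≤-respˡ (-‿inverseʳ x) (+-monoˡ-≤ (- x) x≤y)

  +-mono : ∀ {w x y z} → w ≤ x → y ≤ z → w + y ≤ x + z
  +-mono {w} {x} {y} {z} w≤x y≤z =
    ≤-trans (+-monoˡ-≤ y w≤x) (≤-respˡ (+-comm y x) (≤-respʳ (+-comm z x) (+-monoˡ-≤ x y≤z)))

  0≤+ : ∀ {x y} → 0# ≤ x → 0# ≤ y → 0# ≤ x + y
  0≤+ 0≤x 0≤y = ≤-respˡ (+-identityˡ 0#) (+-mono 0≤x 0≤y)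

  neg-anti : ∀ {x y} → x ≤ y → - y ≤ - x
  neg-anti {x} {y} x≤y = ≤-from (y - x) (0≤y-x x≤y)
    (solve 2 (λ x y → :- y :+ (y :- x) := :- x) ≈-refl x y)

  neg-nonNeg : ∀ {x} → x ≤ 0# → 0# ≤ - x
  neg-nonNeg {x} x≤0 = ≤-from (0# - x) (0≤y-x x≤0) (solve 1 (λ x → :0 :+ (:0 :- x) := :- x) ≈-refl x)

  *-monoʳ : ∀ {x y} z → 0# ≤ z → x ≤ y → z * x ≤ z * y
  *-monoʳ {x} {y} z 0≤z x≤y = ≤-from (z * (y - x)) (*-nonNeg 0≤z (0≤y-x x≤y))
    (solve 3 (λ x y z → z :* x :+ z :* (y :- x) := z :* y) ≈-refl x y z)

  *-monoˡ : ∀ {x y} z → 0# ≤ z → x ≤ y → x * z ≤ y * z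
  *-monoˡ z 0≤z x≤y = ≤-respˡ (*-comm z _) (≤-respʳ (*-comm z _) (*-monoʳ z 0≤z x≤y))

  *-mono : ∀ {w x y z} → 0# ≤ w → 0# ≤ y → w ≤ x → y ≤ z → w * y ≤ x * z
  *-mono {x = x} {y} 0≤w 0≤y w≤x y≤z = ≤-trans (*-monoˡ y 0≤y w≤x) (*-monoʳ x (≤-trans 0≤w w≤x) y≤z)

  0≤x² : ∀ x → 0# ≤ x * x
  0≤x² x with total 0# x
  ... | inj₁ 0≤x = *-nonNeg 0≤x 0≤x
  ... | inj₂ x≤0 = ≤-respʳ (solve 1 (λ x → :- x :* :- x := x :* x) ≈-refl x)
                     (*-nonNeg (neg-nonNeg x≤0) (neg-nonNeg x≤0))

  0≤1 : 0# ≤ 1#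
  0≤1 = ≤-respʳ (*-identityʳ 1#) (0≤x² 1#)

  ≰⇒≥ : ∀ {x y} → ¬ (x ≤ y) → y ≤ x
  ≰⇒≥ {x} {y} x≰y with total x y
  ... | inj₁ x≤y = contradiction x≤y x≰y
  ... | inj₂ y≤x = y≤x

  ≰⇒> : ∀ {x y} → ¬ (x ≤ y) → y < x
  ≰⇒> x≰y = ≰⇒≥ x≰y , λ y≈x → x≰y (≤-reflexive (≈-sym y≈x))

  <⇒≱ : ∀ {x y} → x < y → ¬ (y ≤ x)
  <⇒≱ (x≤y , x≉y) y≤x = x≉y (antisym x≤y y≤x)

  0<1 : 0# < 1#
  0<1 = 0≤1 , 0≉1

  <-≤-trans : ∀ {x y z} → x < y → y ≤ z → x < z
  <-≤-trans (x≤y , x≉y) y≤z = ≤-trans x≤y y≤z , λ x≈z → x≉y (antisym x≤y (≤-respʳ (≈-sym x≈z) y≤z))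

  0<x-y : ∀ {x y} → y < x → 0# < x - y
  0<x-y {x} {y} (y≤x , y≉x) = 0≤y-x y≤x , λ 0≈x-y → y≉x (begin
    y             ≈⟨ +-identityʳ y ⟨
    y + 0#        ≈⟨ +-congˡ 0≈x-y ⟩
    y + (x - y)   ≈⟨ solve 2 (λ x y → y :+ (x :- y) := x) ≈-refl x y ⟩
    x             ∎)
    where open ≈-Reasoning

  0<+ : ∀ {x y} → 0# < x → 0# ≤ y → 0# < x + y
  0<+ {x} {y} 0<x 0≤y = <-≤-trans 0<x (≤-from y 0≤y ≈-refl)

  x*y≈0⇒y≈0 : ∀ {x y} → ¬ (x ≈ 0#) → x * y ≈ 0# → y ≈ 0#
  x*y≈0⇒y≈0 {x} {y} x≉0 xy≈0 = begin
    y               ≈⟨ *-identityˡ y ⟨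
    1# * y          ≈⟨ *-congʳ (⁻¹-inverseʳ x≉0) ⟨
    x * x ⁻¹ * y    ≈⟨ solve 3 (λ x x⁻¹ y → x :* x⁻¹ :* y := x⁻¹ :* (x :* y)) ≈-refl x (x ⁻¹) y ⟩
    x ⁻¹ * (x * y)  ≈⟨ *-congˡ xy≈0 ⟩
    x ⁻¹ * 0#       ≈⟨ zeroʳ _ ⟩
    0#              ∎
    where open ≈-Reasoning

  *-cancelˡ : ∀ {x y} z → ¬ (z ≈ 0#) → z * x ≈ z * y → x ≈ y
  *-cancelˡ {x} {y} z z≉0 zx≈zy = begin
    x           ≈⟨ solve 2 (λ x y → x := (x :- y) :+ y) ≈-refl x y ⟩
    (x - y) + y ≈⟨ +-congʳ (x*y≈0⇒y≈0 z≉0 (begin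
                     z * (x - y)   ≈⟨ solve 3 (λ x y z → z :* (x :- y) := z :* x :- z :* y) ≈-refl x y z ⟩
                     z * x - z * y ≈⟨ +-congʳ zx≈zy ⟩
                     z * y - z * y ≈⟨ -‿inverseʳ _ ⟩
                     0#            ∎)) ⟩
    0# + y      ≈⟨ +-identityˡ y ⟩
    y           ∎
    where open ≈-Reasoning

  0<* : ∀ {x y} → 0# < x → 0# < y → 0# < x * y
  0<* (0≤x , 0≉x) (0≤y , 0≉y) = *-nonNeg 0≤x 0≤y ,
    λ 0≈xy → 0≉y (≈-sym (x*y≈0⇒y≈0 (0≉x ∘ ≈-sym) (≈-sym 0≈xy)))

  *-cancelˡ-≤ : ∀ {x y} z → 0# < z → z * x ≤ z * y → x ≤ y
  *-cancelˡ-≤ {x} {y} z (0≤z , 0≉z) zx≤zy with total x y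
  ... | inj₁ x≤y = x≤y
  ... | inj₂ y≤x = ≤-reflexive (*-cancelˡ z (0≉z ∘ ≈-sym) (antisym zx≤zy (*-monoʳ z 0≤z y≤x)))

  >⇒≉0 : ∀ {x} → 0# < x → ¬ (x ≈ 0#)
  >⇒≉0 (_ , 0≉x) = 0≉x ∘ ≈-sym

  0<⁻¹ : ∀ {x} → 0# < x → 0# < x ⁻¹
  0<⁻¹ {x} 0<x = 0≤x⁻¹ , λ 0≈x⁻¹ → 0≉1 (≈-trans (≈-trans (≈-sym (zeroʳ x)) (*-congˡ 0≈x⁻¹)) xx⁻¹≈1)
    where
    xx⁻¹≈1 : x * x ⁻¹ ≈ 1#
    xx⁻¹≈1 = ⁻¹-inverseʳ (>⇒≉0 0<x)
    0≤x⁻¹ : 0# ≤ x ⁻¹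
    0≤x⁻¹ = *-cancelˡ-≤ x 0<x (≤-respˡ (≈-sym (zeroʳ x)) (≤-respʳ (≈-sym xx⁻¹≈1) 0≤1))

  ÷-cancel : ∀ {x y} → ¬ (y ≈ 0#) → y * (x * y ⁻¹) ≈ x
  ÷-cancel {x} {y} y≉0 = begin
    y * (x * y ⁻¹) ≈⟨ solve 3 (λ x y y⁻¹ → y :* (x :* y⁻¹) := x :* (y :* y⁻¹)) ≈-refl x y (y ⁻¹) ⟩
    x * (y * y ⁻¹) ≈⟨ *-congˡ (⁻¹-inverseʳ y≉0) ⟩
    x * 1#         ≈⟨ *-identityʳ x ⟩
    x              ∎
    where open ≈-Reasoning

  ^-nonNeg : ∀ {x} n → 0# ≤ x → 0# ≤ x ^ n
  ^-nonNeg zero    0≤x = 0≤1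
  ^-nonNeg (suc n) 0≤x = *-nonNeg 0≤x (^-nonNeg n 0≤x)

  ^-pos : ∀ {x} n → 0# < x → 0# < x ^ n
  ^-pos zero    0<x = 0<1
  ^-pos (suc n) 0<x = 0<* 0<x (^-pos n 0<x)

  ^-mono : ∀ {x y} n → 0# ≤ x → x ≤ y → x ^ n ≤ y ^ n
  ^-mono zero    0≤x x≤y = ≤-refl
  ^-mono (suc n) 0≤x x≤y = *-mono 0≤x (^-nonNeg n 0≤x) x≤y (^-mono n 0≤x x≤y)

  1^n≈1 : ∀ n → 1# ^ n ≈ 1#
  1^n≈1 zero    = ≈-refl
  1^n≈1 (suc n) = ≈-trans (*-identityˡ _) (1^n≈1 n)

  nat-+ : ∀ m n → nat (m ℕ.+ n) ≈ nat m + nat n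
  nat-+ m n = ×-homo-+ 1# m n

  nat-* : ∀ m n → nat (m ℕ.* n) ≈ nat m * nat n
  nat-* = ×1-homo-*

  nat-^ : ∀ m n → nat (m ℕ.^ n) ≈ nat m ^ n
  nat-^ m zero    = ×-homo-1 1#
  nat-^ m (suc n) = ≈-trans (nat-* m (m ℕ.^ n)) (*-congˡ (nat-^ m n))

  nat-1 : nat 1 ≈ 1#
  nat-1 = ×-homo-1 1#

  0≤nat : ∀ n → 0# ≤ nat n
  0≤nat zero    = ≤-refl
  0≤nat (suc n) = 0≤+ 0≤1 (0≤nat n)

  0<nat : ∀ {n} → 0 ℕ.< n → 0# < nat n
  0<nat {suc n} _ = 0<+ 0<1 (0≤nat n)

  nat-mono : ∀ {m n} → m ℕ.≤ n → nat m ≤ nat n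
  nat-mono {n = n} z≤n       = 0≤nat n
  nat-mono         (s≤s m≤n) = +-mono ≤-refl (nat-mono m≤n)

  nat-mono-< : ∀ {m n} → m ℕ.< n → nat m < nat n
  nat-mono-< {m} {n} m<n = <-≤-trans (≤-from 1# 0≤1 (+-comm _ 1#) , m≉1+m) (nat-mono m<n)
    where
    m≉1+m : ¬ (nat m ≈ 1# + nat m)
    m≉1+m eq = 0≉1 (begin
      0#                        ≈⟨ -‿inverseʳ (nat m) ⟨
      nat m - nat m             ≈⟨ +-congʳ eq ⟩
      1# + nat m - nat m        ≈⟨ solve 1 (λ m → :1 :+ m :- m := :1) ≈-refl (nat m) ⟩
      1#                        ∎)
      where open ≈-Reasoning

  nat-cancel-≤ : ∀ {m n} → nat m ≤ nat n → m ℕ.≤ n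
  nat-cancel-≤ {m} {n} le with m ℕ.≤? n
  ... | yes m≤n = m≤n
  ... | no  m≰n = contradiction le (<⇒≱ (nat-mono-< (ℕ.≰⇒> m≰n)))

  x+x-nonNeg⇒x-nonNeg : ∀ {x} → 0# ≤ x + x → 0# ≤ x
  x+x-nonNeg⇒x-nonNeg {x} 0≤x+x with total 0# x
  ... | inj₁ 0≤x = 0≤x
  ... | inj₂ x≤0 = ≤-trans 0≤x+x (≤-respʳ (+-identityˡ x) (+-monoˡ-≤ x x≤0))

  module _ (em : ExcludedMiddle 0ℓ) where
    open CompleteOrderedField ℝ using (UpperBound; supremum)

    archimedean : ∀ x → ∃ λ n → x ≤ nat n
    archimedean x with em {∃ λ n → x ≤ nat n}
    ... | yes bounded  = bounded
    ... | no  ¬bounded = contradiction (s≤b (s - 1#) below) (<⇒≱ s-1<s)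
      where
      S : Carrier → Set
      S y = ∃ λ n → y ≈ nat n

      S≤x : UpperBound S x
      S≤x y (n , y≈n) = ≤-respˡ (≈-sym y≈n) (≰⇒≥ (λ x≤n → ¬bounded (n , x≤n)))

      sup = supremum S (0# , 0 , ≈-refl) (x , S≤x)
      s   = proj₁ sup
      s≤b = proj₂ (proj₂ sup)

      below : UpperBound S (s - 1#)
      below y (n , y≈n) = ≤-respˡ eq (+-monoˡ-≤ (- 1#) (proj₁ (proj₂ sup) (nat (suc n)) (suc n , ≈-refl)))
        where
        eq : nat (suc n) - 1# ≈ y
        eq = ≈-trans (solve 1 (λ n → :1 :+ n :- :1 := n) ≈-refl (nat n)) (≈-sym y≈n)

      s-1<s : s - 1# < s
      s-1<s = ≤-from 1# 0≤1 (solve 1 (λ s → s :- :1 :+ :1 := s) ≈-refl s) , λ eq → 0≉1 (begin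
        0#            ≈⟨ -‿inverseʳ s ⟨
        s - s         ≈⟨ +-congˡ (-‿cong eq) ⟨
        s - (s - 1#)  ≈⟨ solve 1 (λ s → s :- (s :- :1) := :1) ≈-refl s ⟩
        1#            ∎)
        where open ≈-Reasoning

module IntermediateValue (ℝ : CompleteOrderedField) where
  open OrderedField ℝ

  private variable
    a b x y : Carrier
    f g     : Carrier → Carrier

  -- ∣ x ∣ ≤ b
  Within : Carrier → Carrier → Set
  Within b x = - b ≤ x × x ≤ b

  within-≈ : x ≈ y → Within b x → Within b y
  within-≈ x≈y (l , u) = ≤-respʳ x≈y l , ≤-respˡ x≈y u

  within-cong : a ≈ b → Within a x → Within b x
  within-cong a≈b (l , u) = ≤-respˡ (-‿cong a≈b) l , ≤-respʳ a≈b u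

  within-+ : Within a x → Within b y → Within (a + b) (x + y)
  within-+ {a} {x} {b} {y} (l , u) (l′ , u′) =
    ≤-respˡ (solve 2 (λ a b → :- a :+ :- b := :- (a :+ b)) ≈-refl a b) (+-mono l l′) , +-mono u u′

  within-neg : Within b x → Within b (- x)
  within-neg {b} {x} (l , u) =
    neg-anti u , ≤-respʳ (solve 1 (λ b → :- (:- b) := b) ≈-refl b) (neg-anti l)

  within-upper : Within a x → Within b y → x * y ≤ a * b
  within-upper {a} {x} {b} {y} (l , u) (l′ , u′) =
    ≤-from (a * b - x * y) (x+x-nonNeg⇒x-nonNeg (≤-respʳ
      (solve 4 (λ a x b y → (a :- x) :* (b :+ y) :+ (a :+ x) :* (b :- y)
                         := (a :* b :- x :* y) :+ (a :* b :- x :* y)) ≈-refl a x b y)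
      (0≤+ (*-nonNeg (0≤y-x u) (nonNeg l′)) (*-nonNeg (nonNeg l) (0≤y-x u′)))))
      (solve 4 (λ a x b y → x :* y :+ (a :* b :- x :* y) := a :* b) ≈-refl a x b y)
    where
    nonNeg : ∀ {a x} → - a ≤ x → 0# ≤ a + x
    nonNeg {a} {x} l = ≤-respʳ (solve 2 (λ a x → x :- :- a := a :+ x) ≈-refl a x) (0≤y-x l)

  within-* : Within a x → Within b y → Within (a * b) (x * y)
  within-* {a} {x} {b} {y} wx wy =
    ≤-respʳ (solve 2 (λ x y → :- (:- x :* y) := x :* y) ≈-refl x y)
      (neg-anti (within-upper (within-neg wx) wy)) ,
    within-upper wx wy

  within-exists : ∀ x → ∃ λ b → 0# ≤ b × Within b x
  within-exists x with total 0# x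
  ... | inj₁ 0≤x = x , 0≤x , ≤-trans (≤-from x 0≤x (-‿inverseˡ x)) 0≤x , ≤-refl
  ... | inj₂ x≤0 = - x , neg-nonNeg x≤0
                 , ≤-reflexive (solve 1 (λ x → :- (:- x) := x) ≈-refl x) , ≤-trans x≤0 (neg-nonNeg x≤0)

  record LipschitzOn (B : Carrier) (f : Carrier → Carrier) : Set where
    field
      bound       : Carrier
      constant    : Carrier
      0≤bound     : 0# ≤ bound
      0≤constant  : 0# ≤ constant
      bounded     : ∀ x → Within B x → Within bound (f x)
      lipschitz   : ∀ x y → Within B x → Within B y → x ≤ y → Within (constant * (y - x)) (f y - f x)

  LocallyLipschitz : (Carrier → Carrier) → Set
  LocallyLipschitz f = ∀ B → 0# ≤ B → LipschitzOn B f

  within-0 : 0# ≤ b → x ≈ 0# → Within b x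
  within-0 {b} 0≤b x≈0 = ≤-respʳ (≈-sym x≈0) (≤-from b 0≤b (-‿inverseˡ b)) , ≤-respˡ (≈-sym x≈0) 0≤b

  lipschitz-const : ∀ c → LocallyLipschitz (λ _ → c)
  lipschitz-const c B 0≤B = record
    { bound = proj₁ w ; constant = 0# ; 0≤bound = proj₁ (proj₂ w) ; 0≤constant = ≤-refl
    ; bounded = λ _ _ → proj₂ (proj₂ w)
    ; lipschitz = λ x y _ _ _ → within-0 (≤-reflexive (≈-sym (zeroˡ _))) (-‿inverseʳ c)
    }
    where w = within-exists c

  lipschitz-id : LocallyLipschitz (λ x → x)
  lipschitz-id B 0≤B = record
    { bound = B ; constant = 1# ; 0≤bound = 0≤B ; 0≤constant = 0≤1
    ; bounded = λ _ w → w
    ; lipschitz = λ x y _ _ x≤y →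
        ≤-trans (≤-from (1# * (y - x)) (*-nonNeg 0≤1 (0≤y-x x≤y)) (-‿inverseˡ _)) (0≤y-x x≤y) ,
        ≤-reflexive (≈-sym (*-identityˡ _))
    }

  lipschitz-+ : LocallyLipschitz f → LocallyLipschitz g → LocallyLipschitz (λ x → f x + g x)
  lipschitz-+ {f} {g} lf lg B 0≤B = record
    { bound = F.bound + G.bound ; constant = F.constant + G.constant
    ; 0≤bound = 0≤+ F.0≤bound G.0≤bound ; 0≤constant = 0≤+ F.0≤constant G.0≤constant
    ; bounded = λ x w → within-+ (F.bounded x w) (G.bounded x w)
    ; lipschitz = λ x y wx wy x≤y → within-cong (≈-sym (distribʳ _ _ _)) (within-≈
        (solve 4 (λ a b c d → (a :- c) :+ (b :- d) := (a :+ b) :- (c :+ d)) ≈-refl (f y) (g y) (f x) (g x))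
        (within-+ (F.lipschitz x y wx wy x≤y) (G.lipschitz x y wx wy x≤y)))
    }
    where
    module F = LipschitzOn (lf B 0≤B)
    module G = LipschitzOn (lg B 0≤B)

  lipschitz-* : LocallyLipschitz f → LocallyLipschitz g → LocallyLipschitz (λ x → f x * g x)
  lipschitz-* {f} {g} lf lg B 0≤B = record
    { bound = F.bound * G.bound ; constant = F.bound * G.constant + G.bound * F.constant
    ; 0≤bound = *-nonNeg F.0≤bound G.0≤bound
    ; 0≤constant = 0≤+ (*-nonNeg F.0≤bound G.0≤constant) (*-nonNeg G.0≤bound F.0≤constant)
    ; bounded = λ x w → within-* (F.bounded x w) (G.bounded x w)
    ; lipschitz = λ x y wx wy x≤y → within-cong
        (solve 5 (λ m k n l d → m :* (k :* d) :+ n :* (l :* d) := (m :* k :+ n :* l) :* d) ≈-refl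
          F.bound G.constant G.bound F.constant (y - x))
        (within-≈
          (solve 4 (λ a b c d → a :* (b :- d) :+ d :* (a :- c) := a :* b :- c :* d) ≈-refl (f y) (g y) (f x) (g x))
          (within-+ (within-* (F.bounded y wy) (G.lipschitz x y wx wy x≤y))
                    (within-* (G.bounded x wx) (F.lipschitz x y wx wy x≤y))))
    }
    where
    module F = LipschitzOn (lf B 0≤B)
    module G = LipschitzOn (lg B 0≤B)

  lipschitz-neg : LocallyLipschitz f → LocallyLipschitz (λ x → - f x)
  lipschitz-neg {f} lf B 0≤B = record
    { bound = F.bound ; constant = F.constant ; 0≤bound = F.0≤bound ; 0≤constant = F.0≤constant
    ; bounded = λ x w → within-neg (F.bounded x w)
    ; lipschitz = λ x y wx wy x≤y → within-≈
        (solve 2 (λ a b → :- (a :- b) := :- a :- :- b) ≈-refl (f y) (f x))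
        (within-neg (F.lipschitz x y wx wy x≤y))
    }
    where module F = LipschitzOn (lf B 0≤B)

  lipschitz-^ : ∀ n → LocallyLipschitz (_^ n)
  lipschitz-^ zero    = lipschitz-const 1#
  lipschitz-^ (suc n) = lipschitz-* lipschitz-id (lipschitz-^ n)

  module _ (em : ExcludedMiddle 0ℓ) where
    open CompleteOrderedField ℝ using (UpperBound; supremum)

    module _ {f : Carrier → Carrier} {B a b : Carrier} (lip : LipschitzOn B f)
             (-B≤a : - B ≤ a) (a≤b : a ≤ b) (b≤B : b ≤ B) where
      private
        module F = LipschitzOn lip

        L = F.constant

        0<1+L : 0# < 1# + L
        0<1+L = 0<+ 0<1 F.0≤constant

        δ : Carrier → Carrier
        δ v = v * (1# + L) ⁻¹

        0<δ : ∀ {v} → 0# < v → 0# < δ v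
        0<δ 0<v = 0<* 0<v (0<⁻¹ 0<1+L)

        Lδ : ∀ v → L * δ v ≈ v - δ v
        Lδ v = begin
          L * δ v               ≈⟨ solve 2 (λ l d → l :* d := (:1 :+ l) :* d :- d) ≈-refl L (δ v) ⟩
          (1# + L) * δ v - δ v  ≈⟨ +-congʳ (÷-cancel (>⇒≉0 0<1+L)) ⟩
          v - δ v               ∎
          where open ≈-Reasoning

        within : ∀ {x} → a ≤ x → x ≤ b → Within B x
        within a≤x x≤b = ≤-trans -B≤a a≤x , ≤-trans x≤b b≤B

        increment : ∀ {x y} → a ≤ x → x ≤ y → y ≤ b → Within (L * (y - x)) (f y - f x)
        increment a≤x x≤y y≤b =
          F.lipschitz _ _ (within a≤x (≤-trans x≤y y≤b)) (within (≤-trans a≤x x≤y) y≤b) x≤y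

      module _ (fa≤0 : f a ≤ 0#) (0≤fb : 0# ≤ f b) where
        private
          S : Carrier → Set
          S x = (a ≤ x × x ≤ b) × f x ≤ 0#

          sup   = supremum S (a , (≤-refl , a≤b) , fa≤0) (b , λ _ → proj₂ ∘ proj₁)
          c     = proj₁ sup
          above = proj₁ (proj₂ sup)
          least = proj₂ (proj₂ sup)

          c≤b : c ≤ b
          c≤b = least b (λ _ → proj₂ ∘ proj₁)

          a≤c : a ≤ c
          a≤c = above a ((≤-refl , a≤b) , fa≤0)

          fc≤0 : f c ≤ 0#
          fc≤0 with em {f c ≤ 0#}
          ... | yes fc≤0 = fc≤0
          ... | no  fc≰0 = contradiction (least (c - δ (f c)) upper) (<⇒≱ c-δ<c)
            where
            0<fc = ≰⇒> fc≰0

            c-δ<c : c - δ (f c) < c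
            c-δ<c = <-≤-trans (0<x-y′ , λ eq → proj₂ (0<δ 0<fc) (begin
                0#                ≈⟨ -‿inverseʳ c ⟨
                c - c             ≈⟨ +-congˡ (-‿cong eq) ⟨
                c - (c - δ (f c)) ≈⟨ solve 2 (λ c d → c :- (c :- d) := d) ≈-refl c (δ (f c)) ⟩
                δ (f c)           ∎)) ≤-refl
              where
              open ≈-Reasoning
              0<x-y′ : c - δ (f c) ≤ c
              0<x-y′ = ≤-from (δ (f c)) (proj₁ (0<δ 0<fc)) (solve 2 (λ c d → c :- d :+ d := c) ≈-refl c (δ (f c)))

            upper : UpperBound S (c - δ (f c))
            upper x Sx@((a≤x , x≤b) , fx≤0) with em {x ≤ c - δ (f c)}
            ... | yes x≤c-δ = x≤c-δ
            ... | no  x≰c-δ = contradiction fx≤0 (<⇒≱ (<-≤-trans (0<δ 0<fc) δ≤fx))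
              where
              x≤c = proj₁ (proj₂ sup) x Sx
              c-x≤δ : c - x ≤ δ (f c)
              c-x≤δ = ≤-from (x - (c - δ (f c))) (0≤y-x (≰⇒≥ x≰c-δ))
                (solve 3 (λ c x d → c :- x :+ (x :- (c :- d)) := d) ≈-refl c x (δ (f c)))
              δ≤fx : δ (f c) ≤ f x
              δ≤fx = begin
                δ (f c)               ≈⟨ solve 2 (λ v d → d := v :- (v :- d)) ≈-refl (f c) (δ (f c)) ⟩
                f c - (f c - δ (f c)) ≈⟨ +-congˡ (-‿cong (Lδ (f c))) ⟨
                f c - L * δ (f c)     ≤⟨ +-mono ≤-refl (neg-anti (*-monoʳ L F.0≤constant c-x≤δ)) ⟩
                f c - L * (c - x)     ≤⟨ +-mono ≤-refl (neg-anti (proj₂ (increment a≤x x≤c c≤b))) ⟩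
                f c - (f c - f x)     ≈⟨ solve 2 (λ u v → u :- (u :- v) := v) ≈-refl (f c) (f x) ⟩
                f x                   ∎
                where open ≤-Reasoning

          0≤fc : 0# ≤ f c
          0≤fc with em {0# ≤ f c}
          ... | yes 0≤fc = 0≤fc
          ... | no  0≰fc = contradiction c+δ≤c (<⇒≱ c<c+δ)
            where
            d = δ (- f c)
            0<-fc : 0# < - f c
            0<-fc = ≤-respʳ (+-identityˡ _) (proj₁ (0<x-y (≰⇒> 0≰fc)))
                  , λ eq → proj₂ (0<x-y (≰⇒> 0≰fc)) (≈-trans eq (≈-sym (+-identityˡ _)))
            0<d = 0<δ 0<-fc

            c<c+δ : c < c + d
            c<c+δ = ≤-from d (proj₁ 0<d) ≈-refl , λ eq → proj₂ 0<d (begin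
                0#          ≈⟨ -‿inverseʳ c ⟨
                c - c       ≈⟨ +-congʳ eq ⟩
                c + d - c   ≈⟨ solve 2 (λ c d → c :+ d :- c := d) ≈-refl c d ⟩
                d           ∎)
              where open ≈-Reasoning

            f≤ : ∀ {y} → c ≤ y → y ≤ b → y - c ≤ d → f y ≤ - d
            f≤ {y} c≤y y≤b y-c≤d = begin
              f y                 ≈⟨ solve 2 (λ u v → v := u :+ (v :- u)) ≈-refl (f c) (f y) ⟩
              f c + (f y - f c)   ≤⟨ +-mono ≤-refl (proj₂ (increment a≤c c≤y y≤b)) ⟩
              f c + L * (y - c)   ≤⟨ +-mono ≤-refl (*-monoʳ L F.0≤constant y-c≤d) ⟩
              f c + L * d         ≈⟨ +-congˡ (Lδ (- f c)) ⟩
              f c + (- f c - d)   ≈⟨ solve 2 (λ v d → v :+ (:- v :- d) := :- d) ≈-refl (f c) d ⟩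
              - d                 ∎
              where open ≤-Reasoning

            -d≤0 : - d ≤ 0#
            -d≤0 = ≤-from d (proj₁ 0<d) (-‿inverseˡ d)

            c+δ≤b : c + d ≤ b
            c+δ≤b with em {c + d ≤ b}
            ... | yes le = le
            ... | no  gt = contradiction (≤-trans 0≤fb (f≤ c≤b ≤-refl b-c≤d)) (<⇒≱ (-d≤0 , λ eq →
                    proj₂ 0<d (≈-trans (≈-sym (-‿inverseˡ d)) (≈-trans (+-congʳ eq) (+-identityˡ d)))))
              where
              b-c≤d : b - c ≤ d
              b-c≤d = ≤-from (c + d - b) (0≤y-x (≰⇒≥ gt))
                (solve 3 (λ b c d → b :- c :+ (c :+ d :- b) := d) ≈-refl b c d)

            c+δ≤c : c + d ≤ c
            c+δ≤c = above (c + d) ((≤-trans a≤c (proj₁ c<c+δ) , c+δ≤b) ,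
              ≤-trans (f≤ (proj₁ c<c+δ) c+δ≤b (≤-reflexive (solve 2 (λ c d → c :+ d :- c := d) ≈-refl c d))) -d≤0)

        intermediate-value : ∃ λ c → f c ≈ 0#
        intermediate-value = c , antisym fc≤0 0≤fc

    nonNeg-root : ∀ k .{{_ : NonZero k}} {l} → 0# ≤ l → ∃ λ ρ → ρ ^ k ≈ l
    nonNeg-root (suc k) {l} 0≤l =
      let ρ , eq = intermediate-value (lip (1# + l) 0≤1+l) -B≤0 0≤1+l ≤-refl f0≤0 0≤f[1+l]
      in ρ , ≈-trans (solve 2 (λ p l → p := (p :- l) :+ l) ≈-refl (ρ ^ suc k) l) (≈-trans (+-congʳ eq) (+-identityˡ l))
      where
      lip = lipschitz-+ (lipschitz-^ (suc k)) (lipschitz-const (- l))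
      0≤1+l = 0≤+ 0≤1 0≤l
      -B≤0 = ≤-from (1# + l) 0≤1+l (-‿inverseˡ _)
      f0≤0 : 0# ^ suc k - l ≤ 0#
      f0≤0 = ≤-from l 0≤l (solve 2 (λ p l → (:0 :* p :- l) :+ l := :0) ≈-refl (0# ^ k) l)
      1≤1+l : 1# ≤ 1# + l
      1≤1+l = ≤-from l 0≤l ≈-refl
      0≤f[1+l] : 0# ≤ (1# + l) ^ suc k - l
      0≤f[1+l] = begin
        0#                            ≤⟨ 0≤1 ⟩
        1#                            ≈⟨ solve 1 (λ l → :1 := (:1 :+ l) :* :1 :- l) ≈-refl l ⟩
        (1# + l) * 1# - l             ≤⟨ +-monoˡ-≤ (- l) (*-monoʳ (1# + l) 0≤1+l (begin
          1#             ≈⟨ 1^n≈1 k ⟨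
          1# ^ k         ≤⟨ ^-mono k 0≤1 1≤1+l ⟩
          (1# + l) ^ k   ∎)) ⟩
        (1# + l) * (1# + l) ^ k - l   ∎
        where open ≤-Reasoning

module Complex (ℝ : CompleteOrderedField) where
  open OrderedField ℝ

  private module ℂ = RawRing (ℂ ℝ)

  ℂ-commutativeRing : CommutativeRing 0ℓ 0ℓ
  ℂ-commutativeRing = record
    { RawRing (ℂ ℝ)
    ; isCommutativeRing = record
      { isRing = record
        { +-isAbelianGroup = record
          { isGroup = record
            { isMonoid = record
              { isSemigroup = record
                { isMagma = record
                  { isEquivalence = record
                    { refl  = ≈-refl , ≈-refl
                    ; sym   = λ (p , q) → ≈-sym p , ≈-sym q
                    ; trans = λ (p , q) (p′ , q′) → ≈-trans p p′ , ≈-trans q q′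
                    }
                  ; ∙-cong = λ (p , q) (p′ , q′) → +-cong p p′ , +-cong q q′
                  }
                ; assoc = λ (a , b) (c , d) (e , f) → +-assoc a c e , +-assoc b d f
                }
              ; identity = (λ (a , b) → +-identityˡ a , +-identityˡ b)
                         , (λ (a , b) → +-identityʳ a , +-identityʳ b)
              }
            ; inverse = (λ (a , b) → -‿inverseˡ a , -‿inverseˡ b)
                      , (λ (a , b) → -‿inverseʳ a , -‿inverseʳ b)
            ; ⁻¹-cong = λ (p , q) → -‿cong p , -‿cong q
            }
          ; comm = λ (a , b) (c , d) → +-comm a c , +-comm b d
          }
        ; *-cong = λ (p , q) (p′ , q′) →
            +-cong (*-cong p p′) (-‿cong (*-cong q q′)) , +-cong (*-cong p q′) (*-cong q p′)
        ; *-assoc = λ (a , b) (c , d) (e , f) →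
            solve 6 (λ a b c d e f → (a :* c :- b :* d) :* e :- (a :* d :+ b :* c) :* f
                                  := a :* (c :* e :- d :* f) :- b :* (c :* f :+ d :* e)) ≈-refl a b c d e f ,
            solve 6 (λ a b c d e f → (a :* c :- b :* d) :* f :+ (a :* d :+ b :* c) :* e
                                  := a :* (c :* f :+ d :* e) :+ b :* (c :* e :- d :* f)) ≈-refl a b c d e f
        ; *-identity =
            (λ (a , b) → solve 2 (λ a b → :1 :* a :- :0 :* b := a) ≈-refl a b
                       , solve 2 (λ a b → :1 :* b :+ :0 :* a := b) ≈-refl a b) ,
            (λ (a , b) → solve 2 (λ a b → a :* :1 :- b :* :0 := a) ≈-refl a b
                       , solve 2 (λ a b → a :* :0 :+ b :* :1 := b) ≈-refl a b)
        ; distrib =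
            (λ (a , b) (c , d) (e , f) →
              solve 6 (λ a b c d e f → a :* (c :+ e) :- b :* (d :+ f)
                                    := (a :* c :- b :* d) :+ (a :* e :- b :* f)) ≈-refl a b c d e f ,
              solve 6 (λ a b c d e f → a :* (d :+ f) :+ b :* (c :+ e)
                                    := (a :* d :+ b :* c) :+ (a :* f :+ b :* e)) ≈-refl a b c d e f) ,
            (λ (a , b) (c , d) (e , f) →
              solve 6 (λ a b c d e f → (c :+ e) :* a :- (d :+ f) :* b
                                    := (c :* a :- d :* b) :+ (e :* a :- f :* b)) ≈-refl a b c d e f ,
              solve 6 (λ a b c d e f → (c :+ e) :* b :+ (d :+ f) :* a
                                    := (c :* b :+ d :* a) :+ (e :* b :+ f :* a)) ≈-refl a b c d e f)
        }
      ; *-comm = λ (a , b) (c , d) →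
          solve 4 (λ a b c d → a :* c :- b :* d := c :* a :- d :* b) ≈-refl a b c d ,
          solve 4 (λ a b c d → a :* d :+ b :* c := c :* b :+ d :* a) ≈-refl a b c d
      }
    }

  module ℂR = CommutativeRing ℂ-commutativeRing
  open RawSemiringDefs (RawRing.rawSemiring (ℂ ℝ)) public using () renaming (_^_ to _^ᶜ_; sum to sumᶜ)
  module ℂExp = Exp ℂR.commutativeSemiring
  open Mult ℂR.semiring public using () renaming (_×_ to _·ᶜ_)

  real : Carrier → ℂ.Carrier
  real x = x , 0#

  real-cong : ∀ {x y} → x ≈ y → real x ℂ.≈ real y
  real-cong x≈y = x≈y , ≈-refl

  real-+ : ∀ x y → real (x + y) ℂ.≈ real x ℂ.+ real y
  real-+ x y = ≈-refl , ≈-sym (+-identityˡ 0#)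

  real-* : ∀ x y → real (x * y) ℂ.≈ real x ℂ.* real y
  real-* x y = solve 2 (λ x y → x :* y := x :* y :- :0 :* :0) ≈-refl x y
             , solve 2 (λ x y → :0 := x :* :0 :+ :0 :* y) ≈-refl x y

  real-^ : ∀ x n → real (x ^ n) ℂ.≈ real x ^ᶜ n
  real-^ x zero    = ℂR.refl
  real-^ x (suc n) = ℂR.trans (real-* x (x ^ n)) (ℂR.*-congˡ {real x} (real-^ x n))

  real-*ˡ : ∀ x z → real x ℂ.* z ℂ.≈ (x * proj₁ z , x * proj₂ z)
  real-*ˡ x (a , b) = solve 3 (λ x a b → x :* a :- :0 :* b := x :* a) ≈-refl x a b
                    , solve 3 (λ x a b → x :* b :+ :0 :* a := x :* b) ≈-refl x a b

  ·ᶜ-components : ∀ n z → n ·ᶜ z ℂ.≈ (nat n * proj₁ z , nat n * proj₂ z)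
  ·ᶜ-components zero    (a , b) = ≈-sym (zeroˡ a) , ≈-sym (zeroˡ b)
  ·ᶜ-components (suc n) (a , b) with ·ᶜ-components n (a , b)
  ... | p , q = step p , step q
    where
    step : ∀ {x y} → x ≈ nat n * y → y + x ≈ (1# + nat n) * y
    step {x} {y} eq = ≈-trans (+-congˡ eq) (solve 2 (λ n y → y :+ n :* y := (:1 :+ n) :* y) ≈-refl (nat n) y)

  ∣_∣² : ℂ.Carrier → Carrier
  ∣ a , b ∣² = a * a + b * b

  ∣∣²-cong : ∀ {z w} → z ℂ.≈ w → ∣ z ∣² ≈ ∣ w ∣²
  ∣∣²-cong (p , q) = +-cong (*-cong p p) (*-cong q q)

  ∣∣²-* : ∀ z w → ∣ z ℂ.* w ∣² ≈ ∣ z ∣² * ∣ w ∣²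
  ∣∣²-* (a , b) (c , d) = solve 4 (λ a b c d →
    (a :* c :- b :* d) :* (a :* c :- b :* d) :+ (a :* d :+ b :* c) :* (a :* d :+ b :* c)
    := (a :* a :+ b :* b) :* (c :* c :+ d :* d)) ≈-refl a b c d

  ∣∣²-^ : ∀ z n → ∣ z ^ᶜ n ∣² ≈ ∣ z ∣² ^ n
  ∣∣²-^ z zero    = solve 0 (:1 :* :1 :+ :0 :* :0 := :1) ≈-refl
  ∣∣²-^ z (suc n) = ≈-trans (∣∣²-* z (z ^ᶜ n)) (*-congˡ (∣∣²-^ z n))

  module _ (em : ExcludedMiddle 0ℓ) where
    x²-pos : ∀ {x} → ¬ (x ≈ 0#) → 0# < x * x
    x²-pos {x} x≉0 = 0≤x² x , λ 0≈x² → x≉0 (x*y≈0⇒y≈0 x≉0 (≈-sym 0≈x²))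

    ∣∣²-pos : ∀ {z} → ¬ (z ℂ.≈ ℂ.0#) → 0# < ∣ z ∣²
    ∣∣²-pos {a , b} z≉0 with em {a ≈ 0#}
    ... | no  a≉0 = 0<+ (x²-pos a≉0) (0≤x² b)
    ... | yes a≈0 = <-≤-trans (x²-pos (λ b≈0 → z≉0 (a≈0 , b≈0)))
                      (≤-from (a * a) (0≤x² a) (+-comm _ _))

    ^ᶜ-≉0 : ∀ {z} n → ¬ (z ℂ.≈ ℂ.0#) → ¬ (z ^ᶜ n ℂ.≈ ℂ.0#)
    ^ᶜ-≉0 {z} n z≉0 zⁿ≈0 = proj₂ (^-pos n (∣∣²-pos {z} z≉0)) (begin
      0#               ≈⟨ solve 0 (:0 := :0 :* :0 :+ :0 :* :0) ≈-refl ⟩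
      ∣ ℂ.0# ∣²        ≈⟨ ∣∣²-cong zⁿ≈0 ⟨
      ∣ z ^ᶜ n ∣²      ≈⟨ ∣∣²-^ z n ⟩
      ∣ z ∣² ^ n       ∎)
      where open ≈-Reasoning

module OddPowers (R : CommutativeRing 0ℓ 0ℓ) where
  open CommutativeRing R
  open Exp commutativeSemiring
  open IntegerCoefficients R
  open SetoidReasoning setoid

  ^-even : ∀ x j → x ^ (j ℕ.+ j) ≈ (x * x) ^ j
  ^-even x j = trans (^-homo-* x j j) (sym (^-distrib-* x x j))

  ^-odd-neg : ∀ x j → (- x) ^ suc (j ℕ.+ j) ≈ - (x ^ suc (j ℕ.+ j))
  ^-odd-neg x j = begin
    - x * (- x) ^ (j ℕ.+ j)    ≈⟨ *-congˡ (^-even (- x) j) ⟩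
    - x * (- x * - x) ^ j      ≈⟨ *-congˡ (^-congˡ j (solve 1 (λ x → :- x :* :- x := x :* x) refl x)) ⟩
    - x * (x * x) ^ j          ≈⟨ *-congˡ (^-even x j) ⟨
    - x * x ^ (j ℕ.+ j)        ≈⟨ solve 2 (λ x y → :- x :* y := :- (x :* y)) refl x (x ^ (j ℕ.+ j)) ⟩
    - (x * x ^ (j ℕ.+ j))      ∎

parity : ∀ k → (∃ λ j → k ≡ j ℕ.+ j) ⊎ (∃ λ j → k ≡ suc (j ℕ.+ j))
parity zero    = inj₁ (0 , ≡.refl)
parity (suc k) with parity k
... | inj₁ (j , eq) = inj₂ (j , ≡.cong suc eq)
... | inj₂ (j , eq) = inj₁ (suc j , ≡.trans (≡.cong suc eq) (≡.sym (ℕ.+-suc (suc j) j)))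

-- For c ≠ 0 the path z(t) = t + (1 - t²)i avoids 0, and between t = ±1 for odd k
-- (between t = 0 and t = 1 for k = 2) the sign of Im(z(t)ᵏ c̄) changes.  At a zero t
-- of it, z(t)ᵏ is a real multiple of c.
module ComplexRoots (ℝ : CompleteOrderedField) (em : ExcludedMiddle 0ℓ) where
  open OrderedField ℝ
  open IntermediateValue ℝ
  open Complex ℝ

  private module ℂ = RawRing (ℂ ℝ)

  path : Carrier → ℂ.Carrier
  path t = t , 1# - t * t

  path≉0 : ∀ t → ¬ (path t ℂ.≈ ℂ.0#)
  path≉0 t (t≈0 , 1-tt≈0) = 0≉1 (begin
    0#              ≈⟨ 1-tt≈0 ⟨
    1# - t * t      ≈⟨ +-congˡ (-‿cong (*-cong t≈0 t≈0)) ⟩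
    1# - 0# * 0#    ≈⟨ solve 0 (:1 :- :0 :* :0 := :1) ≈-refl ⟩
    1#              ∎)
    where open ≈-Reasoning

  lipschitz-path-^ : ∀ k → LocallyLipschitz (λ t → proj₁ (path t ^ᶜ k))
                         × LocallyLipschitz (λ t → proj₂ (path t ^ᶜ k))
  lipschitz-path-^ zero    = lipschitz-const 1# , lipschitz-const 0#
  lipschitz-path-^ (suc k) =
    let re , im = lipschitz-path-^ k
        y = lipschitz-+ (lipschitz-const 1#) (lipschitz-neg (lipschitz-* lipschitz-id lipschitz-id))
    in lipschitz-+ (lipschitz-* lipschitz-id re) (lipschitz-neg (lipschitz-* y im))
     , lipschitz-+ (lipschitz-* lipschitz-id im) (lipschitz-* y re)

  -- Im(w c̄)
  cross : ℂ.Carrier → ℂ.Carrier → Carrier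
  cross (p , q) (u , v) = v * p - u * q

  cross-neg : ∀ c {w w′} → w ℂ.≈ ℂ.- w′ → cross c w ≈ - cross c w′
  cross-neg (p , q) {u , v} {u′ , v′} (eu , ev) = ≈-trans
    (+-cong (*-congʳ ev) (-‿cong (*-congʳ eu)))
    (solve 4 (λ p q u v → :- v :* p :- :- u :* q := :- (v :* p :- u :* q)) ≈-refl p q u′ v′)

  lipschitz-cross : ∀ c k → LocallyLipschitz (λ t → cross c (path t ^ᶜ k))
  lipschitz-cross (p , q) k =
    let re , im = lipschitz-path-^ k
    in lipschitz-+ (lipschitz-* im (lipschitz-const p)) (lipschitz-neg (lipschitz-* re (lipschitz-const q)))

  cross-zero : ∀ c k a → - 1# ≤ a → a ≤ 1# → path a ^ᶜ k ℂ.≈ ℂ.- (path 1# ^ᶜ k) →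
    ∃ λ z → ¬ (z ℂ.≈ ℂ.0#) × cross c (z ^ᶜ k) ≈ 0#
  cross-zero c k a -1≤a a≤1 flip with total 0# (cross c (path 1# ^ᶜ k))
  ... | inj₁ 0≤h =
    let t , eq = intermediate-value em (lipschitz-cross c k 1# 0≤1) -1≤a a≤1 ≤-refl
                   (≤-respˡ (≈-sym (cross-neg c flip))
                     (≤-from _ 0≤h (-‿inverseˡ _))) 0≤h
    in path t , path≉0 t , eq
  ... | inj₂ h≤0 =
    let t , eq = intermediate-value em (lipschitz-neg (lipschitz-cross c k) 1# 0≤1) -1≤a a≤1 ≤-refl
                   (≤-respˡ (-‿cong (≈-sym (cross-neg c flip)))
                     (≤-respˡ (solve 1 (λ x → x := :- (:- x)) ≈-refl _) h≤0)) (neg-nonNeg h≤0)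
    in path t , path≉0 t , ≈-trans (solve 1 (λ x → x := :- (:- x)) ≈-refl _)
         (≈-trans (-‿cong eq) (solve 0 (:- :0 := :0) ≈-refl))

  real-multiple : ∀ c w → ¬ (c ℂ.≈ ℂ.0#) → ¬ (w ℂ.≈ ℂ.0#) → cross c w ≈ 0# →
    ∃ λ l → ¬ (l ≈ 0#) × w ℂ.≈ real l ℂ.* c
  real-multiple c@(p , q) w@(u , v) c≉0 w≉0 vp-uq≈0 = l , l≉0 , w≈lc
    where
    n = ∣ c ∣²
    n≉0 = >⇒≉0 (∣∣²-pos em {c} c≉0)
    m = u * p + v * q
    l = m * n ⁻¹
    nl≈m = ÷-cancel {m} n≉0
    component : ∀ x y → n * x ≈ m * y → x ≈ l * y
    component x y eq = *-cancelˡ n n≉0 (begin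
      n * x       ≈⟨ eq ⟩
      m * y       ≈⟨ *-congʳ nl≈m ⟨
      n * l * y   ≈⟨ *-assoc n l y ⟩
      n * (l * y) ∎)
      where open ≈-Reasoning
    w≈lc : w ℂ.≈ real l ℂ.* c
    w≈lc = ℂR.trans (component u p (begin
        (p * p + q * q) * u                       ≈⟨ solve 4 (λ p q u v → (p :* p :+ q :* q) :* u
                                                       := (u :* p :+ v :* q) :* p :- (v :* p :- u :* q) :* q)
                                                       ≈-refl p q u v ⟩
        m * p - (v * p - u * q) * q               ≈⟨ +-congˡ (-‿cong (*-congʳ vp-uq≈0)) ⟩
        m * p - 0# * q                            ≈⟨ solve 2 (λ x q → x :- :0 :* q := x) ≈-refl (m * p) q ⟩
        m * p                                     ∎) ,
      component v q (begin
        (p * p + q * q) * v                       ≈⟨ solve 4 (λ p q u v → (p :* p :+ q :* q) :* v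
                                                       := (u :* p :+ v :* q) :* q :+ (v :* p :- u :* q) :* p)
                                                       ≈-refl p q u v ⟩
        m * q + (v * p - u * q) * p               ≈⟨ +-congˡ (*-congʳ vp-uq≈0) ⟩
        m * q + 0# * p                            ≈⟨ solve 2 (λ x p → x :+ :0 :* p := x) ≈-refl (m * q) p ⟩
        m * q                                     ∎))
      (ℂR.sym (real-*ˡ l c))
      where open ≈-Reasoning
    l≉0 : ¬ (l ≈ 0#)
    l≉0 l≈0 = w≉0 (ℂR.trans w≈lc (ℂR.trans (ℂR.*-congʳ {c} (real-cong l≈0)) (ℂR.zeroˡ c)))

  rescale : ∀ k {z c l ρ} → ¬ (l ≈ 0#) → z ^ᶜ k ℂ.≈ real l ℂ.* c → ρ ^ k ≈ l → ∃ λ z′ → z′ ^ᶜ k ℂ.≈ c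
  rescale k {z} {c} {l} {ρ} l≉0 zᵏ≈lc ρᵏ≈l = real σ ℂ.* z , (begin
    (real σ ℂ.* z) ^ᶜ k                ≈⟨ ℂExp.^-distrib-* (real σ) z k ⟩
    real σ ^ᶜ k ℂ.* z ^ᶜ k             ≈⟨ ℂR.*-cong (ℂR.sym (real-^ σ k)) zᵏ≈lc ⟩
    real (σ ^ k) ℂ.* (real l ℂ.* c)    ≈⟨ ℂR.*-assoc (real (σ ^ k)) (real l) c ⟨
    (real (σ ^ k) ℂ.* real l) ℂ.* c    ≈⟨ ℂR.*-congʳ {c} (real-* (σ ^ k) l) ⟨
    real (σ ^ k * l) ℂ.* c             ≈⟨ ℂR.*-congʳ {c} (real-cong σᵏl≈1) ⟩
    ℂ.1# ℂ.* c                         ≈⟨ ℂR.*-identityˡ c ⟩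
    c                                  ∎)
    where
    open SetoidReasoning ℂR.setoid
    0^≈0⇒ : ∀ k → ¬ (k ≡ 0) → 0# ^ k ≈ 0#
    0^≈0⇒ zero    k≢0 = contradiction ≡.refl k≢0
    0^≈0⇒ (suc k) _   = zeroˡ _
    σ : Carrier
    σ = ρ ⁻¹
    σᵏl≈1 : σ ^ k * l ≈ 1#
    σᵏl≈1 with em {ρ ≈ 0#} | k ℕ.≟ 0
    ... | _       | yes ≡.refl = ≈-trans (*-identityˡ l) (≈-sym ρᵏ≈l)
    ... | yes ρ≈0 | no k≢0 = contradiction
          (≈-trans (≈-sym ρᵏ≈l) (≈-trans (^-congˡ k ρ≈0) (0^≈0⇒ k k≢0))) l≉0
    ... | no  ρ≉0 | no _   = ≈-trans (*-congˡ (≈-sym ρᵏ≈l)) (≈-trans (≈-sym (^-distrib-* σ ρ k))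
          (≈-trans (^-congˡ k (≈-trans (*-comm σ ρ) (⁻¹-inverseʳ ρ≉0))) (1^n≈1 k)))

  odd-root : ∀ j c → ¬ (c ℂ.≈ ℂ.0#) → ∃ λ z → z ^ᶜ suc (j ℕ.+ j) ℂ.≈ c
  odd-root j c c≉0 =
    let k = suc (j ℕ.+ j)
        z , z≉0 , h≈0 = cross-zero c k (- 1#) ≤-refl (≤-trans (≤-from 1# 0≤1 (-‿inverseˡ 1#)) 0≤1)
          (ℂR.trans (ℂExp.^-congˡ k {path (- 1#)} {ℂ.- path 1#}
            (≈-refl , solve 0 (:1 :- :- :1 :* :- :1 := :- (:1 :- :1 :* :1)) ≈-refl))
            (OddPowers.^-odd-neg ℂ-commutativeRing (path 1#) j))
        l , l≉0 , eq = real-multiple c (z ^ᶜ k) c≉0 (^ᶜ-≉0 em {z} k z≉0) h≈0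
        ρ , ρᵏ≈l = real-root l
    in rescale k {z} {c} l≉0 eq ρᵏ≈l
    where
    real-root : ∀ l → ∃ λ ρ → ρ ^ suc (j ℕ.+ j) ≈ l
    real-root l with total 0# l
    ... | inj₁ 0≤l = nonNeg-root em (suc (j ℕ.+ j)) 0≤l
    ... | inj₂ l≤0 = let ρ , eq = nonNeg-root em (suc (j ℕ.+ j)) (neg-nonNeg l≤0) in
      - ρ , ≈-trans (OddPowers.^-odd-neg commutativeRing ρ j)
              (≈-trans (-‿cong eq) (solve 1 (λ x → :- (:- x) := x) ≈-refl l))

  square-root : ∀ c → ¬ (c ℂ.≈ ℂ.0#) → ∃ λ z → z ^ᶜ 2 ℂ.≈ c
  square-root c c≉0 = choose (total 0# l)
    where
    0→1 : path 0# ^ᶜ 2 ℂ.≈ ℂ.- (path 1# ^ᶜ 2)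
    0→1 = solve 0 (:0 :* (:0 :* :1 :- (:1 :- :0 :* :0) :* :0) :- (:1 :- :0 :* :0) :* (:0 :* :0 :+ (:1 :- :0 :* :0) :* :1)
              := :- (:1 :* (:1 :* :1 :- (:1 :- :1 :* :1) :* :0) :- (:1 :- :1 :* :1) :* (:1 :* :0 :+ (:1 :- :1 :* :1) :* :1))) ≈-refl
        , solve 0 (:0 :* (:0 :* :0 :+ (:1 :- :0 :* :0) :* :1) :+ (:1 :- :0 :* :0) :* (:0 :* :1 :- (:1 :- :0 :* :0) :* :0)
              := :- (:1 :* (:1 :* :0 :+ (:1 :- :1 :* :1) :* :1) :+ (:1 :- :1 :* :1) :* (:1 :* :1 :- (:1 :- :1 :* :1) :* :0))) ≈-refl
    found = cross-zero c 2 0# (≤-from 1# 0≤1 (-‿inverseˡ 1#)) 0≤1 0→1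
    z = proj₁ found
    multiple = real-multiple c (z ^ᶜ 2) c≉0 (^ᶜ-≉0 em {z} 2 (proj₁ (proj₂ found))) (proj₂ (proj₂ found))
    l = proj₁ multiple
    l≉0 = proj₁ (proj₂ multiple)
    z²≈lc = proj₂ (proj₂ multiple)
    i : ℂ.Carrier
    i = 0# , 1#
    choose : 0# ≤ l ⊎ l ≤ 0# → ∃ λ z → z ^ᶜ 2 ℂ.≈ c
    choose (inj₁ 0≤l) = rescale 2 {z} {c} l≉0 z²≈lc (proj₂ (nonNeg-root em 2 0≤l))
    choose (inj₂ l≤0) = rescale 2 {i ℂ.* z} {c} -l≉0 iz²≈-lc (proj₂ (nonNeg-root em 2 (neg-nonNeg l≤0)))
      where
      -l≉0 : ¬ (- l ≈ 0#)
      -l≉0 eq = l≉0 (≈-trans (solve 1 (λ x → x := :- (:- x)) ≈-refl l) (≈-trans (-‿cong eq) (solve 0 (:- :0 := :0) ≈-refl)))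
      iz²≈-lc : (i ℂ.* z) ^ᶜ 2 ℂ.≈ real (- l) ℂ.* c
      iz²≈-lc = begin
        (i ℂ.* z) ^ᶜ 2           ≈⟨ ℂExp.^-distrib-* i z 2 ⟩
        i ^ᶜ 2 ℂ.* z ^ᶜ 2        ≈⟨ ℂR.*-cong i²≈-1 z²≈lc ⟩
        real (- 1#) ℂ.* (real l ℂ.* c) ≈⟨ ℂR.*-assoc (real (- 1#)) (real l) c ⟨
        (real (- 1#) ℂ.* real l) ℂ.* c ≈⟨ ℂR.*-congʳ {c} (real-* (- 1#) l) ⟨
        real (- 1# * l) ℂ.* c          ≈⟨ ℂR.*-congʳ {c} (real-cong (solve 1 (λ l → :- :1 :* l := :- l) ≈-refl l)) ⟩
        real (- l) ℂ.* c               ∎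
        where
        open SetoidReasoning ℂR.setoid
        i²≈-1 : i ^ᶜ 2 ℂ.≈ real (- 1#)
        i²≈-1 = solve 0 (:0 :* (:0 :* :1 :- :1 :* :0) :- :1 :* (:0 :* :0 :+ :1 :* :1) := :- :1) ≈-refl
              , solve 0 (:0 :* (:0 :* :0 :+ :1 :* :1) :+ :1 :* (:0 :* :1 :- :1 :* :0) := :0) ≈-refl

  nonzero-root : ∀ fuel k → k ℕ.≤ fuel → 0 ℕ.< k → ∀ c → ¬ (c ℂ.≈ ℂ.0#) → ∃ λ z → z ^ᶜ k ℂ.≈ c
  nonzero-root zero       k k≤n 0<k c c≉0 = contradiction k≤n (ℕ.<⇒≱ 0<k)
  nonzero-root (suc fuel) k k≤n 0<k c c≉0 with parity k
  ... | inj₂ (j , ≡.refl)     = odd-root j c c≉0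
  ... | inj₁ (suc j , ≡.refl) =
    let w , w²≈c = square-root c c≉0
        z , zʲ≈w = nonzero-root fuel (suc j) (ℕ.≤-trans (s≤s (ℕ.m≤m+n j j))
                     (ℕ.≤-trans (ℕ.≤-reflexive (≡.sym (ℕ.+-suc j j))) (ℕ.s≤s⁻¹ k≤n))) (s≤s z≤n) w (w≉0 w w²≈c)
    in z , (begin
      z ^ᶜ (suc j ℕ.+ suc j)              ≡⟨ ≡.cong (z ^ᶜ_) (≡.trans (≡.cong (suc j ℕ.+_) (≡.sym (ℕ.+-identityʳ (suc j)))) (ℕ.*-comm 2 (suc j))) ⟩
      z ^ᶜ (suc j ℕ.* 2)                  ≈⟨ ℂExp.^-assocʳ z (suc j) 2 ⟨
      (z ^ᶜ suc j) ^ᶜ 2                   ≈⟨ ℂExp.^-congˡ 2 zʲ≈w ⟩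
      w ^ᶜ 2                              ≈⟨ w²≈c ⟩
      c                                   ∎)
    where
    open SetoidReasoning ℂR.setoid
    w≉0 : ∀ w → w ^ᶜ 2 ℂ.≈ c → ¬ (w ℂ.≈ ℂ.0#)
    w≉0 w w²≈c w≈0 = c≉0 (ℂR.trans (ℂR.sym w²≈c) (ℂR.trans (ℂR.*-congʳ {w ^ᶜ 1} w≈0) (ℂR.zeroˡ (w ^ᶜ 1))))

  complex-root : ∀ k .{{_ : NonZero k}} c → ∃ λ z → z ^ᶜ k ℂ.≈ c
  complex-root k@(suc k-1) c with em {c ℂ.≈ ℂ.0#}
  ... | yes c≈0 = ℂ.0# , ℂR.trans (ℂR.zeroˡ (ℂ.0# ^ᶜ k-1)) (ℂR.sym c≈0)
  ... | no  c≉0 = nonzero-root k k ℕ.≤-refl (s≤s z≤n) c c≉0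

P′-suc : ∀ n k → suc n P′ suc k ≡ n P′ suc k ℕ.+ suc k ℕ.* (n P′ k)
P′-suc n k with k ℕ.≤? n
... | yes k≤n = begin
  suc n P′ suc k                                  ≡⟨ nP′k≡n[n∸1P′k∸1] (suc n) (suc k) ⟩
  suc n ℕ.* (n P′ k)                              ≡⟨ ≡.cong (ℕ._* (n P′ k)) (≡.trans (ℕ.+-suc (n ℕ.∸ k) k) (≡.cong suc (ℕ.m∸n+n≡m k≤n))) ⟨
  (n ℕ.∸ k ℕ.+ suc k) ℕ.* (n P′ k)                ≡⟨ ℕ.*-distribʳ-+ (n P′ k) (n ℕ.∸ k) (suc k) ⟩
  n P′ suc k ℕ.+ suc k ℕ.* (n P′ k)               ∎
  where open ≡.≡-Reasoning
... | no k≰n = ≡.trans (nP′k≡n[n∸1P′k∸1] (suc n) (suc k))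
  (≡.trans (≡.cong (suc n ℕ.*_) nP′k≡0)
    (≡.trans (ℕ.*-zeroʳ (suc n)) (≡.sym (≡.trans
      (≡.cong (λ z → (n ℕ.∸ k) ℕ.* z ℕ.+ suc k ℕ.* z) nP′k≡0)
      (≡.cong₂ ℕ._+_ (ℕ.*-zeroʳ (n ℕ.∸ k)) (ℕ.*-zeroʳ (suc k)))))))
  where
  vanish : ∀ {k} → n ℕ.< k → n P′ k ≡ 0
  vanish {suc k} (s≤s n≤k) = ≡.cong (ℕ._* (n P′ k)) (ℕ.m≤n⇒m∸n≡0 n≤k)
  nP′k≡0 = vanish (ℕ.≰⇒> k≰n)

P′≤^ : ∀ n k → n P′ k ℕ.≤ n ℕ.^ k
P′≤^ n zero    = ℕ.≤-refl
P′≤^ n (suc k) = ℕ.*-mono-≤ (ℕ.m∸n≤m n k) (P′≤^ n k)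

n≤2^n : ∀ n → n ℕ.≤ 2 ℕ.^ n
n≤2^n zero    = z≤n
n≤2^n (suc n) = begin
  1 ℕ.+ n                 ≤⟨ ℕ.+-mono-≤ (ℕ.m^n>0 2 n) (n≤2^n n) ⟩
  2 ℕ.^ n ℕ.+ 2 ℕ.^ n     ≡⟨ ≡.cong (2 ℕ.^ n ℕ.+_) (ℕ.+-identityʳ _) ⟨
  2 ℕ.^ suc n             ∎
  where open ℕ.≤-Reasoning

^≤P′ : ∀ n k → n ℕ.* n ℕ.^ k ℕ.≤ n ℕ.* (n P′ k) ℕ.+ 2 ℕ.^ k ℕ.* n ℕ.^ k
^≤P′ n zero    = ℕ.m≤m+n (n ℕ.* 1) _
^≤P′ n (suc k) = begin
  n ℕ.* (n ℕ.* x)                                             ≤⟨ ℕ.*-monoʳ-≤ n (^≤P′ n k) ⟩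
  n ℕ.* (n ℕ.* f ℕ.+ t ℕ.* x)                                 ≡⟨ distrib n f t x ⟩
  n ℕ.* n ℕ.* f ℕ.+ t ℕ.* (n ℕ.* x)                           ≤⟨ ℕ.+-monoˡ-≤ _ (ℕ.*-monoˡ-≤ f (ℕ.*-monoʳ-≤ n (n≤n∸k+k n k))) ⟩
  n ℕ.* (n ℕ.∸ k ℕ.+ k) ℕ.* f ℕ.+ t ℕ.* (n ℕ.* x)             ≡⟨ expand n (n ℕ.∸ k) k f (t ℕ.* (n ℕ.* x)) ⟩
  n ℕ.* ((n ℕ.∸ k) ℕ.* f) ℕ.+ (k ℕ.* (n ℕ.* f) ℕ.+ t ℕ.* (n ℕ.* x))
    ≤⟨ ℕ.+-monoʳ-≤ (n ℕ.* ((n ℕ.∸ k) ℕ.* f)) (ℕ.+-monoˡ-≤ (t ℕ.* (n ℕ.* x)) (ℕ.*-mono-≤ (n≤2^n k) (ℕ.*-monoʳ-≤ n (P′≤^ n k)))) ⟩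
  n ℕ.* ((n ℕ.∸ k) ℕ.* f) ℕ.+ (t ℕ.* (n ℕ.* x) ℕ.+ t ℕ.* (n ℕ.* x))
    ≡⟨ ≡.cong (n ℕ.* ((n ℕ.∸ k) ℕ.* f) ℕ.+_) (double t (n ℕ.* x)) ⟩
  n ℕ.* (n P′ suc k) ℕ.+ 2 ℕ.^ suc k ℕ.* n ℕ.^ suc k          ∎
  where
  open ℕ.≤-Reasoning
  x = n ℕ.^ k
  f = n P′ k
  t = 2 ℕ.^ k
  n≤n∸k+k : ∀ n k → n ℕ.≤ n ℕ.∸ k ℕ.+ k
  n≤n∸k+k n k = ≡.subst (n ℕ.≤_) (ℕ.+-comm k _) (ℕ.m≤n+m∸n n k)
  distrib : ∀ n f t x → n ℕ.* (n ℕ.* f ℕ.+ t ℕ.* x) ≡ n ℕ.* n ℕ.* f ℕ.+ t ℕ.* (n ℕ.* x)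
  distrib = solve-∀
  expand : ∀ n a k f y → n ℕ.* (a ℕ.+ k) ℕ.* f ℕ.+ y ≡ n ℕ.* (a ℕ.* f) ℕ.+ (k ℕ.* (n ℕ.* f) ℕ.+ y)
  expand = solve-∀
  double : ∀ t y → t ℕ.* y ℕ.+ t ℕ.* y ≡ 2 ℕ.* t ℕ.* y
  double = solve-∀

module Exponential (ℝ : CompleteOrderedField) where
  open OrderedField ℝ
  open IntermediateValue ℝ

  inv! : ℕ → Carrier
  inv! k = nat (k !) ⁻¹

  0<k! : ∀ k → 0# < nat (k !)
  0<k! k = 0<nat (ℕ.n≢0⇒n>0 (ℕ.≢-nonZero⁻¹ (k !) {{k ℕ.!≢0}}))

  0≤inv! : ∀ k → 0# ≤ inv! k
  0≤inv! k = proj₁ (0<⁻¹ (0<k! k))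

  inv!-suc : ∀ k → nat (suc k) * inv! (suc k) ≈ inv! k
  inv!-suc k = *-cancelˡ (nat (k !)) (>⇒≉0 (0<k! k)) (begin
    nat (k !) * (nat (suc k) * inv! (suc k))  ≈⟨ *-assoc _ _ _ ⟨
    nat (k !) * nat (suc k) * inv! (suc k)    ≈⟨ *-congʳ (*-comm _ _) ⟩
    nat (suc k) * nat (k !) * inv! (suc k)    ≈⟨ *-congʳ (nat-* (suc k) (k !)) ⟨
    nat (suc k !) * inv! (suc k)              ≈⟨ ⁻¹-inverseʳ (>⇒≉0 (0<k! (suc k))) ⟩
    1#                                        ≈⟨ ⁻¹-inverseʳ (>⇒≉0 (0<k! k)) ⟨
    nat (k !) * inv! k                        ∎)
    where open ≈-Reasoning

  inv!-0 : inv! 0 ≈ 1#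
  inv!-0 = ≈-trans (≈-sym (≈-trans (*-congʳ nat-1) (*-identityˡ _))) (⁻¹-inverseʳ (>⇒≉0 (0<k! 0)))

  term : ℕ → Carrier → Carrier
  term k x = x ^ k * inv! k

  partialSum : (ℕ → Carrier) → ℕ → Carrier
  partialSum t zero    = 0#
  partialSum t (suc k) = partialSum t k + t k

  partialSum-shift : ∀ t m → partialSum t (suc m) ≈ t 0 + partialSum (t ∘ suc) m
  partialSum-shift t zero    = +-comm 0# (t 0)
  partialSum-shift t (suc m) = ≈-trans (+-congʳ (partialSum-shift t m)) (+-assoc _ _ _)

  sum≈partialSum : ∀ t m → sum {m} (t ∘ toℕ) ≈ partialSum t m
  sum≈partialSum t zero    = ≈-refl
  sum≈partialSum t (suc m) = ≈-trans (+-congˡ (sum≈partialSum (t ∘ suc) m)) (≈-sym (partialSum-shift t m))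

  expSum : ℕ → Carrier → Carrier
  expSum k x = partialSum (λ j → term j x) k

  partialSum-mono : ∀ {t u} → (∀ j → t j ≤ u j) → ∀ k → partialSum t k ≤ partialSum u k
  partialSum-mono t≤u zero    = ≤-refl
  partialSum-mono t≤u (suc k) = +-mono (partialSum-mono t≤u k) (t≤u k)

  expSum-cong : ∀ k {x y} → x ≈ y → expSum k x ≈ expSum k y
  expSum-cong zero    x≈y = ≈-refl
  expSum-cong (suc k) x≈y = +-cong (expSum-cong k x≈y) (*-congʳ (^-congˡ k x≈y))

  term-nonNeg : ∀ k {x} → 0# ≤ x → 0# ≤ term k x
  term-nonNeg k 0≤x = *-nonNeg (^-nonNeg k 0≤x) (0≤inv! k)

  expSum-nonNeg : ∀ k {x} → 0# ≤ x → 0# ≤ expSum k x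
  expSum-nonNeg zero    0≤x = ≤-refl
  expSum-nonNeg (suc k) 0≤x = 0≤+ (expSum-nonNeg k 0≤x) (term-nonNeg k 0≤x)

  expSum-mono : ∀ k {x y} → 0# ≤ x → x ≤ y → expSum k x ≤ expSum k y
  expSum-mono k 0≤x x≤y = partialSum-mono (λ j → *-monoˡ (inv! j) (0≤inv! j) (^-mono j 0≤x x≤y)) k

  ^-increment : ∀ j {u h} → 0# ≤ u → 0# ≤ h → (u + h) ^ suc j ≤ u ^ suc j + nat (suc j) * h * (u + h) ^ j
  ^-increment zero    {u} {h} 0≤u 0≤h = ≤-reflexive
    (solve 2 (λ u h → (u :+ h) :* :1 := u :* :1 :+ (:1 :+ :0) :* h :* :1) ≈-refl u h)
  ^-increment (suc j) {u} {h} 0≤u 0≤h = begin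
    v * v ^ suc j                                                   ≤⟨ *-monoʳ v 0≤v (^-increment j 0≤u 0≤h) ⟩
    v * (u ^ suc j + n * h * v ^ j)                                 ≈⟨ solve 5 (λ u h x n y →
      (u :+ h) :* (x :+ n :* h :* y) := u :* x :+ (h :* x :+ n :* h :* ((u :+ h) :* y)))
      ≈-refl u h (u ^ suc j) n (v ^ j) ⟩
    u ^ suc (suc j) + (h * u ^ suc j + n * h * v ^ suc j)           ≤⟨ +-mono ≤-refl (+-monoˡ-≤ _ (*-monoʳ h 0≤h
      (^-mono (suc j) 0≤u (≤-from h 0≤h ≈-refl)))) ⟩
    u ^ suc (suc j) + (h * v ^ suc j + n * h * v ^ suc j)           ≈⟨ solve 4 (λ x h y n →
      x :+ (h :* y :+ n :* h :* y) := x :+ (:1 :+ n) :* h :* y) ≈-refl (u ^ suc (suc j)) h (v ^ suc j) n ⟩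
    u ^ suc (suc j) + nat (suc (suc j)) * h * v ^ suc j             ∎
    where
    open ≤-Reasoning
    v = u + h
    n = nat (suc j)
    0≤v = 0≤+ 0≤u 0≤h

  expSum-increment : ∀ k {u h} → 0# ≤ u → 0# ≤ h → expSum (suc k) (u + h) ≤ expSum (suc k) u + h * expSum k (u + h)
  expSum-increment zero    {u} {h} 0≤u 0≤h = ≤-reflexive (solve 2 (λ h c → :0 :+ c := :0 :+ c :+ h :* :0) ≈-refl h _)
  expSum-increment (suc k) {u} {h} 0≤u 0≤h = begin
    expSum (suc k) v + v ^ suc k * c                                     ≤⟨ +-mono (expSum-increment k 0≤u 0≤h) (*-monoˡ c (0≤inv! (suc k)) (^-increment k 0≤u 0≤h)) ⟩
    (expSum (suc k) u + h * expSum k v) + (u ^ suc k + n * h * v ^ k) * c ≈⟨ solve 7 (λ e h f x n y c →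
      (e :+ h :* f) :+ (x :+ n :* h :* y) :* c := (e :+ x :* c) :+ h :* (f :+ y :* (n :* c)))
      ≈-refl (expSum (suc k) u) h (expSum k v) (u ^ suc k) n (v ^ k) c ⟩
    (expSum (suc k) u + u ^ suc k * c) + h * (expSum k v + v ^ k * (n * c)) ≈⟨ +-congˡ (*-congˡ (+-congˡ (*-congˡ (inv!-suc k)))) ⟩
    expSum (suc (suc k)) u + h * expSum (suc k) v                        ∎
    where
    open ≤-Reasoning
    v = u + h
    n = nat (suc k)
    c = inv! (suc k)

  expSum-step : ∀ k {u h} → 0# ≤ u → 0# ≤ h → (1# - h) * expSum k (u + h) ≤ expSum k u
  expSum-step zero    {u} {h} 0≤u 0≤h = ≤-reflexive (zeroʳ _)
  expSum-step (suc k) {u} {h} 0≤u 0≤h = begin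
    (1# - h) * E′                      ≈⟨ solve 2 (λ h e → (:1 :- h) :* e := e :- h :* e) ≈-refl h E′ ⟩
    E′ - h * E′                        ≤⟨ +-mono (expSum-increment k 0≤u 0≤h) (neg-anti (*-monoʳ h 0≤h
                                            (≤-from _ (term-nonNeg k (0≤+ 0≤u 0≤h)) ≈-refl))) ⟩
    (expSum (suc k) u + h * E) - h * E ≈⟨ solve 2 (λ x y → x :+ y :- y := x) ≈-refl (expSum (suc k) u) (h * E) ⟩
    expSum (suc k) u                   ∎
    where
    open ≤-Reasoning
    E  = expSum k (u + h)
    E′ = expSum (suc k) (u + h)

  expSum-0 : ∀ k → expSum k 0# ≤ 1#
  expSum-0 zero          = 0≤1
  expSum-0 (suc zero)    = ≤-reflexive (≈-trans (+-identityˡ _) (≈-trans (*-identityˡ _) inv!-0))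
  expSum-0 (suc (suc k)) = ≤-respˡ (≈-sym (≈-trans (+-congˡ (≈-trans (*-congʳ (zeroˡ _)) (zeroˡ _)))
    (+-identityʳ _))) (expSum-0 (suc k))

  [1-h]^s-expSum≤1 : ∀ k s {h} → 0# ≤ h → h ≤ 1# → (1# - h) ^ s * expSum k (nat s * h) ≤ 1#
  [1-h]^s-expSum≤1 k zero    {h} 0≤h h≤1 = ≤-respˡ (≈-sym (*-identityˡ _))
    (≤-respˡ (expSum-cong k (≈-sym (zeroˡ h))) (expSum-0 k))
  [1-h]^s-expSum≤1 k (suc s) {h} 0≤h h≤1 = begin
    (1# - h) * (1# - h) ^ s * expSum k (nat (suc s) * h)  ≈⟨ *-congˡ (expSum-cong k
      (solve 2 (λ s h → (:1 :+ s) :* h := s :* h :+ h) ≈-refl (nat s) h)) ⟩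
    (1# - h) * (1# - h) ^ s * expSum k (nat s * h + h)    ≈⟨ solve 3 (λ a b c → a :* b :* c := b :* (a :* c)) ≈-refl (1# - h) ((1# - h) ^ s) _ ⟩
    (1# - h) ^ s * ((1# - h) * expSum k (nat s * h + h))  ≤⟨ *-monoʳ _ (^-nonNeg s (0≤y-x h≤1))
      (expSum-step k (*-nonNeg (0≤nat s) 0≤h) 0≤h) ⟩
    (1# - h) ^ s * expSum k (nat s * h)                   ≤⟨ [1-h]^s-expSum≤1 k s 0≤h h≤1 ⟩
    1#                                                    ∎
    where open ≤-Reasoning

  bernoulli : ∀ e {h} → 0# ≤ h → h ≤ 1# → 1# - nat e * h ≤ (1# - h) ^ e
  bernoulli zero    {h} 0≤h h≤1 = ≤-reflexive (solve 1 (λ h → :1 :- :0 :* h := :1) ≈-refl h)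
  bernoulli (suc e) {h} 0≤h h≤1 = begin
    1# - nat (suc e) * h                  ≤⟨ ≤-from (nat e * (h * h)) (*-nonNeg (0≤nat e) (0≤x² h))
      (solve 2 (λ e h → :1 :- (:1 :+ e) :* h :+ e :* (h :* h) := (:1 :- h) :* (:1 :- e :* h)) ≈-refl (nat e) h) ⟩
    (1# - h) * (1# - nat e * h)           ≤⟨ *-monoʳ _ (0≤y-x h≤1) (bernoulli e 0≤h h≤1) ⟩
    (1# - h) * (1# - h) ^ e               ∎
    where open ≤-Reasoning

  module _ {p y : Carrier} (s e : ℕ) .{{_ : NonZero e}} (0≤p : 0# ≤ p) (p≤1 : p ≤ 1#)
           (0≤y : 0# ≤ y) (ey≤sp : nat e * y ≤ nat s * p) where
    private
      0<e : 0# < nat e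
      0<e = 0<nat {e} (ℕ.n≢0⇒n>0 (ℕ.≢-nonZero⁻¹ e))

      h = p * nat e ⁻¹

      eh≈p : nat e * h ≈ p
      eh≈p = ÷-cancel (>⇒≉0 0<e)

      0≤h : 0# ≤ h
      0≤h = *-nonNeg 0≤p (proj₁ (0<⁻¹ 0<e))

      h≤1 : h ≤ 1#
      h≤1 = *-cancelˡ-≤ (nat e) 0<e (begin
        nat e * h   ≈⟨ eh≈p ⟩
        p           ≤⟨ p≤1 ⟩
        1#          ≈⟨ nat-1 ⟨
        nat 1       ≤⟨ nat-mono (ℕ.n≢0⇒n>0 (ℕ.≢-nonZero⁻¹ e)) ⟩
        nat e       ≈⟨ *-identityʳ _ ⟨
        nat e * 1#  ∎)
        where open ≤-Reasoning

      y≤sh : y ≤ nat s * h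
      y≤sh = *-cancelˡ-≤ (nat e) 0<e (begin
        nat e * y           ≤⟨ ey≤sp ⟩
        nat s * p           ≈⟨ *-congˡ eh≈p ⟨
        nat s * (nat e * h) ≈⟨ solve 3 (λ s e h → s :* (e :* h) := e :* (s :* h)) ≈-refl (nat s) (nat e) h ⟩
        nat e * (nat s * h) ∎)
        where open ≤-Reasoning

    [1-p]^s-expSum^e≤1 : ∀ k → (1# - p) ^ s * expSum k y ^ e ≤ 1#
    [1-p]^s-expSum^e≤1 k = begin
      (1# - p) ^ s * expSum k y ^ e                       ≤⟨ *-mono (^-nonNeg s (0≤y-x p≤1)) (^-nonNeg e (expSum-nonNeg k 0≤y))
                                                               (^-mono s (0≤y-x p≤1) 1-p≤) (^-mono e (expSum-nonNeg k 0≤y) (expSum-mono k 0≤y y≤sh)) ⟩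
      ((1# - h) ^ e) ^ s * expSum k (nat s * h) ^ e       ≈⟨ *-congʳ (≈-trans (^-assocʳ _ e s)
                                                               (≈-trans (reflexive (≡.cong ((1# - h) ^_) (ℕ.*-comm e s))) (≈-sym (^-assocʳ _ s e)))) ⟩
      ((1# - h) ^ s) ^ e * expSum k (nat s * h) ^ e       ≈⟨ ^-distrib-* _ _ e ⟨
      ((1# - h) ^ s * expSum k (nat s * h)) ^ e           ≤⟨ ^-mono e (*-nonNeg (^-nonNeg s (0≤y-x h≤1))
                                                               (expSum-nonNeg k (*-nonNeg (0≤nat s) 0≤h))) ([1-h]^s-expSum≤1 k s 0≤h h≤1) ⟩
      1# ^ e                                              ≈⟨ 1^n≈1 e ⟩
      1#                                                  ∎
      where
      open ≤-Reasoning
      1-p≤ : 1# - p ≤ (1# - h) ^ e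
      1-p≤ = ≤-respˡ (+-congˡ (-‿cong eh≈p)) (bernoulli e 0≤h h≤1)

    module _ (em : ExcludedMiddle 0ℓ) {N : Carrier} (0<N : 0# < N) (exp : IsExp ℝ y N) where
      -- Otherwise v := (1 - p)ˢ Nᵉ > 1, and already (1 - p)ˢ (N (1 - η))ᵉ > 1 for a small η > 0.
      [1-p]^s-N^e≤1 : (1# - p) ^ s * N ^ e ≤ 1#
      [1-p]^s-N^e≤1 with em {(1# - p) ^ s * N ^ e ≤ 1#}
      ... | yes le = le
      ... | no ¬le = contradiction upper (<⇒≱ lower)
        where
        v = (1# - p) ^ s * N ^ e
        1<v : 1# < v
        1<v = ≰⇒> ¬le
        0<v : 0# < v
        0<v = <-≤-trans 0<1 (proj₁ 1<v)
        w = v * nat (suc e)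
        0<w : 0# < w
        0<w = 0<* 0<v (0<nat {suc e} (s≤s z≤n))
        η = (v - 1#) * w ⁻¹
        wη : w * η ≈ v - 1#
        wη = ÷-cancel (>⇒≉0 0<w)
        0<η : 0# < η
        0<η = 0<* (0<x-y 1<v) (0<⁻¹ 0<w)
        η≤1 : η ≤ 1#
        η≤1 = *-cancelˡ-≤ w 0<w (≤-respˡ (≈-sym wη) (≤-from (v * nat e + 1#)
          (0≤+ (*-nonNeg (proj₁ 0<v) (0≤nat e)) 0≤1)
          (solve 2 (λ v e → v :- :1 :+ (v :* e :+ :1) := v :* (:1 :+ e) :* :1) ≈-refl v (nat e))))
        conv = exp (N * η) (0<* 0<N 0<η)
        M = proj₁ conv
        u = N * (1# - η)
        u≤E : u ≤ expSum M y
        u≤E = ≤-respˡ (solve 2 (λ n h → n :- n :* h := n :* (:1 :- h)) ≈-refl N η)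
          (≤-respʳ (sum≈partialSum (λ j → term j y) M) (proj₁ (proj₁ (proj₂ conv M ℕ.≤-refl))))
        0≤u : 0# ≤ u
        0≤u = *-nonNeg (proj₁ 0<N) (0≤y-x η≤1)
        upper : (1# - p) ^ s * u ^ e ≤ 1#
        upper = ≤-trans (*-monoʳ _ (^-nonNeg s (0≤y-x p≤1)) (^-mono e 0≤u u≤E)) ([1-p]^s-expSum^e≤1 M)
        lower : 1# < (1# - p) ^ s * u ^ e
        lower = <-≤-trans (≤-from _ (proj₁ 0<vη) ≈-refl , λ eq → proj₂ 0<vη (begin-equality
            0#                     ≈⟨ -‿inverseʳ 1# ⟨
            1# - 1#                ≈⟨ +-congʳ eq ⟩
            (1# + v * η) - 1#      ≈⟨ solve 1 (λ x → :1 :+ x :- :1 := x) ≈-refl (v * η) ⟩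
            v * η                  ∎)) (begin
          1# + v * η                                 ≈⟨ solve 3 (λ v e h → :1 :+ v :* h := v :- (v :- :1) :+ v :* h) ≈-refl v (nat e) η ⟩
          v - (v - 1#) + v * η                       ≈⟨ +-congʳ (+-congˡ (-‿cong wη)) ⟨
          v - w * η + v * η                          ≈⟨ solve 3 (λ v e h → v :- v :* (:1 :+ e) :* h :+ v :* h := v :* (:1 :- e :* h)) ≈-refl v (nat e) η ⟩
          v * (1# - nat e * η)                       ≤⟨ *-monoʳ v (proj₁ 0<v) (bernoulli e (proj₁ 0<η) η≤1) ⟩
          v * (1# - η) ^ e                           ≈⟨ *-assoc _ _ _ ⟩
          (1# - p) ^ s * (N ^ e * (1# - η) ^ e)      ≈⟨ *-congˡ (^-distrib-* N (1# - η) e) ⟨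
          (1# - p) ^ s * u ^ e                       ∎)
          where
          open ≤-Reasoning
          0<vη = 0<* 0<v 0<η

module LogarithmPositive (ℝ : CompleteOrderedField) (em : ExcludedMiddle 0ℓ) where
  open OrderedField ℝ
  open IntermediateValue ℝ
  open Exponential ℝ

  binomialSum : ℕ → ℕ → Carrier → Carrier
  binomialSum M K t = partialSum (λ j → nat (M P′ j) * inv! j * t ^ j) K

  binomialSum-suc : ∀ M K t → binomialSum (suc M) (suc K) t ≈ binomialSum M (suc K) t + t * binomialSum M K t
  binomialSum-suc M zero    t = solve 2 (λ t x → :0 :+ x := :0 :+ x :+ t :* :0) ≈-refl t _
  binomialSum-suc M (suc K) t = begin
    binomialSum (suc M) (suc K) t + nat (suc M P′ suc K) * c * (t * t ^ K)
      ≈⟨ +-cong (binomialSum-suc M K t) (*-congʳ (*-congʳ nat-P′)) ⟩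
    (binomialSum M (suc K) t + t * binomialSum M K t) + (nat (M P′ suc K) + n * nat (M P′ K)) * c * (t * t ^ K)
      ≈⟨ solve 8 (λ a t b f n g c x → (a :+ t :* b) :+ (f :+ n :* g) :* c :* (t :* x)
                := (a :+ f :* c :* (t :* x)) :+ t :* (b :+ g :* (n :* c) :* x))
           ≈-refl (binomialSum M (suc K) t) t (binomialSum M K t) (nat (M P′ suc K)) n (nat (M P′ K)) c (t ^ K) ⟩
    (binomialSum M (suc K) t + nat (M P′ suc K) * c * (t * t ^ K)) + t * (binomialSum M K t + nat (M P′ K) * (n * c) * t ^ K)
      ≈⟨ +-congˡ (*-congˡ (+-congˡ (*-congʳ (*-congˡ (inv!-suc K))))) ⟩
    binomialSum M (suc (suc K)) t + t * binomialSum M (suc K) t ∎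
    where
    open ≈-Reasoning
    n = nat (suc K)
    c = inv! (suc K)
    nat-P′ : nat (suc M P′ suc K) ≈ nat (M P′ suc K) + n * nat (M P′ K)
    nat-P′ = ≈-trans (reflexive (≡.cong nat (P′-suc M K)))
      (≈-trans (nat-+ (M P′ suc K) _) (+-congˡ (nat-* (suc K) (M P′ K))))

  binomial-theorem : ∀ {M K} t → M ℕ.< K → binomialSum M K t ≈ (1# + t) ^ M
  binomial-theorem {zero}  {suc zero}    t _ =
    ≈-trans (+-identityˡ _) (≈-trans (*-identityʳ _) (≈-trans (*-cong nat-1 inv!-0) (*-identityˡ _)))
  binomial-theorem {zero}  {suc (suc K)} t _ = ≈-trans
    (+-cong (binomial-theorem {zero} {suc K} t (s≤s z≤n)) (begin
      nat ((0 ℕ.∸ K) ℕ.* (0 P′ K)) * inv! (suc K) * t ^ suc K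
        ≡⟨ ≡.cong (λ z → nat (z ℕ.* (0 P′ K)) * inv! (suc K) * t ^ suc K) (ℕ.0∸n≡0 K) ⟩
      0# * inv! (suc K) * t ^ suc K
        ≈⟨ solve 2 (λ x y → :0 :* x :* y := :0) ≈-refl (inv! (suc K)) (t ^ suc K) ⟩
      0# ∎))
    (+-identityʳ 1#)
    where open ≈-Reasoning
  binomial-theorem {suc M} {suc K}       t (s≤s M<K) = begin
    binomialSum (suc M) (suc K) t                     ≈⟨ binomialSum-suc M K t ⟩
    binomialSum M (suc K) t + t * binomialSum M K t   ≈⟨ +-cong (binomial-theorem t (ℕ.m≤n⇒m≤1+n M<K)) (*-congˡ (binomial-theorem t M<K)) ⟩
    (1# + t) ^ M + t * (1# + t) ^ M                   ≈⟨ solve 2 (λ t x → x :+ t :* x := (:1 :+ t) :* x) ≈-refl t ((1# + t) ^ M) ⟩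
    (1# + t) ^ suc M                                  ∎
    where open ≈-Reasoning

  neg-^≤^ : ∀ j {z} → 0# ≤ z → Within (z ^ j) ((- z) ^ j)
  neg-^≤^ zero    0≤z = ≤-trans (≤-from 1# 0≤1 (-‿inverseˡ 1#)) 0≤1 , ≤-refl
  neg-^≤^ (suc j) {z} 0≤z = within-* (≤-refl , ≤-trans (≤-from z 0≤z (-‿inverseˡ z)) 0≤z) (neg-^≤^ j 0≤z)

  module _ (M : ℕ) .{{_ : NonZero M}} where
    private
      w = nat M ⁻¹

      0<M : 0# < nat M
      0<M = 0<nat {M} (ℕ.n≢0⇒n>0 (ℕ.≢-nonZero⁻¹ M))

      Mw≈1 : nat M * w ≈ 1#
      Mw≈1 = ⁻¹-inverseʳ (>⇒≉0 0<M)

      M^w^≈1 : ∀ j → nat M ^ j * w ^ j ≈ 1#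
      M^w^≈1 j = ≈-trans (≈-sym (^-distrib-* (nat M) w j)) (≈-trans (^-congˡ j Mw≈1) (1^n≈1 j))

      0≤w : 0# ≤ w
      0≤w = proj₁ (0<⁻¹ 0<M)

      ratio : ℕ → Carrier
      ratio j = nat (M P′ j) * w ^ j

      ratio≤1 : ∀ j → ratio j ≤ 1#
      ratio≤1 j = begin
        nat (M P′ j) * w ^ j  ≤⟨ *-monoˡ _ (^-nonNeg j 0≤w) (nat-mono (P′≤^ M j)) ⟩
        nat (M ℕ.^ j) * w ^ j ≈⟨ *-congʳ (nat-^ M j) ⟩
        nat M ^ j * w ^ j     ≈⟨ M^w^≈1 j ⟩
        1#                    ∎
        where open ≤-Reasoning

      1≤ratio+ : ∀ j → 1# ≤ ratio j + nat 2 ^ j * w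
      1≤ratio+ j = begin
        1#                                                      ≈⟨ *-identityˡ 1# ⟨
        1# * 1#                                                 ≈⟨ *-cong Mw≈1 (M^w^≈1 j) ⟨
        (nat M * w) * (nat M ^ j * w ^ j)                       ≈⟨ solve 4 (λ m w x y → (m :* w) :* (x :* y) := (m :* x) :* (w :* y)) ≈-refl (nat M) w (nat M ^ j) (w ^ j) ⟩
        (nat M * nat M ^ j) * (w * w ^ j)                       ≈⟨ *-congʳ (nat-^ M (suc j)) ⟨
        nat (M ℕ.* M ℕ.^ j) * (w * w ^ j)                       ≤⟨ *-monoˡ _ (^-nonNeg (suc j) 0≤w) (nat-mono (^≤P′ M j)) ⟩
        nat (M ℕ.* (M P′ j) ℕ.+ 2 ℕ.^ j ℕ.* M ℕ.^ j) * (w * w ^ j) ≈⟨ *-congʳ (≈-trans (nat-+ (M ℕ.* (M P′ j)) _)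
                                                                    (+-cong (nat-* M _) (≈-trans (nat-* (2 ℕ.^ j) (M ℕ.^ j)) (*-cong (nat-^ 2 j) (nat-^ M j))))) ⟩
        (nat M * nat (M P′ j) + nat 2 ^ j * nat M ^ j) * (w * w ^ j) ≈⟨ solve 6 (λ m f t x w y →
                                                                    (m :* f :+ t :* x) :* (w :* y) := (m :* w) :* (f :* y) :+ (x :* y) :* (t :* w))
                                                                    ≈-refl (nat M) (nat (M P′ j)) (nat 2 ^ j) (nat M ^ j) w (w ^ j) ⟩
        (nat M * w) * ratio j + (nat M ^ j * w ^ j) * (nat 2 ^ j * w) ≈⟨ +-cong (*-congʳ Mw≈1) (*-congʳ (M^w^≈1 j)) ⟩
        1# * ratio j + 1# * (nat 2 ^ j * w)                     ≈⟨ +-cong (*-identityˡ _) (*-identityˡ _) ⟩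
        ratio j + nat 2 ^ j * w                                 ∎
        where open ≤-Reasoning

      term-bound : ∀ j {z} → 0# ≤ z →
        term j (- z) ≤ nat (M P′ j) * inv! j * (- z * w) ^ j + w * term j (nat 2 * z)
      term-bound j {z} 0≤z = begin
        (- z) ^ j * c                                      ≈⟨ solve 3 (λ x c a → x :* c := a :* c :* x :+ x :* (c :* (:1 :- a))) ≈-refl ((- z) ^ j) c a ⟩
        a * c * (- z) ^ j + (- z) ^ j * (c * (1# - a))     ≤⟨ +-mono ≤-refl (*-monoˡ _ (*-nonNeg (0≤inv! j) (0≤y-x (ratio≤1 j))) (proj₂ (neg-^≤^ j 0≤z))) ⟩
        a * c * (- z) ^ j + z ^ j * (c * (1# - a))         ≤⟨ +-mono ≤-refl (*-monoʳ _ (^-nonNeg j 0≤z) (*-monoʳ c (0≤inv! j) 1-a≤)) ⟩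
        a * c * (- z) ^ j + z ^ j * (c * (nat 2 ^ j * w))  ≈⟨ solve 7 (λ f y c x z t w → f :* y :* c :* x :+ z :* (c :* (t :* w))
                                                                := f :* c :* (x :* y) :+ w :* ((t :* z) :* c)) ≈-refl (nat (M P′ j)) (w ^ j) c ((- z) ^ j) (z ^ j) (nat 2 ^ j) w ⟩
        nat (M P′ j) * c * ((- z) ^ j * w ^ j) + w * ((nat 2 ^ j * z ^ j) * c)
                                                           ≈⟨ +-cong (*-congˡ (^-distrib-* (- z) w j)) (*-congˡ (*-congʳ (^-distrib-* (nat 2) z j))) ⟨
        nat (M P′ j) * c * (- z * w) ^ j + w * term j (nat 2 * z) ∎
        where
        open ≤-Reasoning
        a = ratio j
        c = inv! j
        1-a≤ : 1# - a ≤ nat 2 ^ j * w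
        1-a≤ = ≤-respʳ (solve 2 (λ a x → a :+ x :- a := x) ≈-refl a (nat 2 ^ j * w)) (+-monoˡ-≤ (- a) (1≤ratio+ j))

      expSum≤binomialSum : ∀ K {z} → 0# ≤ z →
        expSum K (- z) ≤ binomialSum M K (- z * w) + w * expSum K (nat 2 * z)
      expSum≤binomialSum zero    {z} 0≤z = ≤-reflexive (solve 1 (λ w → :0 := :0 :+ w :* :0) ≈-refl w)
      expSum≤binomialSum (suc K) {z} 0≤z = ≤-trans (+-mono (expSum≤binomialSum K 0≤z) (term-bound K 0≤z))
        (≤-reflexive (solve 5 (λ a w b c d → (a :+ w :* b) :+ (c :+ w :* d) := (a :+ c) :+ w :* (b :+ d))
          ≈-refl (binomialSum M K (- z * w)) w (expSum K (nat 2 * z)) _ (term K (nat 2 * z))))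

    expSum-neg-bound : ∀ {z D} → 0# ≤ z → z ≤ nat M → expSum (suc M) (nat 2 * z) ≤ D →
      nat M * expSum (suc M) (- z) ≤ nat M + D
    expSum-neg-bound {z} {D} 0≤z z≤M E≤D = begin
      nat M * expSum (suc M) (- z)         ≤⟨ *-monoʳ _ (0≤nat M) (expSum≤binomialSum (suc M) 0≤z) ⟩
      nat M * (binomialSum M (suc M) (- z * w) + w * E)  ≤⟨ *-monoʳ _ (0≤nat M) (+-mono binomial≤1 (*-monoʳ w 0≤w E≤D)) ⟩
      nat M * (1# + w * D)                 ≈⟨ solve 3 (λ m w d → m :* (:1 :+ w :* d) := m :+ (m :* w) :* d) ≈-refl (nat M) w D ⟩
      nat M + (nat M * w) * D              ≈⟨ +-congˡ (≈-trans (*-congʳ Mw≈1) (*-identityˡ D)) ⟩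
      nat M + D                            ∎
      where
      open ≤-Reasoning
      E = expSum (suc M) (nat 2 * z)
      zw≤1 : z * w ≤ 1#
      zw≤1 = ≤-respʳ Mw≈1 (*-monoˡ w 0≤w z≤M)
      binomial≤1 : binomialSum M (suc M) (- z * w) ≤ 1#
      binomial≤1 = begin
        binomialSum M (suc M) (- z * w)  ≈⟨ binomial-theorem {M} {suc M} (- z * w) ℕ.≤-refl ⟩
        (1# + - z * w) ^ M               ≈⟨ ^-congˡ M (solve 2 (λ z w → :1 :+ :- z :* w := :1 :- z :* w) ≈-refl z w) ⟩
        (1# - z * w) ^ M                 ≤⟨ ^-mono M (0≤y-x zw≤1) (≤-from (z * w) (*-nonNeg 0≤z 0≤w)
                                              (solve 1 (λ x → :1 :- x :+ x := :1) ≈-refl (z * w))) ⟩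
        1# ^ M                           ≈⟨ 1^n≈1 M ⟩
        1#                               ∎

  expSum-bounded : ∀ {x} → 0# ≤ x → ∃ λ D → ∀ k → expSum k x ≤ D
  expSum-bounded {x} 0≤x = v ⁻¹ , λ k → *-cancelˡ-≤ v 0<v (begin
    v * expSum k x                        ≈⟨ *-congˡ (expSum-cong k sh≈x) ⟨
    v * expSum k (nat (suc s) * h)        ≤⟨ [1-h]^s-expSum≤1 k (suc s) 0≤h (≤-respʳ (solve 1 (λ h → :1 :- h :+ h := :1) ≈-refl h)
                                               (≤-respˡ (+-identityˡ h) (+-monoˡ-≤ h (proj₁ 0<1-h)))) ⟩
    1#                                    ≈⟨ ⁻¹-inverseʳ (>⇒≉0 0<v) ⟨
    v * v ⁻¹                              ∎)
    where
    open ≤-Reasoning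
    s = proj₁ (archimedean em x)
    x≤s = proj₂ (archimedean em x)
    0<1+s : 0# < nat (suc s)
    0<1+s = 0<nat {suc s} (s≤s z≤n)
    h = x * nat (suc s) ⁻¹
    sh≈x = ÷-cancel {x} (>⇒≉0 0<1+s)
    0≤h : 0# ≤ h
    0≤h = *-nonNeg 0≤x (proj₁ (0<⁻¹ 0<1+s))
    [1+s][1-h] : nat (suc s) * (1# - h) ≈ 1# + (nat s - x)
    [1+s][1-h] = ≈-trans (solve 2 (λ n h → n :* (:1 :- h) := n :- n :* h) ≈-refl (nat (suc s)) h)
      (≈-trans (+-congˡ (-‿cong sh≈x)) (+-assoc _ _ _))
    0<[1+s][1-h] : 0# < nat (suc s) * (1# - h)
    0<[1+s][1-h] = <-≤-trans (0<+ 0<1 (0≤y-x x≤s)) (≤-reflexive (≈-sym [1+s][1-h]))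
    0<1-h : 0# < 1# - h
    0<1-h = ≰⇒> λ 1-h≤0 → <⇒≱ 0<[1+s][1-h] (≤-respʳ (zeroʳ _) (*-monoʳ _ (0≤nat (suc s)) 1-h≤0))
    v = (1# - h) ^ suc s
    0<v = ^-pos (suc s) 0<1-h

  log-positive : ∀ {y n} → 2 ℕ.≤ n → IsLog ℝ (nat n) y → 0# < y
  log-positive {y} {n} 2≤n exp with em {y ≤ 0#}
  ... | no  y≰0 = ≰⇒> y≰0
  ... | yes y≤0 = contradiction
          (nat-cancel-≤ {M} {m₂} (≤-trans M≤2D 2D≤m₂))
          (ℕ.<⇒≱ (s≤s (ℕ.m≤n+m m₂ (M₀ ℕ.+ m₁))))
    where
    z = - y
    0≤z = neg-nonNeg y≤0
    0<2 : 0# < nat 2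
    0<2 = 0<nat {2} (s≤s z≤n)
    η = nat 2 ⁻¹
    2η≈1 : nat 2 * η ≈ 1#
    2η≈1 = ⁻¹-inverseʳ (>⇒≉0 0<2)
    conv = exp η (0<⁻¹ 0<2)
    M₀ = proj₁ conv
    bounded = expSum-bounded (*-nonNeg (0≤nat 2) 0≤z)
    D = proj₁ bounded
    m₁ = proj₁ (archimedean em z)
    m₂ = proj₁ (archimedean em (nat 2 * D))
    2D≤m₂ = proj₂ (archimedean em (nat 2 * D))
    M = suc (M₀ ℕ.+ m₁ ℕ.+ m₂)
    M₀≤1+M : M₀ ℕ.≤ suc M
    M₀≤1+M = ℕ.m≤n⇒m≤1+n (ℕ.m≤n⇒m≤1+n (ℕ.≤-trans (ℕ.m≤m+n M₀ m₁) (ℕ.m≤m+n _ m₂)))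
    z≤M : z ≤ nat M
    z≤M = ≤-trans (proj₂ (archimedean em z))
      (nat-mono (ℕ.m≤n⇒m≤1+n (ℕ.≤-trans (ℕ.m≤n+m m₁ M₀) (ℕ.m≤m+n _ m₂))))
    N-η≤E : nat 2 - η ≤ expSum (suc M) (- z)
    N-η≤E = begin
      nat 2 - η                                ≤⟨ +-monoˡ-≤ (- η) (nat-mono 2≤n) ⟩
      nat n - η                                ≤⟨ proj₁ (proj₁ (proj₂ conv (suc M) M₀≤1+M)) ⟩
      sum {suc M} (λ k → term (toℕ k) y)       ≈⟨ sum≈partialSum (λ j → term j y) (suc M) ⟩
      expSum (suc M) y                         ≈⟨ expSum-cong (suc M) (solve 1 (λ y → y := :- (:- y)) ≈-refl y) ⟩
      expSum (suc M) (- z)                     ∎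
      where open ≤-Reasoning
    M≤2D : nat M ≤ nat 2 * D
    M≤2D = ≤-from-difference (begin
      nat M + nat 2 * nat M                             ≈⟨ solve 1 (λ m → m :+ (:1 :+ (:1 :+ :0)) :* m := m :* ((:1 :+ (:1 :+ :0)) :* (:1 :+ (:1 :+ :0)) :- :1)) ≈-refl (nat M) ⟩
      nat M * (nat 2 * nat 2 - 1#)                      ≈⟨ *-congˡ (+-congˡ (-‿cong 2η≈1)) ⟨
      nat M * (nat 2 * nat 2 - nat 2 * η)               ≈⟨ solve 3 (λ m t h → m :* (t :* t :- t :* h) := t :* (m :* (t :- h))) ≈-refl (nat M) (nat 2) η ⟩
      nat 2 * (nat M * (nat 2 - η))                     ≤⟨ *-monoʳ _ (0≤nat 2) (*-monoʳ _ (0≤nat M) N-η≤E) ⟩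
      nat 2 * (nat M * expSum (suc M) (- z))            ≤⟨ *-monoʳ _ (0≤nat 2) (expSum-neg-bound M 0≤z z≤M (proj₂ bounded (suc M))) ⟩
      nat 2 * (nat M + D)                               ≈⟨ solve 3 (λ t m d → t :* (m :+ d) := t :* d :+ t :* m) ≈-refl (nat 2) (nat M) D ⟩
      nat 2 * D + nat 2 * nat M                         ∎)
      where
      open ≤-Reasoning
      ≤-from-difference : ∀ {a b c} → a + c ≤ b + c → a ≤ b
      ≤-from-difference {a} {b} {c} le = ≤-from ((b + c) - (a + c)) (0≤y-x le)
        (solve 3 (λ a b c → a :+ ((b :+ c) :- (a :+ c)) := b) ≈-refl a b c)

module Covering where
  open ListSum ℕ.+-*-commutativeSemiring

  indicator : {P : Set} → Dec P → ℕ
  indicator (yes _) = 1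
  indicator (no  _) = 0

  ∑-const : {A : Set} (xs : List A) (c : ℕ) → ∑ xs (λ _ → c) ≡ length xs ℕ.* c
  ∑-const []       c = ≡.refl
  ∑-const (x ∷ xs) c = ≡.cong (c ℕ.+_) (∑-const xs c)

  pigeonhole : {A : Set} (x : A) (xs : List A) (h : A → ℕ) →
    ∃ λ y → length (x ∷ xs) ℕ.* h y ℕ.≤ ∑ (x ∷ xs) h
  pigeonhole x []           h = x , ℕ.≤-refl
  pigeonhole x xs@(x′ ∷ ys) h with pigeonhole x′ ys h
  ... | y , le with ℕ.≤-total (h x) (h y)
  ...   | inj₁ hx≤hy = x , ℕ.+-monoʳ-≤ (h x) (ℕ.≤-trans (ℕ.*-monoʳ-≤ (length xs) hx≤hy) le)
  ...   | inj₂ hy≤hx = y , ℕ.+-mono-≤ hy≤hx le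

  module _ {A X : Set} {Covers : A → X → Set} (covers? : ∀ φ x → Dec (Covers φ x)) where

    remaining : A → List X → List X
    remaining φ = List.filter (¬? ∘ covers? φ)

    length-remaining : ∀ φ B → length (remaining φ B) ℕ.+ ∑ B (indicator ∘ covers? φ) ≡ length B
    length-remaining φ []      = ≡.refl
    length-remaining φ (x ∷ B) with covers? φ x
    ... | yes _ = ≡.trans (ℕ.+-suc _ _) (≡.cong suc (length-remaining φ B))
    ... | no  _ = ≡.cong suc (length-remaining φ B)

    uncovered : List A → List X → List X
    uncovered []       B = B
    uncovered (φ ∷ φs) B = uncovered φs (remaining φ B)

    uncovered-empty : ∀ φs B → length (uncovered φs B) ≡ 0 → ∀ {x} → x ∈ B → Any (λ φ → Covers φ x) φs
    uncovered-empty []       []      _   ()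
    uncovered-empty (φ ∷ φs) B       eq {x} x∈B with covers? φ x
    ... | yes c = here c
    ... | no ¬c = there (uncovered-empty φs (remaining φ B) eq (∈-filter⁺ (¬? ∘ covers? φ) x∈B ¬c))

    module _ (φ₀ : A) (Φ′ : List A) (P Q : ℕ) where
      private Φ = φ₀ ∷ Φ′

      OftenCovered : X → Set
      OftenCovered x = length Φ ℕ.* P ℕ.≤ Q ℕ.* ∑ Φ (λ φ → indicator (covers? φ x))

      cover-step : ∀ {B} → All OftenCovered B → ∃ λ φ → Q ℕ.* length (remaining φ B) ℕ.≤ (Q ℕ.∸ P) ℕ.* length B
      cover-step {B} often =
        let φ , le = pigeonhole φ₀ Φ′ (λ φ → length (remaining φ B))
        in φ , ℕ.*-cancelˡ-≤ (length Φ) (begin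
          length Φ ℕ.* (Q ℕ.* length (remaining φ B))  ≡⟨ swap (length Φ) Q _ ⟩
          Q ℕ.* (length Φ ℕ.* length (remaining φ B))  ≤⟨ ℕ.*-monoʳ-≤ Q le ⟩
          Q ℕ.* R                                      ≤⟨ QR≤ ⟩
          (Q ℕ.∸ P) ℕ.* (length Φ ℕ.* length B)        ≡⟨ swap (Q ℕ.∸ P) (length Φ) _ ⟩
          length Φ ℕ.* ((Q ℕ.∸ P) ℕ.* length B)        ∎)
        where
        open ℕ.≤-Reasoning
        swap : ∀ a b c → a ℕ.* (b ℕ.* c) ≡ b ℕ.* (a ℕ.* c)
        swap = solve-∀
        R C : ℕ
        R = ∑ Φ (λ φ → length (remaining φ B))
        C = ∑ Φ (λ φ → ∑ B (indicator ∘ covers? φ))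
        R+C : R ℕ.+ C ≡ length Φ ℕ.* length B
        R+C = ≡.trans (≡.sym (∑-distrib-+ Φ {λ φ → length (remaining φ B)} {λ φ → ∑ B (indicator ∘ covers? φ)})) (≡.trans (∑-cong Φ (λ φ → length-remaining φ B)) (∑-const Φ (length B)))
        QC≥ : ∀ {B} → All OftenCovered B →
          length B ℕ.* (length Φ ℕ.* P) ℕ.≤ Q ℕ.* ∑ B (λ x → ∑ Φ (λ φ → indicator (covers? φ x)))
        QC≥ []         = z≤n
        QC≥ (oc ∷ ocs) = ℕ.≤-trans (ℕ.+-mono-≤ oc (QC≥ ocs)) (ℕ.≤-reflexive (≡.sym (ℕ.*-distribˡ-+ Q _ _)))
        QR≤ : Q ℕ.* R ℕ.≤ (Q ℕ.∸ P) ℕ.* (length Φ ℕ.* length B)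
        QR≤ = begin
          Q ℕ.* R                                                  ≡⟨ ℕ.m+n∸n≡m (Q ℕ.* R) (Q ℕ.* C) ⟨
          Q ℕ.* R ℕ.+ Q ℕ.* C ℕ.∸ Q ℕ.* C                          ≡⟨ ≡.cong (ℕ._∸ Q ℕ.* C) (≡.trans (≡.sym (ℕ.*-distribˡ-+ Q R C)) (≡.cong (Q ℕ.*_) R+C)) ⟩
          Q ℕ.* (length Φ ℕ.* length B) ℕ.∸ Q ℕ.* C                ≤⟨ ℕ.∸-monoʳ-≤ _ (≡.subst (λ z → length B ℕ.* (length Φ ℕ.* P) ℕ.≤ Q ℕ.* z) (≡.sym (∑-comm Φ B)) (QC≥ often)) ⟩
          Q ℕ.* (length Φ ℕ.* length B) ℕ.∸ length B ℕ.* (length Φ ℕ.* P) ≡⟨ ≡.cong (Q ℕ.* (length Φ ℕ.* length B) ℕ.∸_) (rotate (length B) (length Φ) P) ⟩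
          Q ℕ.* (length Φ ℕ.* length B) ℕ.∸ P ℕ.* (length Φ ℕ.* length B) ≡⟨ ℕ.*-distribʳ-∸ _ Q P ⟨
          (Q ℕ.∸ P) ℕ.* (length Φ ℕ.* length B)                    ∎
          where
          rotate : ∀ a b c → a ℕ.* (b ℕ.* c) ≡ c ℕ.* (b ℕ.* a)
          rotate = solve-∀

      cover : ∀ s {B} → All OftenCovered B → ∃ λ φs → length φs ≡ s ×
        Q ℕ.^ s ℕ.* length (uncovered φs B) ℕ.≤ (Q ℕ.∸ P) ℕ.^ s ℕ.* length B
      cover zero    often = [] , ≡.refl , ℕ.≤-refl
      cover (suc s) {B} often =
        let φ , le        = cover-step often
            φs , eq , le′ = cover s (All.filter⁺ (¬? ∘ covers? φ) often)
            U             = length (uncovered φs (remaining φ B))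
        in φ ∷ φs , ≡.cong suc eq , (begin
          Q ℕ.* Q ℕ.^ s ℕ.* U                                      ≡⟨ ℕ.*-assoc Q _ _ ⟩
          Q ℕ.* (Q ℕ.^ s ℕ.* U)                                    ≤⟨ ℕ.*-monoʳ-≤ Q le′ ⟩
          Q ℕ.* ((Q ℕ.∸ P) ℕ.^ s ℕ.* length (remaining φ B))       ≡⟨ swap Q ((Q ℕ.∸ P) ℕ.^ s) _ ⟩
          (Q ℕ.∸ P) ℕ.^ s ℕ.* (Q ℕ.* length (remaining φ B))       ≤⟨ ℕ.*-monoʳ-≤ ((Q ℕ.∸ P) ℕ.^ s) le ⟩
          (Q ℕ.∸ P) ℕ.^ s ℕ.* ((Q ℕ.∸ P) ℕ.* length B)             ≡⟨ assoc ((Q ℕ.∸ P) ℕ.^ s) (Q ℕ.∸ P) _ ⟩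
          (Q ℕ.∸ P) ℕ.* (Q ℕ.∸ P) ℕ.^ s ℕ.* length B               ∎)
        where
        open ℕ.≤-Reasoning
        swap : ∀ a b c → a ℕ.* (b ℕ.* c) ≡ b ℕ.* (a ℕ.* c)
        swap = solve-∀
        assoc : ∀ a b c → a ℕ.* (b ℕ.* c) ≡ b ℕ.* a ℕ.* c
        assoc = solve-∀

-- 0/1 vectors stand for subsets, that is, for multilinear monomials.
Multilinear : ∀ {n} → ℕ → Vec ℕ n → Set
Multilinear d α = VecAll (ℕ._≤ 1) α × Vec.sum α ≡ d

multilinear? : ∀ {n} d (α : Vec ℕ n) → Dec (Multilinear d α)
multilinear? d α = VecAll.all? (ℕ._≤? 1) α ×-dec (Vec.sum α ℕ.≟ d)

sum-replicate : ∀ n v → Vec.sum (Vec.replicate n v) ≡ n ℕ.* v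
sum-replicate zero    v = ≡.refl
sum-replicate (suc n) v = ≡.cong (v ℕ.+_) (sum-replicate n v)

replicate-≤1 : ∀ n {v} → v ℕ.≤ 1 → VecAll (ℕ._≤ 1) (Vec.replicate n v)
replicate-≤1 zero    v≤1 = []
replicate-≤1 (suc n) v≤1 = v≤1 ∷ replicate-≤1 n v≤1

ones-multilinear : ∀ n → Multilinear n (Vec.replicate n 1)
ones-multilinear n = replicate-≤1 n ℕ.≤-refl , ≡.trans (sum-replicate n 1) (ℕ.*-identityʳ n)

subsets : ∀ N → ℕ → List (Vec ℕ N)
subsets zero    zero    = [] ∷ []
subsets zero    (suc e) = []
subsets (suc N) zero    = List.map (0 ∷_) (subsets N zero)
subsets (suc N) (suc e) = List.map (0 ∷_) (subsets N (suc e)) List.++ List.map (1 ∷_) (subsets N e)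

subsets-multilinear : ∀ N e → All (Multilinear e) (subsets N e)
subsets-multilinear zero    zero    = ([] , ≡.refl) ∷ []
subsets-multilinear zero    (suc e) = []
subsets-multilinear (suc N) zero    =
  All.map⁺ (All.map (λ (le , eq) → z≤n ∷ le , eq) (subsets-multilinear N zero))
subsets-multilinear (suc N) (suc e) = All.++⁺
  (All.map⁺ (All.map (λ (le , eq) → z≤n ∷ le , eq) (subsets-multilinear N (suc e))))
  (All.map⁺ (All.map (λ (le , eq) → s≤s z≤n ∷ le , ≡.cong suc eq) (subsets-multilinear N e)))

subsets-complete : ∀ {N} e (β : Vec ℕ N) → Multilinear e β → β ∈ subsets N e
subsets-complete zero    []      _                           = here ≡.refl
subsets-complete (suc e) []      (_ , ())
subsets-complete zero    (0 ∷ β) (_ ∷ le , eq)               = ∈-map⁺ (0 ∷_) (subsets-complete zero β (le , eq))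
subsets-complete (suc e) (0 ∷ β) (_ ∷ le , eq)               =
  ∈-++⁺ˡ (∈-map⁺ (0 ∷_) (subsets-complete (suc e) β (le , eq)))
subsets-complete zero    (suc _ ∷ β) (_ , ())
subsets-complete {suc N} (suc e) (1 ∷ β) (s≤s z≤n ∷ le , eq) =
  ∈-++⁺ʳ (List.map (0 ∷_) (subsets N (suc e))) (∈-map⁺ (1 ∷_) (subsets-complete e β (le , ℕ.suc-injective eq)))

length-subsets-suc : ∀ N e → length (subsets (suc N) (suc e)) ≡ length (subsets N (suc e)) ℕ.+ length (subsets N e)
length-subsets-suc N e = ≡.trans (List.length-++ (List.map (0 ∷_) (subsets N (suc e))))
  (≡.cong₂ ℕ._+_ (List.length-map (0 ∷_) (subsets N (suc e))) (List.length-map (1 ∷_) (subsets N e)))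

length-subsets≤ : ∀ N e → length (subsets N e) ℕ.≤ N ℕ.^ e
length-subsets≤ zero    zero    = ℕ.≤-refl
length-subsets≤ zero    (suc e) = z≤n
length-subsets≤ (suc N) zero    = ≡.subst (ℕ._≤ 1) (≡.sym (List.length-map (0 ∷_) (subsets N zero))) (length-subsets≤ N zero)
length-subsets≤ (suc N) (suc e) = begin
  length (subsets (suc N) (suc e))                     ≡⟨ length-subsets-suc N e ⟩
  length (subsets N (suc e)) ℕ.+ length (subsets N e)  ≤⟨ ℕ.+-mono-≤ (length-subsets≤ N (suc e)) (length-subsets≤ N e) ⟩
  N ℕ.* N ℕ.^ e ℕ.+ N ℕ.^ e                            ≡⟨ ℕ.+-comm (N ℕ.* N ℕ.^ e) _ ⟩
  suc N ℕ.* N ℕ.^ e                                    ≤⟨ ℕ.*-monoʳ-≤ (suc N) (ℕ.^-monoˡ-≤ e (ℕ.n≤1+n N)) ⟩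
  suc N ℕ.* suc N ℕ.^ e                                ∎
  where open ℕ.≤-Reasoning

length-subsets< : ∀ N e → 2 ℕ.≤ e → 0 ℕ.< N → length (subsets N e) ℕ.< N ℕ.^ e
length-subsets< (suc N) (suc e) (s≤s 1≤e) _ = begin-strict
  length (subsets (suc N) (suc e))                     ≡⟨ length-subsets-suc N e ⟩
  length (subsets N (suc e)) ℕ.+ length (subsets N e)  ≤⟨ ℕ.+-mono-≤ (length-subsets≤ N (suc e)) (length-subsets≤ N e) ⟩
  N ℕ.* N ℕ.^ e ℕ.+ N ℕ.^ e                            ≡⟨ ℕ.+-comm (N ℕ.* N ℕ.^ e) _ ⟩
  suc N ℕ.* N ℕ.^ e                                    <⟨ ℕ.*-monoʳ-< (suc N) (ℕ.^-monoˡ-< e {{ℕ.>-nonZero 1≤e}} (ℕ.n<1+n N)) ⟩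
  suc N ℕ.* suc N ℕ.^ e                                ∎
  where open ℕ.≤-Reasoning

module VectorSums where
  open RawSemiringDefs (CommutativeSemiring.rawSemiring ℕ.+-*-commutativeSemiring) using (sum)

  vecProduct : ∀ {n} → (ℕ → ℕ) → Vec ℕ n → ℕ
  vecProduct h []      = 1
  vecProduct h (v ∷ u) = h v ℕ.* vecProduct h u

  vecProduct-updateAt : ∀ {n} h f c (u : Vec ℕ n) b → h (lookup u b) ≡ c ℕ.* h (f (lookup u b)) →
    vecProduct h u ≡ c ℕ.* vecProduct h (updateAt u b f)
  vecProduct-updateAt h f c (v ∷ u) zero    eq = ≡.trans (≡.cong (ℕ._* vecProduct h u) eq) (ℕ.*-assoc c _ _)
  vecProduct-updateAt h f c (v ∷ u) (suc b) eq =
    ≡.trans (≡.cong (h v ℕ.*_) (vecProduct-updateAt h f c u b eq)) (swap (h v) c _)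
    where
    swap : ∀ a b c → a ℕ.* (b ℕ.* c) ≡ b ℕ.* (a ℕ.* c)
    swap = solve-∀

  vecProduct-zero : ∀ {n} h → h 0 ≡ 1 → (u : Vec ℕ n) → Vec.sum u ≡ 0 → vecProduct h u ≡ 1
  vecProduct-zero h h0≡1 []         eq = ≡.refl
  vecProduct-zero h h0≡1 (zero ∷ u) eq = ≡.cong₂ ℕ._*_ h0≡1 (vecProduct-zero h h0≡1 u eq)

  vecProduct-replicate : ∀ n h v → vecProduct h (Vec.replicate n v) ≡ h v ℕ.^ n
  vecProduct-replicate zero    h v = ≡.refl
  vecProduct-replicate (suc n) h v = ≡.cong (h v ℕ.*_) (vecProduct-replicate n h v)

  sum-updateAt-pred : ∀ {n} (u : Vec ℕ n) b {v} → lookup u b ≡ suc v → Vec.sum u ≡ suc (Vec.sum (updateAt u b ℕ.pred))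
  sum-updateAt-pred (_ ∷ u) zero    ≡.refl = ≡.refl
  sum-updateAt-pred (w ∷ u) (suc b) eq     = ≡.trans (≡.cong (w ℕ.+_) (sum-updateAt-pred u b eq)) (ℕ.+-suc w _)

  sum-updateAt-suc : ∀ {n} (u : Vec ℕ n) b → Vec.sum (updateAt u b suc) ≡ suc (Vec.sum u)
  sum-updateAt-suc (_ ∷ u) zero    = ≡.refl
  sum-updateAt-suc (w ∷ u) (suc b) = ≡.trans (≡.cong (w ℕ.+_) (sum-updateAt-suc u b)) (ℕ.+-suc w _)

  lookup≤sum : ∀ {n} (u : Vec ℕ n) b → lookup u b ℕ.≤ Vec.sum u
  lookup≤sum (v ∷ u) zero    = ℕ.m≤m+n v _
  lookup≤sum (v ∷ u) (suc b) = ℕ.≤-trans (lookup≤sum u b) (ℕ.m≤n+m _ v)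

  sum-weighted : ∀ {n} (u : Vec ℕ n) Y (g : Fin n → ℕ) → (∀ b → lookup u b ℕ.* Y ℕ.≤ g b) → Vec.sum u ℕ.* Y ℕ.≤ sum g
  sum-weighted []      Y g le = z≤n
  sum-weighted (v ∷ u) Y g le = ℕ.≤-trans (ℕ.≤-reflexive (ℕ.*-distribʳ-+ Y v (Vec.sum u)))
    (ℕ.+-mono-≤ (le zero) (sum-weighted u Y (g ∘ suc) (le ∘ suc)))

  sum-vacant : ∀ {n} (γ : Vec ℕ n) R (g : Fin n → ℕ) → VecAll (ℕ._≤ 1) γ →
    (∀ j → lookup γ j ≡ 0 → R ℕ.≤ g j) → ∀ q → Vec.sum γ ℕ.+ q ≡ n → q ℕ.* R ℕ.≤ sum g
  sum-vacant []      R g []         le q       ≡.refl = z≤n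
  sum-vacant (0 ∷ γ) R g (_ ∷ γ≤1)  le (suc q) eq =
    ℕ.+-mono-≤ (le zero ≡.refl) (sum-vacant γ R (g ∘ suc) γ≤1 (le ∘ suc) q
      (ℕ.suc-injective (≡.trans (≡.sym (ℕ.+-suc (Vec.sum γ) q)) eq)))
  sum-vacant {n} (0 ∷ γ) R g (_ ∷ γ≤1) le zero eq = z≤n
  sum-vacant (1 ∷ γ) R g (s≤s z≤n ∷ γ≤1) le q eq =
    ℕ.≤-trans (sum-vacant γ R (g ∘ suc) γ≤1 (le ∘ suc) q (ℕ.suc-injective eq)) (ℕ.m≤n+m _ (g zero))

  sum-const : ∀ n Y (g : Fin n → ℕ) → (∀ b → Y ℕ.≤ g b) → n ℕ.* Y ℕ.≤ sum g
  sum-const zero    Y g le = z≤n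
  sum-const (suc n) Y g le = ℕ.+-mono-≤ (le zero) (sum-const n Y (g ∘ suc) (le ∘ suc))

  zeros : ∀ {N} → Vec ℕ N → ℕ
  zeros []          = 0
  zeros (zero  ∷ β) = suc (zeros β)
  zeros (suc _ ∷ β) = zeros β

  zeros+sum : ∀ {N} (β : Vec ℕ N) → VecAll (ℕ._≤ 1) β → zeros β ℕ.+ Vec.sum β ≡ N
  zeros+sum []      []                = ≡.refl
  zeros+sum (0 ∷ β) (_ ∷ le)          = ≡.cong suc (zeros+sum β le)
  zeros+sum (1 ∷ β) (s≤s z≤n ∷ le)    = ≡.trans (ℕ.+-suc _ _) (≡.cong suc (zeros+sum β le))

totalDegree : ∀ {m n} → Vec (Vec ℕ n) m → ℕ
totalDegree []      = 0
totalDegree (γ ∷ Γ) = Vec.sum γ ℕ.+ totalDegree Γ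

-- A placement sends the variables x₁, …, x_N to the cells of an m × n₀ matrix of
-- variables, and thereby a monomial in the former to one in the latter.
module Placements (m n₀ : ℕ) where
  open ListSum ℕ.+-*-commutativeSemiring
  open RawSemiringDefs (CommutativeSemiring.rawSemiring ℕ.+-*-commutativeSemiring) using (sum)
  open Covering using (indicator)
  open VectorSums
  open SemiringSum (CommutativeSemiring.semiring ℕ.+-*-commutativeSemiring) using (*-distribˡ-sum)

  Cell : Set
  Cell = Fin m × Fin n₀

  Matrix : Set
  Matrix = Vec (Vec ℕ n₀) m

  raise : Cell → ℕ → Matrix → Matrix
  raise (b , j) a Γ = updateAt Γ b (λ γ → updateAt γ j (a ℕ.+_))

  place : ∀ {N} → Matrix → Vec Cell N → Vec ℕ N → Matrix
  place Γ []      []      = Γ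
  place Γ (c ∷ φ) (a ∷ β) = place (raise c a Γ) φ β

  raise-zero : ∀ c Γ → raise c 0 Γ ≡ Γ
  raise-zero (b , j) Γ = ≡.trans (Vec.updateAt-cong-local b Γ (Vec.updateAt-id j (lookup Γ b))) (Vec.updateAt-id b Γ)

  zeroMatrix : Matrix
  zeroMatrix = Vec.replicate m (Vec.replicate n₀ 0)

  totalDegree-place : ∀ {N} Γ (φ : Vec Cell N) β → totalDegree (place Γ φ β) ≡ totalDegree Γ ℕ.+ Vec.sum β
  totalDegree-place Γ []            []      = ≡.sym (ℕ.+-identityʳ _)
  totalDegree-place Γ ((b , j) ∷ φ) (a ∷ β) = ≡.trans (totalDegree-place _ φ β)
    (≡.trans (≡.cong (ℕ._+ Vec.sum β) (totalDegree-raise Γ b j a)) (rotate a (totalDegree Γ) (Vec.sum β)))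
    where
    rotate : ∀ a b c → a ℕ.+ b ℕ.+ c ≡ b ℕ.+ (a ℕ.+ c)
    rotate = solve-∀
    swap : ∀ a b c → a ℕ.+ (b ℕ.+ c) ≡ b ℕ.+ (a ℕ.+ c)
    swap = solve-∀
    sum-raise : ∀ {n} (γ : Vec ℕ n) j a → Vec.sum (updateAt γ j (a ℕ.+_)) ≡ a ℕ.+ Vec.sum γ
    sum-raise (x ∷ γ) zero    a = ℕ.+-assoc a x _
    sum-raise (x ∷ γ) (suc j) a = ≡.trans (≡.cong (x ℕ.+_) (sum-raise γ j a)) (swap x a _)
    totalDegree-raise : ∀ {m} (Γ : Vec (Vec ℕ n₀) m) b j a →
      totalDegree (updateAt Γ b (λ γ → updateAt γ j (a ℕ.+_))) ≡ a ℕ.+ totalDegree Γ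
    totalDegree-raise (γ ∷ Γ) zero    j a = ≡.trans (≡.cong (ℕ._+ totalDegree Γ) (sum-raise γ j a)) (ℕ.+-assoc a _ _)
    totalDegree-raise (γ ∷ Γ) (suc b) j a =
      ≡.trans (≡.cong (Vec.sum γ ℕ.+_) (totalDegree-raise Γ b j a)) (swap (Vec.sum γ) a _)

  totalDegree-zeroMatrix : totalDegree zeroMatrix ≡ 0
  totalDegree-zeroMatrix = zeroRows m
    where
    zeroRows : ∀ m → totalDegree (Vec.replicate m (Vec.replicate n₀ 0)) ≡ 0
    zeroRows zero    = ≡.refl
    zeroRows (suc m) = ≡.cong₂ ℕ._+_ (≡.trans (sum-replicate n₀ 0) (ℕ.*-zeroʳ n₀)) (zeroRows m)

  place-≤1 : ∀ {N} Γ (φ : Vec Cell N) β → VecAll (VecAll (ℕ._≤ 1)) (place Γ φ β) →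
    VecAll (VecAll (ℕ._≤ 1)) Γ × VecAll (ℕ._≤ 1) β
  place-≤1 Γ []            []      le = le , []
  place-≤1 Γ ((b , j) ∷ φ) (a ∷ β) le =
    let raised≤1 , β≤1 = place-≤1 _ φ β le
        Γ≤1 , a≤1      = updateAt-All Γ b (updateAt-≤1 j) raised≤1
    in Γ≤1 , a≤1 ∷ β≤1
    where
    updateAt-All : ∀ {A : Set} {Q : A → Set} {C : Set} {h : A → A} {n} (xs : Vec A n) i →
      (∀ {x} → Q (h x) → Q x × C) → VecAll Q (updateAt xs i h) → VecAll Q xs × C
    updateAt-All (x ∷ xs) zero    inv (q ∷ qs) = let q′ , c = inv q in q′ ∷ qs , c
    updateAt-All (x ∷ xs) (suc i) inv (q ∷ qs) = let qs′ , c = updateAt-All xs i inv qs in q ∷ qs′ , c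
    updateAt-≤1 : ∀ {n} j {γ : Vec ℕ n} → VecAll (ℕ._≤ 1) (updateAt γ j (a ℕ.+_)) → VecAll (ℕ._≤ 1) γ × a ℕ.≤ 1
    updateAt-≤1 j {γ} = updateAt-All γ j (λ le → ℕ.m+n≤o⇒n≤o a le , ℕ.m+n≤o⇒m≤o a le)

  cells : List Cell
  cells = List.cartesianProduct (List.allFin m) (List.allFin n₀)

  placements : ∀ N → List (Vec Cell N)
  placements zero    = [] ∷ []
  placements (suc N) = List.cartesianProductWith _∷_ cells (placements N)

  length-placements : ∀ N → length (placements N) ≡ (m ℕ.* n₀) ℕ.^ N
  length-placements zero    = ≡.refl
  length-placements (suc N) = ≡.trans (length-cartesianProductWith _∷_ cells (placements N))
    (≡.cong₂ ℕ._*_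
      (≡.trans (length-cartesianProductWith _,_ (List.allFin m) (List.allFin n₀))
        (≡.cong₂ ℕ._*_ (List.length-tabulate {n = m} id) (List.length-tabulate {n = n₀} id)))
      (length-placements N))

  ∑-placements : ∀ N (f : Vec Cell (suc N) → ℕ) →
    ∑ (placements (suc N)) f ≡ sum {m} (λ b → sum {n₀} (λ j → ∑ (placements N) (λ φ → f ((b , j) ∷ φ))))
  ∑-placements N f = begin
    ∑ (placements (suc N)) f                                  ≡⟨ ∑-cartesianProductWith _∷_ cells (placements N) ⟩
    ∑ cells (λ c → ∑ (placements N) (λ φ → f (c ∷ φ)))        ≡⟨ ∑-cartesianProductWith _,_ (List.allFin m) (List.allFin n₀) ⟩
    ∑ (List.allFin m) (λ b → ∑ (List.allFin n₀) (λ j → g b j))  ≡⟨ ∑-cong (List.allFin m) (λ b → ∑-tabulate id (g b)) ⟩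
    ∑ (List.allFin m) (λ b → sum (g b))                       ≡⟨ ∑-tabulate id (λ b → sum (g b)) ⟩
    sum (λ b → sum (g b))                                     ∎
    where
    open ≡.≡-Reasoning
    g : Fin m → Fin n₀ → ℕ
    g b j = ∑ (placements N) (λ φ → f ((b , j) ∷ φ))

  module _ (d₀ k : ℕ) (d₀+k≡n₀ : d₀ ℕ.+ k ≡ n₀) where

    Good : Matrix → Set
    Good = VecAll (Multilinear d₀)

    good? : ∀ Γ → Dec (Good Γ)
    good? = VecAll.all? (multilinear? d₀)

    count : ∀ {N} → Matrix → Vec ℕ N → ℕ
    count {N} Γ β = ∑ (placements N) (λ φ → indicator (good? (place Γ φ β)))

    Row : Vec ℕ n₀ → ℕ → Set
    Row γ v = VecAll (ℕ._≤ 1) γ × Vec.sum γ ℕ.+ v ≡ d₀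

    Rows : Matrix → Vec ℕ m → Set
    Rows Γ u = ∀ b → Row (lookup Γ b) (lookup u b)

    Row-suc : ∀ {γ : Vec ℕ n₀} {v} j → lookup γ j ≡ 0 → Row γ (suc v) → Row (updateAt γ j suc) v
    Row-suc {γ} {v} j vacant (le , eq) = ≤1 γ j vacant le ,
      ≡.trans (≡.cong (ℕ._+ v) (sum-updateAt-suc γ j)) (≡.trans (≡.sym (ℕ.+-suc _ v)) eq)
      where
      ≤1 : ∀ {n} (γ : Vec ℕ n) j → lookup γ j ≡ 0 → VecAll (ℕ._≤ 1) γ → VecAll (ℕ._≤ 1) (updateAt γ j suc)
      ≤1 (0 ∷ γ) zero    _  (_ ∷ le) = s≤s z≤n ∷ le
      ≤1 (x ∷ γ) (suc j) eq (p ∷ le) = p ∷ ≤1 γ j eq le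

    Rows-raise : ∀ {Γ u} b j {v} → lookup u b ≡ suc v → lookup (lookup Γ b) j ≡ 0 → Rows Γ u →
      Rows (raise (b , j) 1 Γ) (updateAt u b ℕ.pred)
    Rows-raise {Γ} {u} b j {v} ub≡ vacant rows b′ with b′ Fin.≟ b
    ... | no b′≢b = ≡.subst₂ Row (≡.sym (Vec.lookup∘updateAt′ b′ b b′≢b Γ)) (≡.sym (Vec.lookup∘updateAt′ b′ b b′≢b u)) (rows b′)
    ... | yes ≡.refl = ≡.subst₂ Row (≡.sym (Vec.lookup∘updateAt b Γ))
          (≡.sym (≡.trans (Vec.lookup∘updateAt b u) (≡.cong ℕ.pred ub≡)))
          (Row-suc j vacant (≡.subst (Row (lookup Γ b)) ub≡ (rows b)))

    rising : ℕ → ℕ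
    rising v = (k ℕ.+ v) P′ v

    rising-suc : ∀ v → rising (suc v) ≡ (k ℕ.+ suc v) ℕ.* rising v
    rising-suc v rewrite ℕ.+-suc k v = nP′k≡n[n∸1P′k∸1] (suc (k ℕ.+ v)) (suc v)

    -- Process the variables of β one by one; a block b that still needs u_b variables
    -- has k + u_b vacant cells.
    count-bound : ∀ {N} (Γ : Matrix) u (β : Vec ℕ N) → Rows Γ u → VecAll (ℕ._≤ 1) β → Vec.sum u ≡ Vec.sum β →
      (m ℕ.* n₀) ℕ.^ zeros β ℕ.* ((Vec.sum β) ! ℕ.* vecProduct rising u) ℕ.≤ vecProduct _! u ℕ.* count Γ β
    count-bound Γ u [] rows [] u≡0 = begin
      1 ℕ.* (1 ℕ.* vecProduct rising u) ≡⟨ ≡.cong (λ z → 1 ℕ.* (1 ℕ.* z)) (vecProduct-zero rising ≡.refl u u≡0) ⟩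
      1                                 ≡⟨ ≡.cong (1 ℕ.*_) count≡1 ⟨
      1 ℕ.* count Γ []                  ≡⟨ ≡.cong (ℕ._* count Γ []) (vecProduct-zero _! ≡.refl u u≡0) ⟨
      vecProduct _! u ℕ.* count Γ []    ∎
      where
      open ℕ.≤-Reasoning
      fromLookup : ∀ {n} {A : Set} {Q : A → Set} (xs : Vec A n) → (∀ i → Q (lookup xs i)) → VecAll Q xs
      fromLookup []       p = []
      fromLookup (x ∷ xs) p = p zero ∷ fromLookup xs (p ∘ suc)
      goodΓ : Good Γ
      goodΓ = fromLookup Γ λ b → proj₁ (rows b) ,
        ≡.trans (≡.sym (ℕ.+-identityʳ _)) (≡.trans (≡.cong (Vec.sum (lookup Γ b) ℕ.+_)
          (≡.sym (ℕ.n≤0⇒n≡0 (≡.subst (lookup u b ℕ.≤_) u≡0 (lookup≤sum u b))))) (proj₂ (rows b)))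
      count≡1 : count Γ [] ≡ 1
      count≡1 with good? Γ
      ... | yes _   = ≡.refl
      ... | no ¬good = contradiction goodΓ ¬good
    count-bound {suc N} Γ u (0 ∷ β) rows (_ ∷ β≤1) u≡β = begin
      m ℕ.* n₀ ℕ.* K ℕ.* W              ≡⟨ assoc m n₀ K W ⟩
      m ℕ.* (n₀ ℕ.* (K ℕ.* W))          ≤⟨ ℕ.*-monoʳ-≤ m (ℕ.*-monoʳ-≤ n₀ (count-bound Γ u β rows β≤1 u≡β)) ⟩
      m ℕ.* (n₀ ℕ.* (F ℕ.* count Γ β))  ≡⟨ swap m n₀ F (count Γ β) ⟩
      F ℕ.* (m ℕ.* (n₀ ℕ.* count Γ β))  ≤⟨ ℕ.*-monoʳ-≤ F (sum-const m _ _ (λ b → sum-const n₀ _ _ (λ j →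
                                             ℕ.≤-reflexive (≡.cong (λ Γ → count Γ β) (≡.sym (raise-zero (b , j) Γ)))))) ⟩
      F ℕ.* sum {m} (λ b → sum {n₀} (λ j → count (raise (b , j) 0 Γ) β))
                                        ≡⟨ ≡.cong (F ℕ.*_) (∑-placements N _) ⟨
      F ℕ.* count Γ (0 ∷ β)             ∎
      where
      open ℕ.≤-Reasoning
      K = (m ℕ.* n₀) ℕ.^ zeros β
      W = Vec.sum β ! ℕ.* vecProduct rising u
      F = vecProduct _! u
      assoc : ∀ m n K W → m ℕ.* n ℕ.* K ℕ.* W ≡ m ℕ.* (n ℕ.* (K ℕ.* W))
      assoc = solve-∀
      swap : ∀ m n F c → m ℕ.* (n ℕ.* (F ℕ.* c)) ≡ F ℕ.* (m ℕ.* (n ℕ.* c))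
      swap = solve-∀
    count-bound {suc N} Γ u (1 ∷ β) rows (s≤s z≤n ∷ β≤1) u≡β = begin
      K ℕ.* (suc t ! ℕ.* w)             ≡⟨ rearrange K (suc t) (t !) w ⟩
      suc t ℕ.* (K ℕ.* (t ! ℕ.* w))     ≡⟨ ≡.cong (ℕ._* (K ℕ.* (t ! ℕ.* w))) u≡β ⟨
      Vec.sum u ℕ.* (K ℕ.* (t ! ℕ.* w)) ≤⟨ sum-weighted u _ (λ b → F ℕ.* blockCount b) block ⟩
      sum (λ b → F ℕ.* blockCount b)    ≡⟨ *-distribˡ-sum F blockCount ⟨
      F ℕ.* sum blockCount              ≡⟨ ≡.cong (F ℕ.*_) (∑-placements N _) ⟨
      F ℕ.* count Γ (1 ∷ β)             ∎
      where
      open ℕ.≤-Reasoning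
      K = (m ℕ.* n₀) ℕ.^ zeros β
      t = Vec.sum β
      w = vecProduct rising u
      F = vecProduct _! u
      rearrange : ∀ K s t w → K ℕ.* (s ℕ.* t ℕ.* w) ≡ s ℕ.* (K ℕ.* (t ℕ.* w))
      rearrange = solve-∀
      blockCount : Fin m → ℕ
      blockCount b = sum {n₀} (λ j → count (raise (b , j) 1 Γ) β)
      block : ∀ b → lookup u b ℕ.* (K ℕ.* (t ! ℕ.* w)) ℕ.≤ F ℕ.* blockCount b
      block b = go (lookup u b) ≡.refl
        where
        go : ∀ v → lookup u b ≡ v → v ℕ.* (K ℕ.* (t ! ℕ.* w)) ℕ.≤ F ℕ.* blockCount b
        go zero    _   = z≤n
        go (suc v) ub≡ = begin
          suc v ℕ.* (K ℕ.* (t ! ℕ.* w))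
            ≡⟨ ≡.cong (λ z → suc v ℕ.* (K ℕ.* (t ! ℕ.* z))) (vecProduct-updateAt rising ℕ.pred (k ℕ.+ suc v) u b
                 (≡.subst (λ z → rising z ≡ (k ℕ.+ suc v) ℕ.* rising (ℕ.pred z)) (≡.sym ub≡) (rising-suc v))) ⟩
          suc v ℕ.* (K ℕ.* (t ! ℕ.* ((k ℕ.+ suc v) ℕ.* vecProduct rising u′)))
            ≡⟨ shuffle (suc v) K (t !) (k ℕ.+ suc v) (vecProduct rising u′) ⟩
          suc v ℕ.* ((k ℕ.+ suc v) ℕ.* (K ℕ.* (t ! ℕ.* vecProduct rising u′)))
            ≤⟨ ℕ.*-monoʳ-≤ (suc v) (sum-vacant (lookup Γ b) _ (λ j → F′ ℕ.* count (raise (b , j) 1 Γ) β) (proj₁ (rows b))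
                 (λ j vacant → count-bound (raise (b , j) 1 Γ) u′ β (Rows-raise {Γ} {u} b j ub≡ vacant rows) β≤1
                   (ℕ.suc-injective (≡.trans (≡.sym (sum-updateAt-pred u b ub≡)) u≡β)))
                 (k ℕ.+ suc v) vacancies) ⟩
          suc v ℕ.* sum {n₀} (λ j → F′ ℕ.* count (raise (b , j) 1 Γ) β)
            ≡⟨ ≡.cong (suc v ℕ.*_) (*-distribˡ-sum F′ (λ j → count (raise (b , j) 1 Γ) β)) ⟨
          suc v ℕ.* (F′ ℕ.* blockCount b)
            ≡⟨ ℕ.*-assoc (suc v) F′ _ ⟨
          suc v ℕ.* F′ ℕ.* blockCount b
            ≡⟨ ≡.cong (ℕ._* blockCount b) (vecProduct-updateAt _! ℕ.pred (suc v) u b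
                 (≡.subst (λ z → z ! ≡ suc v ℕ.* (ℕ.pred z) !) (≡.sym ub≡) ≡.refl)) ⟨
          F ℕ.* blockCount b ∎
          where
          u′ = updateAt u b ℕ.pred
          F′ = vecProduct _! u′
          shuffle : ∀ s K t c w → s ℕ.* (K ℕ.* (t ℕ.* (c ℕ.* w))) ≡ s ℕ.* (c ℕ.* (K ℕ.* (t ℕ.* w)))
          shuffle = solve-∀
          vacancies : Vec.sum (lookup Γ b) ℕ.+ (k ℕ.+ suc v) ≡ n₀
          vacancies = ≡.trans (move (Vec.sum (lookup Γ b)) k (suc v))
            (≡.trans (≡.cong (ℕ._+ k) (≡.trans (≡.cong (Vec.sum (lookup Γ b) ℕ.+_) (≡.sym ub≡)) (proj₂ (rows b)))) d₀+k≡n₀)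
            where
            move : ∀ s k v → s ℕ.+ (k ℕ.+ v) ≡ s ℕ.+ v ℕ.+ k
            move = solve-∀

    Rows-zero : Rows zeroMatrix (Vec.replicate m d₀)
    Rows-zero b = ≡.subst₂ Row (≡.sym (Vec.lookup-replicate b (Vec.replicate n₀ 0))) (≡.sym (Vec.lookup-replicate b d₀))
      (replicate-≤1 n₀ z≤n , ≡.cong (ℕ._+ d₀) (≡.trans (sum-replicate n₀ 0) (ℕ.*-zeroʳ n₀)))

    favourable total : ℕ
    favourable = (m ℕ.* d₀) ! ℕ.* (n₀ P′ d₀) ℕ.^ m
    total      = (d₀ !) ℕ.^ m ℕ.* (m ℕ.* n₀) ℕ.^ (m ℕ.* d₀)

    count-good : ∀ {N} (β : Vec ℕ N) → Multilinear (m ℕ.* d₀) β →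
      length (placements N) ℕ.* favourable ℕ.≤ total ℕ.* count zeroMatrix β
    count-good {N} β (β≤1 , sumβ) = begin
      length (placements N) ℕ.* favourable
        ≡⟨ ≡.cong (ℕ._* favourable) (≡.trans (length-placements N) (≡.trans
             (≡.cong (K ℕ.^_) (≡.sym (zeros+sum β β≤1))) (ℕ.^-distribˡ-+-* K (zeros β) (Vec.sum β)))) ⟩
      K ℕ.^ zeros β ℕ.* K ℕ.^ Vec.sum β ℕ.* favourable
        ≡⟨ ≡.cong (λ e → K ℕ.^ zeros β ℕ.* K ℕ.^ e ℕ.* favourable) sumβ ⟩
      K ℕ.^ zeros β ℕ.* K ℕ.^ e ℕ.* (e ! ℕ.* (n₀ P′ d₀) ℕ.^ m)
        ≡⟨ shuffle (K ℕ.^ zeros β) (K ℕ.^ e) _ ⟩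
      K ℕ.^ e ℕ.* (K ℕ.^ zeros β ℕ.* (e ! ℕ.* (n₀ P′ d₀) ℕ.^ m))
        ≡⟨ ≡.cong₂ (λ a b → K ℕ.^ e ℕ.* (K ℕ.^ zeros β ℕ.* (a ℕ.* b)))
             (≡.cong _! (≡.sym sumβ))
             (≡.trans (≡.cong (λ z → (z P′ d₀) ℕ.^ m) (≡.trans (≡.sym d₀+k≡n₀) (ℕ.+-comm d₀ k)))
                      (≡.sym (vecProduct-replicate m rising d₀))) ⟩
      K ℕ.^ e ℕ.* (K ℕ.^ zeros β ℕ.* (Vec.sum β ! ℕ.* vecProduct rising u))
        ≤⟨ ℕ.*-monoʳ-≤ (K ℕ.^ e) (count-bound zeroMatrix u β Rows-zero β≤1 (≡.trans (sum-replicate m d₀) (≡.sym sumβ))) ⟩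
      K ℕ.^ e ℕ.* (vecProduct _! u ℕ.* count zeroMatrix β)
        ≡⟨ ≡.cong (λ z → K ℕ.^ e ℕ.* (z ℕ.* count zeroMatrix β)) (vecProduct-replicate m _! d₀) ⟩
      K ℕ.^ e ℕ.* ((d₀ !) ℕ.^ m ℕ.* count zeroMatrix β)
        ≡⟨ shuffle′ (K ℕ.^ e) ((d₀ !) ℕ.^ m) _ ⟩
      total ℕ.* count zeroMatrix β ∎
      where
      open ℕ.≤-Reasoning
      K = m ℕ.* n₀
      e = m ℕ.* d₀
      u = Vec.replicate m d₀
      shuffle : ∀ a b c → a ℕ.* b ℕ.* c ≡ b ℕ.* (a ℕ.* c)
      shuffle = solve-∀
      shuffle′ : ∀ a b c → a ℕ.* (b ℕ.* c) ≡ b ℕ.* a ℕ.* c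
      shuffle′ = solve-∀

module ProductFamilies (R : CommutativeRing 0ℓ 0ℓ) where
  open CommutativeRing R hiding (zero)
  open RawSemiringDefs (RawRing.rawSemiring rawRing) using (_^_)
  open Exp commutativeSemiring using (^-homo-*; ^-distrib-*)
  open PowersOfLinearForms R using (mon)
  open ListSum commutativeSemiring
  open IntegerCoefficients R
  open SetoidReasoning setoid

  mon-scale : ∀ {n} c (L : Vec Carrier n) α → mon (Vec.map (c *_) L) α ≈ c ^ Vec.sum α * mon L α
  mon-scale c []      []      = sym (*-identityˡ 1#)
  mon-scale c (x ∷ L) (a ∷ α) = begin
    (c * x) ^ a * mon (Vec.map (c *_) L) α              ≈⟨ *-cong (^-distrib-* c x a) (mon-scale c L α) ⟩
    (c ^ a * x ^ a) * (c ^ Vec.sum α * mon L α)         ≈⟨ solve 4 (λ p q r s → (p :* q) :* (r :* s) := (p :* r) :* (q :* s)) refl _ _ _ _ ⟩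
    (c ^ a * c ^ Vec.sum α) * (x ^ a * mon L α)         ≈⟨ *-congʳ (^-homo-* c a (Vec.sum α)) ⟨
    c ^ (a ℕ.+ Vec.sum α) * (x ^ a * mon L α)           ∎

  mon-++ : ∀ {m n} (L : Vec Carrier m) (L′ : Vec Carrier n) α α′ →
    mon (L Vec.++ L′) (α Vec.++ α′) ≈ mon L α * mon L′ α′
  mon-++ []      L′ []      α′ = sym (*-identityˡ _)
  mon-++ (x ∷ L) L′ (a ∷ α) α′ = trans (*-congˡ (mon-++ L L′ α α′)) (sym (*-assoc _ _ _))

  mon-zero : ∀ {n} (L : Vec Carrier n) → mon L (Vec.replicate n 0) ≈ 1#
  mon-zero []      = refl
  mon-zero (x ∷ L) = trans (*-identityˡ _) (mon-zero L)

  mon-raise : ∀ {n} (L : Vec Carrier n) α j a → mon L (updateAt α j (a ℕ.+_)) ≈ lookup L j ^ a * mon L α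
  mon-raise (x ∷ L) (b ∷ α) zero    a = trans (*-congʳ (^-homo-* x a b)) (*-assoc _ _ _)
  mon-raise (x ∷ L) (b ∷ α) (suc j) a = trans (*-congˡ (mon-raise L α j a))
    (solve 3 (λ p q r → p :* (q :* r) := q :* (p :* r)) refl _ _ _)

  module _ {n₀ : ℕ} where
    matrixMon : ∀ {m} → Vec (Vec Carrier n₀) m → Vec (Vec ℕ n₀) m → Carrier
    matrixMon []      []      = 1#
    matrixMon (ξ ∷ Ξ) (γ ∷ Γ) = mon ξ γ * matrixMon Ξ Γ

    entry : ∀ {m} → Vec (Vec Carrier n₀) m → Fin m × Fin n₀ → Carrier
    entry Ξ (b , j) = lookup (lookup Ξ b) j

    matrixMon-zero : ∀ {m} (Ξ : Vec (Vec Carrier n₀) m) → matrixMon Ξ (Vec.replicate m (Vec.replicate n₀ 0)) ≈ 1#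
    matrixMon-zero []      = refl
    matrixMon-zero (ξ ∷ Ξ) = trans (*-cong (mon-zero ξ) (matrixMon-zero Ξ)) (*-identityˡ 1#)

    matrixMon-raise : ∀ {m} (Ξ : Vec (Vec Carrier n₀) m) Γ c a →
      matrixMon Ξ (Placements.raise m n₀ c a Γ) ≈ entry Ξ c ^ a * matrixMon Ξ Γ
    matrixMon-raise (ξ ∷ Ξ) (γ ∷ Γ) (zero  , j) a = trans (*-congʳ (mon-raise ξ γ j a)) (*-assoc _ _ _)
    matrixMon-raise (ξ ∷ Ξ) (γ ∷ Γ) (suc b , j) a = trans (*-congˡ (matrixMon-raise Ξ Γ (b , j) a))
      (solve 3 (λ p q r → p :* (q :* r) := q :* (p :* r)) refl _ _ _)

    matrixMon-place : ∀ {m N} (Ξ : Vec (Vec Carrier n₀) m) Γ (φ : Vec (Fin m × Fin n₀) N) β →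
      matrixMon Ξ (Placements.place m n₀ Γ φ β) ≈ mon (Vec.map (entry Ξ) φ) β * matrixMon Ξ Γ
    matrixMon-place Ξ Γ []      []      = sym (*-identityˡ _)
    matrixMon-place Ξ Γ (c ∷ φ) (a ∷ β) = begin
      matrixMon Ξ (Placements.place _ n₀ (Placements.raise _ n₀ c a Γ) φ β)           ≈⟨ matrixMon-place Ξ _ φ β ⟩
      mon (Vec.map (entry Ξ) φ) β * matrixMon Ξ (Placements.raise _ n₀ c a Γ)         ≈⟨ *-congˡ (matrixMon-raise Ξ Γ c a) ⟩
      mon (Vec.map (entry Ξ) φ) β * (entry Ξ c ^ a * matrixMon Ξ Γ)                   ≈⟨ solve 3 (λ p q r → p :* (q :* r) := (q :* p) :* r) refl _ _ _ ⟩
      entry Ξ c ^ a * mon (Vec.map (entry Ξ) φ) β * matrixMon Ξ Γ                     ∎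

    module _ (X : List (Carrier × Vec Carrier n₀)) where
      moment : Vec ℕ n₀ → Carrier
      moment γ = ∑ X (λ (w , ξ) → w * mon ξ γ)

      matrixMoment : ∀ {m} → Vec (Vec ℕ n₀) m → Carrier
      matrixMoment []      = 1#
      matrixMoment (γ ∷ Γ) = moment γ * matrixMoment Γ

      productFamily : ∀ m → List (Carrier × Vec (Vec Carrier n₀) m)
      productFamily zero    = (1# , []) ∷ []
      productFamily (suc m) = List.cartesianProductWith (λ (w , ξ) (v , Ξ) → w * v , ξ ∷ Ξ) X (productFamily m)

      length-productFamily : ∀ m → length (productFamily m) ≡ length X ℕ.^ m
      length-productFamily zero    = ≡.refl
      length-productFamily (suc m) =
        ≡.trans (length-cartesianProductWith _ X (productFamily m)) (≡.cong (length X ℕ.*_) (length-productFamily m))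

      ∑-productFamily : ∀ {m} (Γ : Vec (Vec ℕ n₀) m) →
        ∑ (productFamily m) (λ (v , Ξ) → v * matrixMon Ξ Γ) ≈ matrixMoment Γ
      ∑-productFamily []                = trans (+-identityʳ _) (*-identityˡ 1#)
      ∑-productFamily {suc m} (γ ∷ Γ) = begin
        ∑ (productFamily (suc m)) (λ (v , Ξ) → v * matrixMon Ξ (γ ∷ Γ))
          ≈⟨ ∑-cartesianProductWith _ X (productFamily m) ⟩
        ∑ X (λ (w , ξ) → ∑ (productFamily m) (λ (v , Ξ) → (w * v) * (mon ξ γ * matrixMon Ξ Γ)))
          ≈⟨ ∑-cong X (λ (w , ξ) → trans
               (∑-cong (productFamily m) (λ (v , Ξ) → solve 4 (λ p q r s → (p :* q) :* (r :* s) := (p :* r) :* (q :* s)) refl _ _ _ _))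
               (sym (*-distribˡ-∑ (w * mon ξ γ) (productFamily m)))) ⟩
        ∑ X (λ (w , ξ) → (w * mon ξ γ) * ∑ (productFamily m) (λ (v , Ξ) → v * matrixMon Ξ Γ))
          ≈⟨ *-distribʳ-∑ _ X ⟨
        moment γ * ∑ (productFamily m) (λ (v , Ξ) → v * matrixMon Ξ Γ)
          ≈⟨ *-congˡ (∑-productFamily Γ) ⟩
        moment γ * matrixMoment Γ ∎

module LagrangeWeights (ℝ : CompleteOrderedField) where
  open OrderedField ℝ
  open ListSum commutativeSemiring

  ∑-cong-All : {A : Set} {Q : A → Set} (xs : List A) {f g : A → Carrier} → All Q xs →
    (∀ x → Q x → f x ≈ g x) → ∑ xs f ≈ ∑ xs g
  ∑-cong-All []       []       f≈g = ≈-refl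
  ∑-cong-All (x ∷ xs) (q ∷ qs) f≈g = +-cong (f≈g x q) (∑-cong-All xs qs f≈g)

  powerMoment : List (Carrier × Carrier) → ℕ → Carrier
  powerMoment ws k = ∑ ws (λ (w , x) → w * x ^ k)

  -- Adding a node x₀, the weights w become w / (x - x₀), and the weight of x₀ makes the
  -- sum of all weights 0; then m′ₖ₊₁ = x₀ m′ₖ + mₖ for the new moments m′ and the old m.
  lagrange : ∀ D → ∃ λ ws → length ws ≡ suc D × All (λ (w , x) → x < nat (suc D)) ws ×
    (∀ k → k ℕ.< D → powerMoment ws k ≈ 0#) × powerMoment ws D ≈ 1#
  lagrange zero = (1# , 0#) ∷ [] , ≡.refl , 0<nat {1} (s≤s z≤n) ∷ [] , (λ k ()) ,
    ≈-trans (+-identityʳ _) (*-identityˡ 1#)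
  lagrange (suc D) with lagrange D
  ... | ws , len , x<x₀ , small , top = (- W , x₀) ∷ ws′ , ≡.cong suc (≡.trans (List.length-map _ ws) len) ,
      x₀<x₁ ∷ All.map⁺ (All.map (λ x<x₀ → <-≤-trans x<x₀ (proj₁ x₀<x₁)) x<x₀) , small′ ,
      ≈-trans (recursion D) (≈-trans (+-cong (≈-trans (*-congˡ (small′ D ℕ.≤-refl)) (zeroʳ x₀)) top) (+-identityˡ 1#))
    where
    x₀ = nat (suc D)
    x₀<x₁ : x₀ < nat (suc (suc D))
    x₀<x₁ = nat-mono-< {suc D} ℕ.≤-refl
    weight : Carrier × Carrier → Carrier × Carrier
    weight (w , x) = w * (x - x₀) ⁻¹ , x
    ws′ = List.map weight ws
    W = ∑ ws (λ p → proj₁ (weight p))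
    new : ℕ → Carrier
    new = powerMoment ((- W , x₀) ∷ ws′)
    x-x₀≉0 : ∀ {x} → x < x₀ → ¬ (x - x₀ ≈ 0#)
    x-x₀≉0 {x} (_ , x≉x₀) eq = x≉x₀ (≈-trans (solve 2 (λ x y → x := (x :- y) :+ y) ≈-refl x x₀)
      (≈-trans (+-congʳ eq) (+-identityˡ x₀)))
    zeroth : new 0 ≈ 0#
    zeroth = ≈-trans (+-cong (*-identityʳ _)
      (≈-trans (∑-map weight ws) (∑-cong ws (λ _ → *-identityʳ _)))) (-‿inverseˡ W)
    recursion : ∀ k → new (suc k) ≈ x₀ * new k + powerMoment ws k
    recursion k = begin
      - W * (x₀ * x₀ ^ k) + powerMoment ws′ (suc k)
        ≈⟨ +-congˡ (≈-trans (∑-map weight ws) (∑-cong-All ws x<x₀ (λ (w , x) x<x₀ → termwise w x (x-x₀≉0 x<x₀)))) ⟩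
      - W * (x₀ * x₀ ^ k) + ∑ ws (λ (w , x) → x₀ * (w * (x - x₀) ⁻¹ * x ^ k) + w * x ^ k)
        ≈⟨ +-congˡ (≈-trans (∑-distrib-+ ws) (+-congʳ (≈-trans (≈-sym (*-distribˡ-∑ x₀ ws)) (*-congˡ (≈-sym (∑-map weight ws)))))) ⟩
      - W * (x₀ * x₀ ^ k) + (x₀ * powerMoment ws′ k + powerMoment ws k)
        ≈⟨ solve 5 (λ v x y a b → v :* (x :* y) :+ (x :* a :+ b) := x :* (v :* y :+ a) :+ b) ≈-refl (- W) x₀ (x₀ ^ k) _ _ ⟩
      x₀ * new k + powerMoment ws k ∎
      where
      open ≈-Reasoning
      termwise : ∀ w x → ¬ (x - x₀ ≈ 0#) →
        w * (x - x₀) ⁻¹ * (x * x ^ k) ≈ x₀ * (w * (x - x₀) ⁻¹ * x ^ k) + w * x ^ k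
      termwise w x x≉x₀ = begin
        w * i * (x * x ^ k)                                   ≈⟨ solve 5 (λ w i x y z → w :* i :* (x :* y) := z :* (w :* i :* y) :+ (w :* ((x :- z) :* i)) :* y) ≈-refl w i x (x ^ k) x₀ ⟩
        x₀ * (w * i * x ^ k) + (w * ((x - x₀) * i)) * x ^ k   ≈⟨ +-congˡ (*-congʳ (≈-trans (*-congˡ (⁻¹-inverseʳ x≉x₀)) (*-identityʳ w))) ⟩
        x₀ * (w * i * x ^ k) + w * x ^ k                      ∎
        where i = (x - x₀) ⁻¹
    small′ : ∀ k → k ℕ.< suc D → new k ≈ 0#
    small′ zero    _         = zeroth
    small′ (suc k) (s≤s k<D) = ≈-trans (recursion k)
      (≈-trans (+-cong (≈-trans (*-congˡ (small′ k (ℕ.m≤n⇒m≤1+n k<D))) (zeroʳ x₀)) (small k k<D)) (+-identityˡ 0#))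

module WaringFamily (ℝ : CompleteOrderedField) (em : ExcludedMiddle 0ℓ) where
  open OrderedField ℝ
  open Complex ℝ
  open PowersOfLinearForms ℂ-commutativeRing
  open ProductFamilies ℂ-commutativeRing
  open ListSum ℂR.commutativeSemiring
  private
    module ℂ = RawRing (ℂ ℝ)
    module ℝ∑ = ListSum commutativeSemiring

  ∑-real : {A : Set} (xs : List A) (f : A → Carrier) → ∑ xs (real ∘ f) ℂ.≈ real (ℝ∑.∑ xs f)
  ∑-real []       f = ℂR.refl
  ∑-real (x ∷ xs) f = ℂR.trans (ℂR.+-congˡ {real (f x)} (∑-real xs f)) (ℂR.sym (real-+ (f x) (ℝ∑.∑ xs f)))

  Positive : ℂ.Carrier → Set
  Positive z = ∃ λ x → 0# < x × z ℂ.≈ real x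

  Positive-≈ : ∀ {z w} → z ℂ.≈ w → Positive w → Positive z
  Positive-≈ z≈w (x , 0<x , w≈x) = x , 0<x , ℂR.trans z≈w w≈x

  Positive-* : ∀ {z w} → Positive z → Positive w → Positive (z ℂ.* w)
  Positive-* (x , 0<x , z≈x) (y , 0<y , w≈y) =
    x * y , 0<* 0<x 0<y , ℂR.trans (ℂR.*-cong z≈x w≈y) (ℂR.sym (real-* x y))

  Positive-+ : ∀ {z w} → Positive z → Positive w → Positive (z ℂ.+ w)
  Positive-+ (x , 0<x , z≈x) (y , 0<y , w≈y) =
    x + y , 0<+ 0<x (proj₁ 0<y) , ℂR.trans (ℂR.+-cong z≈x w≈y) (ℂR.sym (real-+ x y))

  Σₚ-powers : ∀ {n r} (p : Fin r → ℂ[x].Coeffs ℝ n) (L : Fin r → Vec ℂ.Carrier n) → (∀ i → IsLinear (p i) (L i)) →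
    ∀ d α → Σₚ (λ i → p i ^ₚ d) α ℂ.≈ ∑ (List.tabulate L) (λ ξ → multinomial d α ·ᶜ mon ξ α)
  Σₚ-powers {r = zero}  p L lin d α = ℂR.refl
  Σₚ-powers {r = suc r} p L lin d α =
    ℂR.+-cong (power-coefficient (L zero) (lin zero) d α) (Σₚ-powers (p ∘ suc) (L ∘ suc) (lin ∘ suc) d α)

  ∑-· : {A : Set} (xs : List A) (n : ℕ) {f : A → ℂ.Carrier} → ∑ xs (λ x → n ·ᶜ f x) ℂ.≈ n ·ᶜ ∑ xs f
  ∑-· []       n = ℂR.sym (·ᶜ-zero n)
    where
    ·ᶜ-zero : ∀ n → n ·ᶜ ℂ.0# ℂ.≈ ℂ.0#
    ·ᶜ-zero zero    = ℂR.refl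
    ·ᶜ-zero (suc n) = ℂR.trans (ℂR.+-identityˡ (n ·ᶜ ℂ.0#)) (·ᶜ-zero n)
  ∑-· (x ∷ xs) n {f} = ℂR.trans (ℂR.+-congˡ {n ·ᶜ f x} (∑-· xs n))
    (ℂR.sym (×-distrib-+ (f x) _ n))
    where open import Algebra.Properties.CommutativeMonoid.Mult ℂR.+-commutativeMonoid using (×-distrib-+)

  module _ {n₀ d₀ r : ℕ} (f : ℝ[x].Form ℝ n₀ d₀) (f∈𝔈⁺ : 𝔈⁺ ℝ n₀ d₀ f)
           (decomposition : ℂ[x].IsSumOfPowers ℝ (complexify ℝ f) r) where
    private
      p : Fin r → ℂ[x].Form ℝ n₀ 1
      p = proj₁ decomposition

      coefficients : ∀ i → ∃ (IsLinear (ℂ[x].coeff {ℝ} (p i)))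
      coefficients i = linear-coefficients (ℂ[x].coeff {ℝ} (p i)) (ℂ[x].homogeneous {ℝ} (p i))

      Ls : List (Vec ℂ.Carrier n₀)
      Ls = List.tabulate (proj₁ ∘ coefficients)

      powerSum : Vec ℕ n₀ → ℂ.Carrier
      powerSum γ = ∑ Ls (λ L → mon L γ)

      f≈powerSum : ∀ γ → real (ℝ[x].coeff {ℝ} f γ) ℂ.≈ multinomial d₀ γ ·ᶜ powerSum γ
      f≈powerSum γ = ℂR.trans (proj₂ decomposition γ)
        (ℂR.trans (Σₚ-powers (ℂ[x].coeff {ℝ} ∘ p) (proj₁ ∘ coefficients) (proj₂ ∘ coefficients) d₀ γ)
          (∑-· Ls (multinomial d₀ γ)))

      module _ (γ : Vec ℕ n₀) (|γ|≡d₀ : Vec.sum γ ≡ d₀) where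
        c = nat (multinomial d₀ γ)
        0<c : 0# < c
        0<c = 0<nat {multinomial d₀ γ} (multinomial-pos d₀ γ |γ|≡d₀)

        scaled : real (ℝ[x].coeff {ℝ} f γ) ℂ.≈ (c * proj₁ (powerSum γ) , c * proj₂ (powerSum γ))
        scaled = ℂR.trans (f≈powerSum γ) (·ᶜ-components (multinomial d₀ γ) (powerSum γ))

        powerSum-zero : ¬ Multilinear d₀ γ → powerSum γ ℂ.≈ ℂ.0#
        powerSum-zero ¬ml with em {ℝ[x].coeff {ℝ} f γ ≈ 0#}
        ... | no  fγ≉0 = contradiction (Equivalence.to (proj₂ f∈𝔈⁺ γ) fγ≉0) ¬ml
        ... | yes fγ≈0 = x*y≈0⇒y≈0 (>⇒≉0 0<c) (≈-trans (≈-sym (proj₁ scaled)) fγ≈0)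
                       , x*y≈0⇒y≈0 (>⇒≉0 0<c) (≈-sym (proj₂ scaled))

        powerSum-positive : Multilinear d₀ γ → Positive (powerSum γ)
        powerSum-positive ml = proj₁ (powerSum γ) , positive , ≈-refl , x*y≈0⇒y≈0 (>⇒≉0 0<c) (≈-sym (proj₂ scaled))
          where
          fγ≉0 = Equivalence.from (proj₂ f∈𝔈⁺ γ) ml
          positive : 0# < proj₁ (powerSum γ)
          positive = *-cancelˡ-≤ c 0<c (≤-respˡ (≈-sym (zeroʳ c)) (≤-respʳ (proj₁ scaled) (proj₁ f∈𝔈⁺ γ)))
                   , λ 0≈ → fγ≉0 (≈-trans (proj₁ scaled) (≈-trans (*-congˡ (≈-sym 0≈)) (zeroʳ c)))

      lagrange = LagrangeWeights.lagrange ℝ d₀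
      ws = proj₁ lagrange
      weights-small = proj₁ (proj₂ (proj₂ (proj₂ lagrange)))
      weights-top   = proj₂ (proj₂ (proj₂ (proj₂ lagrange)))

    family : List (ℂ.Carrier × Vec ℂ.Carrier n₀)
    family = List.cartesianProductWith (λ (w , x) L → real w , Vec.map (real x ℂ.*_) L) ws Ls

    length-family : length family ≡ (d₀ ℕ.+ 1) ℕ.* r
    length-family = ≡.trans (length-cartesianProductWith _ ws Ls)
      (≡.cong₂ ℕ._*_ (≡.trans (proj₁ (proj₂ lagrange)) (ℕ.+-comm 1 d₀)) (List.length-tabulate (proj₁ ∘ coefficients)))

    moment-family : ∀ γ → moment family γ ℂ.≈ real (LagrangeWeights.powerMoment ℝ ws (Vec.sum γ)) ℂ.* powerSum γ
    moment-family γ = begin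
      moment family γ
        ≈⟨ ∑-cartesianProductWith _ ws Ls ⟩
      ∑ ws (λ (w , x) → ∑ Ls (λ L → real w ℂ.* mon (Vec.map (real x ℂ.*_) L) γ))
        ≈⟨ ∑-cong ws (λ (w , x) → ℂR.trans (∑-cong Ls (λ L → termwise w x L))
             (ℂR.sym (*-distribˡ-∑ (real (w * x ^ Vec.sum γ)) Ls))) ⟩
      ∑ ws (λ (w , x) → real (w * x ^ Vec.sum γ) ℂ.* powerSum γ)
        ≈⟨ *-distribʳ-∑ (powerSum γ) ws ⟨
      ∑ ws (λ (w , x) → real (w * x ^ Vec.sum γ)) ℂ.* powerSum γ
        ≈⟨ ℂR.*-congʳ {powerSum γ} (∑-real ws (λ (w , x) → w * x ^ Vec.sum γ)) ⟩
      real (LagrangeWeights.powerMoment ℝ ws (Vec.sum γ)) ℂ.* powerSum γ ∎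
      where
      open SetoidReasoning ℂR.setoid
      termwise : ∀ w x L → real w ℂ.* mon (Vec.map (real x ℂ.*_) L) γ ℂ.≈ real (w * x ^ Vec.sum γ) ℂ.* mon L γ
      termwise w x L = begin
        real w ℂ.* mon (Vec.map (real x ℂ.*_) L) γ         ≈⟨ ℂR.*-congˡ {real w} (mon-scale (real x) L γ) ⟩
        real w ℂ.* (real x ^ᶜ Vec.sum γ ℂ.* mon L γ)       ≈⟨ ℂR.*-assoc (real w) (real x ^ᶜ Vec.sum γ) (mon L γ) ⟨
        (real w ℂ.* real x ^ᶜ Vec.sum γ) ℂ.* mon L γ       ≈⟨ ℂR.*-congʳ {mon L γ} (ℂR.*-congˡ {real w} (real-^ x (Vec.sum γ))) ⟨
        (real w ℂ.* real (x ^ Vec.sum γ)) ℂ.* mon L γ      ≈⟨ ℂR.*-congʳ {mon L γ} (real-* w (x ^ Vec.sum γ)) ⟨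
        real (w * x ^ Vec.sum γ) ℂ.* mon L γ               ∎

    moment-small : ∀ γ → Vec.sum γ ℕ.< d₀ → moment family γ ℂ.≈ ℂ.0#
    moment-small γ |γ|<d₀ = ℂR.trans (moment-family γ)
      (ℂR.trans (ℂR.*-congʳ {powerSum γ} (real-cong (weights-small (Vec.sum γ) |γ|<d₀))) (ℂR.zeroˡ (powerSum γ)))

    moment-top : ∀ γ → Vec.sum γ ≡ d₀ → moment family γ ℂ.≈ powerSum γ
    moment-top γ ≡.refl = ℂR.trans (moment-family γ)
      (ℂR.trans (ℂR.*-congʳ {powerSum γ} (real-cong weights-top)) (ℂR.*-identityˡ (powerSum γ)))

    moment-zero : ∀ γ → Vec.sum γ ≡ d₀ → ¬ Multilinear d₀ γ → moment family γ ℂ.≈ ℂ.0#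
    moment-zero γ |γ|≡d₀ ¬ml = ℂR.trans (moment-top γ |γ|≡d₀) (powerSum-zero γ |γ|≡d₀ ¬ml)

    moment-positive : ∀ γ → Multilinear d₀ γ → Positive (moment family γ)
    moment-positive γ ml = Positive-≈ (moment-top γ (proj₂ ml)) (powerSum-positive γ (proj₂ ml) ml)

    totalDegree-good : ∀ {m} {Γ : Vec (Vec ℕ n₀) m} → VecAll (Multilinear d₀) Γ → totalDegree Γ ≡ m ℕ.* d₀
    totalDegree-good []               = ≡.refl
    totalDegree-good ((_ , eq) ∷ mls) = ≡.cong₂ ℕ._+_ eq (totalDegree-good mls)

    matrixMoment-positive : ∀ {m} {Γ : Vec (Vec ℕ n₀) m} → VecAll (Multilinear d₀) Γ → Positive (matrixMoment family Γ)
    matrixMoment-positive []         = 1# , 0<1 , ℂR.refl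
    matrixMoment-positive (ml ∷ mls) = Positive-* (moment-positive _ ml) (matrixMoment-positive mls)

    matrixMoment-zero : ∀ {m} (Γ : Vec (Vec ℕ n₀) m) → totalDegree Γ ℕ.≤ m ℕ.* d₀ →
      ¬ VecAll (Multilinear d₀) Γ → matrixMoment family Γ ℂ.≈ ℂ.0#
    matrixMoment-zero []            _  ¬good = contradiction [] ¬good
    matrixMoment-zero {suc m} (γ ∷ Γ) le ¬good = go (ℕ.<-cmp (Vec.sum γ) d₀)
      where
      head≈0 : moment family γ ℂ.≈ ℂ.0# → matrixMoment family (γ ∷ Γ) ℂ.≈ ℂ.0#
      head≈0 eq = ℂR.trans (ℂR.*-congʳ {matrixMoment family Γ} eq) (ℂR.zeroˡ (matrixMoment family Γ))
      tail≈0 : matrixMoment family Γ ℂ.≈ ℂ.0# → matrixMoment family (γ ∷ Γ) ℂ.≈ ℂ.0#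
      tail≈0 eq = ℂR.trans (ℂR.*-congˡ {moment family γ} eq) (ℂR.zeroʳ (moment family γ))
      go : Tri (Vec.sum γ ℕ.< d₀) (Vec.sum γ ≡ d₀) (d₀ ℕ.< Vec.sum γ) → matrixMoment family (γ ∷ Γ) ℂ.≈ ℂ.0#
      go (tri< lt _ _) = head≈0 (moment-small γ lt)
      go (tri≈ _ eq _) with multilinear? d₀ γ
      ... | no  ¬ml = head≈0 (moment-zero γ eq ¬ml)
      ... | yes ml  = tail≈0 (matrixMoment-zero Γ
              (ℕ.+-cancelˡ-≤ d₀ _ _ (≡.subst (λ z → z ℕ.+ totalDegree Γ ℕ.≤ suc m ℕ.* d₀) eq le))
              (λ good → ¬good (ml ∷ good)))
      go (tri> _ _ gt) = tail≈0 (matrixMoment-zero Γ (ℕ.<⇒≤ lt)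
              (λ good → ℕ.<⇒≢ lt (totalDegree-good good)))
        where
        lt : totalDegree Γ ℕ.< m ℕ.* d₀
        lt = ℕ.+-cancelˡ-< d₀ _ _ (ℕ.<-≤-trans (ℕ.+-monoˡ-< (totalDegree Γ) gt) le)

    module _ (m : ℕ) where
      open Placements m n₀ using (Cell; place; zeroMatrix; totalDegree-place; totalDegree-zeroMatrix; place-≤1)

      module _ {N : ℕ} (β : Vec ℕ N) (|β| : Vec.sum β ≡ m ℕ.* d₀) where
        placed : Vec Cell N → ℂ.Carrier
        placed φ = matrixMoment family (place zeroMatrix φ β)

        private
          degree : ∀ φ → totalDegree (place zeroMatrix φ β) ≡ m ℕ.* d₀
          degree φ = ≡.trans (totalDegree-place zeroMatrix φ β) (≡.cong₂ ℕ._+_ totalDegree-zeroMatrix |β|)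

        placed-zero : ∀ φ → ¬ VecAll (Multilinear d₀) (place zeroMatrix φ β) → placed φ ℂ.≈ ℂ.0#
        placed-zero φ = matrixMoment-zero (place zeroMatrix φ β) (ℕ.≤-reflexive (degree φ))

        ∑-placed-zero : ¬ VecAll (ℕ._≤ 1) β → ∀ φs → ∑ φs placed ℂ.≈ ℂ.0#
        ∑-placed-zero β≰1 φs = ∑-0 φs λ φ → placed-zero φ λ good →
          β≰1 (proj₂ (place-≤1 zeroMatrix φ β (VecAll.map proj₁ good)))

        ∑-placed-positive : ∀ {φs} → Any (λ φ → VecAll (Multilinear d₀) (place zeroMatrix φ β)) φs → Positive (∑ φs placed)
        ∑-placed-positive {φ ∷ φs} covered with VecAll.all? (multilinear? d₀) (place zeroMatrix φ β) | Any.any? (λ φ → VecAll.all? (multilinear? d₀) (place zeroMatrix φ β)) φs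
        ... | yes good | yes rest = Positive-+ (matrixMoment-positive good) (∑-placed-positive rest)
        ... | yes good | no ¬rest = Positive-≈
              (ℂR.trans (ℂR.+-congˡ {placed φ} (none φs ¬rest)) (ℂR.+-identityʳ (placed φ))) (matrixMoment-positive good)
          where
          none : ∀ φs → ¬ Any (λ φ → VecAll (Multilinear d₀) (place zeroMatrix φ β)) φs → ∑ φs placed ℂ.≈ ℂ.0#
          none []       _  = ℂR.refl
          none (φ ∷ φs) ¬c = ℂR.trans (ℂR.+-cong (placed-zero φ (¬c ∘ here)) (none φs (¬c ∘ there))) (ℂR.+-identityˡ ℂ.0#)
        ∑-placed-positive {φ ∷ φs} (here good)  | no ¬good | _ = contradiction good ¬good
        ∑-placed-positive {φ ∷ φs} (there rest) | no ¬good | _ = Positive-≈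
          (ℂR.trans (ℂR.+-congʳ {∑ φs placed} (placed-zero φ ¬good)) (ℂR.+-identityˡ (∑ φs placed))) (∑-placed-positive rest)

^-distribʳ-* : ∀ m n k → (m ℕ.* n) ℕ.^ k ≡ m ℕ.^ k ℕ.* n ℕ.^ k
^-distribʳ-* m n zero    = ≡.refl
^-distribʳ-* m n (suc k) = ≡.trans (≡.cong (m ℕ.* n ℕ.*_) (^-distribʳ-* m n k)) (interchange m n _ _)
  where
  interchange : ∀ a b c d → a ℕ.* b ℕ.* (c ℕ.* d) ≡ a ℕ.* c ℕ.* (b ℕ.* d)
  interchange = solve-∀

P≡P′ : ∀ {n k} → k ℕ.≤ n → n P k ≡ n P′ k
P≡P′ {n} {k} k≤n with k ℕ.≤ᵇ n | ℕ.≤⇒≤ᵇ k≤n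
... | true | _ = ≡.refl

P′-pos : ∀ n k → k ℕ.≤ n → 0 ℕ.< n P′ k
P′-pos n zero    _   = s≤s z≤n
P′-pos n (suc k) k<n = ℕ.*-mono-≤ (ℕ.m<n⇒0<n∸m k<n) (P′-pos n k (ℕ.<⇒≤ k<n))

module CoveringPlacements (ℝ : CompleteOrderedField) (em : ExcludedMiddle 0ℓ)
    (m n₀ d₀ N : ℕ) .{{_ : NonZero d₀}} (d₀≤n₀ : d₀ ℕ.≤ n₀) (1≤m : 1 ℕ.≤ m) (2≤N : 2 ℕ.≤ N)
    (s : ℕ) (isσ : Isσ ℝ N (m ℕ.* d₀) n₀ d₀ s) where
  open OrderedField ℝ hiding (total)
  open Placements m n₀
  open Exponential ℝ using ([1-p]^s-N^e≤1)
  open LogarithmPositive ℝ em using (log-positive)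
  open Covering using (cover; uncovered; uncovered-empty; indicator; OftenCovered)
  open ListSum ℕ.+-*-commutativeSemiring using (∑)

  private
    e k K Q F : ℕ
    e = m ℕ.* d₀
    k = n₀ ℕ.∸ d₀
    K = m ℕ.* n₀

    d₀+k≡n₀ : d₀ ℕ.+ k ≡ n₀
    d₀+k≡n₀ = ℕ.m+[n∸m]≡n d₀≤n₀

    F = favourable d₀ k d₀+k≡n₀
    Q = total d₀ k d₀+k≡n₀

    0<d₀ : 0 ℕ.< d₀
    0<d₀ = ℕ.n≢0⇒n>0 (ℕ.≢-nonZero⁻¹ d₀)

    0<e : 0 ℕ.< e
    0<e = ℕ.*-mono-≤ 1≤m 0<d₀

    instance
      e≢0 : NonZero e
      e≢0 = ℕ.>-nonZero 0<e
      K≢0 : NonZero K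
      K≢0 = ℕ.>-nonZero (ℕ.*-mono-≤ 1≤m (ℕ.≤-trans 0<d₀ d₀≤n₀))
      d₀!≢0 : NonZero (d₀ !)
      d₀!≢0 = d₀ ℕ.!≢0

    Z : Matrix
    Z = zeroMatrix

    covers? : ∀ {N} (φ : Vec Cell N) (β : Vec ℕ N) → Dec (VecAll (Multilinear d₀) (place Z φ β))
    covers? φ β = good? d₀ k d₀+k≡n₀ (place Z φ β)

    0<Q : 0 ℕ.< Q
    0<Q = ℕ.*-mono-≤ (ℕ.m^n>0 (d₀ !) m) (ℕ.m^n>0 K e)

    F≤Q : F ℕ.≤ Q
    F≤Q = ℕ.*-cancelˡ-≤ (length (placements e)) {{placements≢0}} (begin
      length (placements e) ℕ.* F                     ≤⟨ count-good d₀ k d₀+k≡n₀ ones (ones-multilinear e) ⟩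
      Q ℕ.* count d₀ k d₀+k≡n₀ Z ones                 ≤⟨ ℕ.*-monoʳ-≤ Q (count≤ (placements e)) ⟩
      Q ℕ.* length (placements e)                     ≡⟨ ℕ.*-comm Q _ ⟩
      length (placements e) ℕ.* Q                     ∎)
      where
      open ℕ.≤-Reasoning
      placements≢0 : NonZero (length (placements e))
      placements≢0 = ≡.subst NonZero (≡.sym (length-placements e)) (ℕ.m^n≢0 K e)
      ones : Vec ℕ e
      ones = Vec.replicate e 1
      count≤ : (φs : List (Vec Cell e)) → ∑ φs (λ φ → indicator (covers? φ ones)) ℕ.≤ length φs
      count≤ []       = z≤n
      count≤ (φ ∷ φs) with covers? φ ones
      ... | yes _ = s≤s (count≤ φs)
      ... | no  _ = ℕ.m≤n⇒m≤1+n (count≤ φs)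

    y : Carrier
    y = proj₁ isσ

    logN : IsLog ℝ (nat N) y
    logN = proj₁ (proj₂ isσ)

    0<y : 0# < y
    0<y = log-positive 2≤N logN

    0<Qᵣ : 0# < nat Q
    0<Qᵣ = 0<nat 0<Q

    p X : Carrier
    p = nat F * nat Q ⁻¹

    Qp≈F : nat Q * p ≈ nat F
    Qp≈F = ÷-cancel (>⇒≉0 0<Qᵣ)

    a b c g : Carrier
    a = nat (n₀ ℕ.^ d₀)
    b = nat (n₀ P d₀)
    c = nat ((d₀ !) ℕ.^ m ℕ.* m ℕ.^ e)
    g = nat (e !)
    X = (a * b ⁻¹) ^ m * (c * g ⁻¹)

    ceiling : X * nat e * y ≤ nat s
    ceiling = ≡.subst (λ M → (a * b ⁻¹) ^ M * (nat ((d₀ !) ℕ.^ M ℕ.* M ℕ.^ e) * g ⁻¹) * nat e * y ≤ nat s)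
      (m*n/n≡m m d₀) (proj₁ (proj₂ (proj₂ isσ)))

    -- X is the reciprocal of the probability p = F / Q.
    XF≈Q : X * nat F ≈ nat Q
    XF≈Q = begin
      (a * b ⁻¹) ^ m * (c * g ⁻¹) * nat F              ≈⟨ *-congˡ (≈-trans (nat-* (e !) _) (*-congˡ (≈-trans (nat-^ (n₀ P′ d₀) m)
                                                            (^-congˡ m (reflexive (≡.cong nat (≡.sym (P≡P′ d₀≤n₀)))))))) ⟩
      (a * b ⁻¹) ^ m * (c * g ⁻¹) * (g * b ^ m)        ≈⟨ solve 5 (λ u c i g v → u :* (c :* i) :* (g :* v) := (u :* v) :* (g :* (c :* i))) ≈-refl _ c (g ⁻¹) g _ ⟩
      ((a * b ⁻¹) ^ m * b ^ m) * (g * (c * g ⁻¹))      ≈⟨ *-cong (≈-trans (≈-sym (^-distrib-* (a * b ⁻¹) b m))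
                                                            (^-congˡ m (≈-trans (*-comm _ b) (÷-cancel b≉0)))) (÷-cancel g≉0) ⟩
      a ^ m * c                                        ≈⟨ *-congʳ (nat-^ (n₀ ℕ.^ d₀) m) ⟨
      nat ((n₀ ℕ.^ d₀) ℕ.^ m) * c                      ≈⟨ nat-* ((n₀ ℕ.^ d₀) ℕ.^ m) _ ⟨
      nat ((n₀ ℕ.^ d₀) ℕ.^ m ℕ.* ((d₀ !) ℕ.^ m ℕ.* m ℕ.^ e)) ≡⟨ ≡.cong nat Q≡ ⟩
      nat Q                                            ∎
      where
      open ≈-Reasoning
      b≉0 : ¬ (b ≈ 0#)
      b≉0 = >⇒≉0 (0<nat (≡.subst (0 ℕ.<_) (≡.sym (P≡P′ d₀≤n₀)) (P′-pos n₀ d₀ d₀≤n₀)))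
      g≉0 : ¬ (g ≈ 0#)
      g≉0 = >⇒≉0 (0<nat (ℕ.n≢0⇒n>0 (ℕ.≢-nonZero⁻¹ (e !) {{e ℕ.!≢0}})))
      rotate : ∀ a b c → a ℕ.* (b ℕ.* c) ≡ b ℕ.* (c ℕ.* a)
      rotate = solve-∀
      Q≡ : (n₀ ℕ.^ d₀) ℕ.^ m ℕ.* ((d₀ !) ℕ.^ m ℕ.* m ℕ.^ e) ≡ Q
      Q≡ = ≡.trans (rotate ((n₀ ℕ.^ d₀) ℕ.^ m) ((d₀ !) ℕ.^ m) (m ℕ.^ e)) (≡.cong ((d₀ !) ℕ.^ m ℕ.*_)
        (≡.trans (≡.cong (m ℕ.^ e ℕ.*_) (≡.trans (ℕ.^-*-assoc n₀ d₀ m) (≡.cong (n₀ ℕ.^_) (ℕ.*-comm d₀ m))))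
          (≡.sym (^-distribʳ-* m n₀ e))))

    ey≤sp : nat e * y ≤ nat s * p
    ey≤sp = *-cancelˡ-≤ (nat Q) 0<Qᵣ (begin
      nat Q * (nat e * y)           ≈⟨ *-congʳ XF≈Q ⟨
      X * nat F * (nat e * y)       ≈⟨ solve 4 (λ x f e y → x :* f :* (e :* y) := f :* (x :* e :* y)) ≈-refl X (nat F) (nat e) y ⟩
      nat F * (X * nat e * y)       ≤⟨ *-monoʳ _ (0≤nat F) ceiling ⟩
      nat F * nat s                 ≈⟨ *-congʳ Qp≈F ⟨
      nat Q * p * nat s             ≈⟨ solve 3 (λ q p s → q :* p :* s := q :* (s :* p)) ≈-refl (nat Q) p (nat s) ⟩
      nat Q * (nat s * p)           ∎)
      where open ≤-Reasoning

    0≤p : 0# ≤ p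
    0≤p = *-nonNeg (0≤nat F) (proj₁ (0<⁻¹ 0<Qᵣ))

    p≤1 : p ≤ 1#
    p≤1 = *-cancelˡ-≤ (nat Q) 0<Qᵣ (≤-respˡ (≈-sym Qp≈F) (≤-respʳ (≈-sym (*-identityʳ _)) (nat-mono F≤Q)))

    N^e-bound : (1# - p) ^ s * nat N ^ e ≤ 1#
    N^e-bound = [1-p]^s-N^e≤1 s e 0≤p p≤1 (proj₁ 0<y) ey≤sp em (0<nat (ℕ.≤-trans (s≤s z≤n) 2≤N)) logN

    Q-F≈ : nat (Q ℕ.∸ F) ≈ nat Q * (1# - p)
    Q-F≈ = begin
      nat (Q ℕ.∸ F)                           ≈⟨ solve 2 (λ x y → x := (x :+ y) :- y) ≈-refl (nat (Q ℕ.∸ F)) (nat F) ⟩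
      (nat (Q ℕ.∸ F) + nat F) - nat F         ≈⟨ +-cong (≈-trans (≈-sym (nat-+ (Q ℕ.∸ F) F)) (reflexive (≡.cong nat (ℕ.m∸n+n≡m F≤Q)))) (-‿cong (≈-sym Qp≈F)) ⟩
      nat Q - nat Q * p                       ≈⟨ solve 2 (λ q p → q :- q :* p := q :* (:1 :- p)) ≈-refl (nat Q) p ⟩
      nat Q * (1# - p)                        ∎
      where open ≈-Reasoning

    UN^e≤ : ∀ {U B} → Q ℕ.^ s ℕ.* U ℕ.≤ (Q ℕ.∸ F) ℕ.^ s ℕ.* B → U ℕ.* N ℕ.^ e ℕ.≤ B
    UN^e≤ {U} {B} le = nat-cancel-≤ (begin
      nat (U ℕ.* N ℕ.^ e)                         ≈⟨ ≈-trans (nat-* U (N ℕ.^ e)) (*-congˡ (nat-^ N e)) ⟩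
      nat U * nat N ^ e                           ≤⟨ *-monoˡ _ (^-nonNeg e (0≤nat N)) U≤ ⟩
      (1# - p) ^ s * nat B * nat N ^ e            ≈⟨ solve 3 (λ v b n → v :* b :* n := b :* (v :* n)) ≈-refl _ (nat B) _ ⟩
      nat B * ((1# - p) ^ s * nat N ^ e)          ≤⟨ *-monoʳ _ (0≤nat B) N^e-bound ⟩
      nat B * 1#                                  ≈⟨ *-identityʳ _ ⟩
      nat B                                       ∎)
      where
      open ≤-Reasoning
      U≤ : nat U ≤ (1# - p) ^ s * nat B
      U≤ = *-cancelˡ-≤ (nat Q ^ s) (^-pos s 0<Qᵣ) (begin
        nat Q ^ s * nat U                         ≈⟨ ≈-trans (nat-* (Q ℕ.^ s) U) (*-congʳ (nat-^ Q s)) ⟨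
        nat (Q ℕ.^ s ℕ.* U)                       ≤⟨ nat-mono le ⟩
        nat ((Q ℕ.∸ F) ℕ.^ s ℕ.* B)               ≈⟨ ≈-trans (nat-* ((Q ℕ.∸ F) ℕ.^ s) B) (*-congʳ (nat-^ (Q ℕ.∸ F) s)) ⟩
        nat (Q ℕ.∸ F) ^ s * nat B                 ≈⟨ *-congʳ (≈-trans (^-congˡ s Q-F≈) (^-distrib-* (nat Q) (1# - p) s)) ⟩
        nat Q ^ s * (1# - p) ^ s * nat B          ≈⟨ *-assoc _ _ _ ⟩
        nat Q ^ s * ((1# - p) ^ s * nat B)        ∎)

    s≢0 : s ≢ 0
    s≢0 ≡.refl = <⇒≱ (0<* (0<nat {e} 0<e) 0<y) (≤-respʳ (zeroˡ p) ey≤sp)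

    -- In degree e = 1 every placement covers every variable.
    F≡Q : e ≡ 1 → F ≡ Q
    F≡Q e≡1 with ℕ.m*n≡1⇒m≡1 m d₀ e≡1 | ℕ.m*n≡1⇒n≡1 m d₀ e≡1
    ... | ≡.refl | ≡.refl = ≡.trans (ℕ.*-identityˡ _) (≡.trans (ℕ.*-identityʳ _) (≡.trans (ℕ.*-identityʳ n₀)
      (≡.sym (≡.trans (ℕ.*-identityˡ _) (≡.trans (ℕ.*-identityʳ _) (ℕ.*-identityˡ n₀))))))

    U≡0 : ∀ {U} → Q ℕ.^ s ℕ.* U ℕ.≤ (Q ℕ.∸ F) ℕ.^ s ℕ.* length (subsets N e) → U ≡ 0
    U≡0 {U} le with 2 ℕ.≤? e
    ... | yes 2≤e = ℕ.n<1⇒n≡0 (ℕ.*-cancelʳ-< (N ℕ.^ e) U 1 (ℕ.≤-<-trans (UN^e≤ le)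
            (≡.subst (length (subsets N e) ℕ.<_) (≡.sym (ℕ.*-identityˡ _))
              (length-subsets< N e 2≤e (ℕ.≤-trans (s≤s z≤n) 2≤N)))))
    ... | no  2≰e = ℕ.m*n≡0⇒m≡0 U (Q ℕ.^ s) {{ℕ.m^n≢0 Q s {{ℕ.>-nonZero 0<Q}}}}
            (≡.trans (ℕ.*-comm U _) (ℕ.n≤0⇒n≡0 (≡.subst (Q ℕ.^ s ℕ.* U ℕ.≤_) vanish le)))
            where
            e≡1 : e ≡ 1
            e≡1 = ℕ.≤-antisym (ℕ.s≤s⁻¹ (ℕ.≰⇒> 2≰e)) 0<e
            0^s : ∀ s → s ≢ 0 → 0 ℕ.^ s ≡ 0
            0^s zero    s≢0 = contradiction ≡.refl s≢0
            0^s (suc s) _   = ≡.refl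
            vanish : (Q ℕ.∸ F) ℕ.^ s ℕ.* length (subsets N e) ≡ 0
            vanish = ≡.cong (ℕ._* length (subsets N e)) (≡.trans
              (≡.cong (ℕ._^ s) (≡.trans (≡.cong (Q ℕ.∸_) (F≡Q e≡1)) (ℕ.n∸n≡0 Q))) (0^s s s≢0))

  CoveringFamily : Set
  CoveringFamily = ∃ λ (φs : List (Vec Cell N)) → length φs ≡ s ×
    (∀ β → Multilinear e β → Any (λ φ → VecAll (Multilinear d₀) (place Z φ β)) φs)

  coveringFamily : CoveringFamily
  coveringFamily = go (placements N) ≡.refl
    where
    go : ∀ Φ → Φ ≡ placements N → CoveringFamily
    go []        eq = contradiction (≡.trans (≡.cong length eq) (length-placements N))
                        (ℕ.<⇒≢ (ℕ.m^n>0 K N))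
    go (φ₀ ∷ Φ) eq =
      let φs , len , le = cover covers? φ₀ Φ F Q s {subsets N e} (All.map (λ {β} ml →
            ≡.subst (λ Φ → length Φ ℕ.* F ℕ.≤ Q ℕ.* ∑ Φ (λ φ → indicator (covers? φ β))) (≡.sym eq)
              (count-good d₀ k d₀+k≡n₀ β ml)) (subsets-multilinear N e))
      in φs , len , λ β ml → uncovered-empty covers? φs (subsets N e) (U≡0 le) (subsets-complete e β ml)

minimum : ExcludedMiddle 0ℓ → (Q : ℕ → Set) → ∀ {k} → Q k → ∃ λ a → IsMinimum Q a × a ℕ.≤ k
minimum em Q {k} qk = search k 0 (ℕ.+-identityʳ k) (λ _ ())
  where
  search : ∀ fuel i → fuel ℕ.+ i ≡ k → (∀ j → j ℕ.< i → ¬ Q j) → ∃ λ a → IsMinimum Q a × a ℕ.≤ k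
  search fuel i eq below with em {Q i}
  ... | yes qi = i , (qi , λ j qj → ℕ.≮⇒≥ λ j<i → below j j<i qj) , ≡.subst (i ℕ.≤_) eq (ℕ.m≤n+m i fuel)
  search zero       i eq below | no ¬qi = contradiction (≡.subst Q (≡.sym eq) qk) ¬qi
  search (suc fuel) i eq below | no ¬qi = search fuel (suc i) (≡.trans (ℕ.+-suc fuel i) eq) below′
    where
    below′ : ∀ j → j ℕ.< suc i → ¬ Q j
    below′ j j<1+i with ℕ.m≤n⇒m<n∨m≡n (ℕ.s≤s⁻¹ j<1+i)
    ... | inj₁ j<i    = below j j<i
    ... | inj₂ ≡.refl = ¬qi

module Construction (ℝ : CompleteOrderedField) (em : ExcludedMiddle 0ℓ)
    {n₀ d₀ r : ℕ} (f : ℝ[x].Form ℝ n₀ d₀) (f∈𝔈⁺ : 𝔈⁺ ℝ n₀ d₀ f)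
    (decomposition : ℂ[x].IsSumOfPowers ℝ (complexify ℝ f) r)
    (m n d q : ℕ) .{{_ : NonZero d}} (d+q≡md₀ : d ℕ.+ q ≡ m ℕ.* d₀)
    (φs : List (Vec (Fin m × Fin n₀) (n ℕ.+ q)))
    (covering : ∀ β → Multilinear (m ℕ.* d₀) β →
      Any (λ φ → VecAll (Multilinear d₀)
        (Placements.place m n₀ (Vec.replicate m (Vec.replicate n₀ 0)) φ β)) φs) where
  open OrderedField ℝ hiding (total)
  open Complex ℝ
  open PowersOfLinearForms ℂ-commutativeRing
  open ProductFamilies ℂ-commutativeRing
  open ListSum ℂR.commutativeSemiring
  open WaringFamily ℝ em
  open ComplexRoots ℝ em using (complex-root)

  private
    module ℂ = RawRing (ℂ ℝ)

    X = family f f∈𝔈⁺ decomposition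

    ones : Vec ℕ q
    ones = Vec.replicate q 1

    Weighted : Set
    Weighted = ℂ.Carrier × Vec (Vec ℂ.Carrier n₀) m

    Placement : ℕ → Set
    Placement N = Vec (Fin m × Fin n₀) N

    point : ∀ {N} → Weighted → Placement N → Vec ℂ.Carrier N
    point (_ , Ξ) φ = Vec.map (entry Ξ) φ

    constant : Placement (n ℕ.+ q) → Weighted → ℂ.Carrier
    constant φ (v , Ξ) = v ℂ.* mon (point (v , Ξ) (Vec.drop n φ)) ones

    scale : Placement (n ℕ.+ q) → Weighted → ℂ.Carrier
    scale φ v = proj₁ (complex-root d (constant φ v))

    -- Up to a positive factor, ∂/∂xₙ₊₁ ⋯ ∂/∂xₙ₊q turns v (Σᵢ Lᵢ xᵢ)^(d + q)
    -- into v Lₙ₊₁ ⋯ Lₙ₊q (Σᵢ≤ₙ Lᵢ xᵢ)^d; on exponent vectors α it appends q ones.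
    derivative : Placement (n ℕ.+ q) → Weighted → Vec ℂ.Carrier n
    derivative φ v = Vec.map (scale φ v ℂ.*_) (point v (Vec.take n φ))

  forms : List (Vec ℂ.Carrier n)
  forms = List.cartesianProductWith derivative φs (productFamily X m)

  length-forms : length forms ≡ length φs ℕ.* ((d₀ ℕ.+ 1) ℕ.* r) ℕ.^ m
  length-forms = ≡.trans (length-cartesianProductWith derivative φs (productFamily X m))
    (≡.cong (length φs ℕ.*_) (≡.trans (length-productFamily X m)
      (≡.cong (ℕ._^ m) (length-family f f∈𝔈⁺ decomposition))))

  coefficient : Vec ℕ n → ℂ.Carrier
  coefficient α = ∑ forms (λ L → multinomial d α ·ᶜ mon L α)

  private
    derivative-mon : ∀ φ v α → Vec.sum α ≡ d →
      mon (derivative φ v) α ℂ.≈ proj₁ v ℂ.* mon (point v φ) (α Vec.++ ones)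
    derivative-mon φ v α |α|≡d = begin
      mon (derivative φ v) α
        ≈⟨ mon-scale (scale φ v) (point v φ₁) α ⟩
      scale φ v ^ᶜ Vec.sum α ℂ.* mon (point v φ₁) α
        ≡⟨ ≡.cong (λ k → scale φ v ^ᶜ k ℂ.* mon (point v φ₁) α) |α|≡d ⟩
      scale φ v ^ᶜ d ℂ.* mon (point v φ₁) α
        ≈⟨ ℂR.*-congʳ {mon (point v φ₁) α} (proj₂ (complex-root d (constant φ v))) ⟩
      (proj₁ v ℂ.* mon (point v φ₂) ones) ℂ.* mon (point v φ₁) α
        ≈⟨ ℂR.*-assoc (proj₁ v) (mon (point v φ₂) ones) (mon (point v φ₁) α) ⟩
      proj₁ v ℂ.* (mon (point v φ₂) ones ℂ.* mon (point v φ₁) α)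
        ≈⟨ ℂR.*-congˡ {proj₁ v} (ℂR.*-comm (mon (point v φ₂) ones) (mon (point v φ₁) α)) ⟩
      proj₁ v ℂ.* (mon (point v φ₁) α ℂ.* mon (point v φ₂) ones)
        ≈⟨ ℂR.*-congˡ {proj₁ v} (mon-++ (point v φ₁) (point v φ₂) α ones) ⟨
      proj₁ v ℂ.* mon (point v φ₁ Vec.++ point v φ₂) (α Vec.++ ones)
        ≡⟨ ≡.cong (λ L → proj₁ v ℂ.* mon L (α Vec.++ ones))
             (≡.trans (≡.sym (Vec.map-++ (entry (proj₂ v)) φ₁ φ₂)) (≡.cong (point v) (Vec.take++drop≡id n φ))) ⟩
      proj₁ v ℂ.* mon (point v φ) (α Vec.++ ones) ∎
      where
      open SetoidReasoning ℂR.setoid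
      φ₁ = Vec.take n φ
      φ₂ = Vec.drop n φ

    module _ (α : Vec ℕ n) (|α|≡d : Vec.sum α ≡ d) where
      β : Vec ℕ (n ℕ.+ q)
      β = α Vec.++ ones

      |β| : Vec.sum β ≡ m ℕ.* d₀
      |β| = ≡.trans (Vec.sum-++ α) (≡.trans (≡.cong₂ ℕ._+_ |α|≡d (proj₂ (ones-multilinear q))) d+q≡md₀)

      total : ℂ.Carrier
      total = ∑ φs (placed f f∈𝔈⁺ decomposition m β |β|)

      coefficient≈ : coefficient α ℂ.≈ multinomial d α ·ᶜ total
      coefficient≈ = ℂR.trans (∑-· forms (multinomial d α)) (×-congʳ (multinomial d α) (begin
        ∑ forms (λ L → mon L α)
          ≈⟨ ∑-cartesianProductWith derivative φs (productFamily X m) ⟩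
        ∑ φs (λ φ → ∑ (productFamily X m) (λ v → mon (derivative φ v) α))
          ≈⟨ ∑-cong φs (λ φ → ℂR.trans (∑-cong (productFamily X m) (λ v → placedTerm φ v))
               (∑-productFamily X (Placements.place m n₀ Z φ β))) ⟩
        total ∎))
        where
        open SetoidReasoning ℂR.setoid
        open Mult ℂR.semiring using (×-congʳ)
        Z = Vec.replicate m (Vec.replicate n₀ 0)
        placedTerm : ∀ φ v → mon (derivative φ v) α ℂ.≈ proj₁ v ℂ.* matrixMon (proj₂ v) (Placements.place m n₀ Z φ β)
        placedTerm φ v = ℂR.trans (derivative-mon φ v α |α|≡d) (ℂR.*-congˡ {proj₁ v} (ℂR.sym
          (ℂR.trans (matrixMon-place (proj₂ v) Z φ β)
            (ℂR.trans (ℂR.*-congˡ {mon (point v φ) β} (matrixMon-zero (proj₂ v))) (ℂR.*-identityʳ (mon (point v φ) β))))))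

      scaled : coefficient α ℂ.≈ (nat (multinomial d α) * proj₁ total , nat (multinomial d α) * proj₂ total)
      scaled = ℂR.trans coefficient≈ (·ᶜ-components (multinomial d α) total)

      coefficient-positive : Multilinear d α → Positive (coefficient α)
      coefficient-positive (α≤1 , _) =
        let x , 0<x , total≈x = ∑-placed-positive f f∈𝔈⁺ decomposition m β |β|
                                  (covering β (VecAll.++⁺ α≤1 (proj₁ (ones-multilinear q)) , |β|))
            c = nat (multinomial d α)
        in c * x , 0<* (0<nat {multinomial d α} (multinomial-pos d α |α|≡d)) 0<x ,
           ℂR.trans scaled (*-congˡ (proj₁ total≈x) , ≈-trans (*-congˡ (proj₂ total≈x)) (zeroʳ c))

      coefficient-nonMultilinear : ¬ Multilinear d α → coefficient α ℂ.≈ ℂ.0#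
      coefficient-nonMultilinear ¬ml =
        let re≈0 , im≈0 = ∑-placed-zero f f∈𝔈⁺ decomposition m β |β| (λ β≤1 → ¬ml (VecAll.++ˡ⁻ α β≤1 , |α|≡d)) φs
            c = nat (multinomial d α)
        in ℂR.trans scaled (≈-trans (*-congˡ re≈0) (zeroʳ c) , ≈-trans (*-congˡ im≈0) (zeroʳ c))

  coefficient-homogeneous : ∀ α → Vec.sum α ≢ d → coefficient α ℂ.≈ ℂ.0#
  coefficient-homogeneous α |α|≢d = ∑-0 forms λ L →
    ℂR.reflexive (≡.cong (_·ᶜ mon L α) (multinomial-zero d α |α|≢d))

  coefficient-zero : ∀ α → ¬ Multilinear d α → coefficient α ℂ.≈ ℂ.0#
  coefficient-zero α ¬ml with Vec.sum α ℕ.≟ d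
  ... | yes |α|≡d = coefficient-nonMultilinear α |α|≡d ¬ml
  ... | no  |α|≢d = coefficient-homogeneous α |α|≢d

  g : ℝ[x].Form ℝ n d
  g = record
    { coeff       = proj₁ ∘ coefficient
    ; homogeneous = λ α |α|≢d → proj₁ (coefficient-homogeneous α |α|≢d)
    }

  g∈𝔈⁺ : 𝔈⁺ ℝ n d g
  g∈𝔈⁺ = nonNeg , λ α → mk⇔ (support α) λ ml → >⇒≉0 (positive α ml)
    where
    positive : ∀ α → Multilinear d α → 0# < proj₁ (coefficient α)
    positive α ml = let x , 0<x , eq = coefficient-positive α (proj₂ ml) ml
                    in <-≤-trans 0<x (≤-reflexive (≈-sym (proj₁ eq)))
    support : ∀ α → ¬ (proj₁ (coefficient α) ≈ 0#) → Multilinear d α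
    support α gα≉0 with multilinear? d α
    ... | yes ml = ml
    ... | no ¬ml = contradiction (proj₁ (coefficient-zero α ¬ml)) gα≉0
    nonNeg : ∀ α → 0# ≤ proj₁ (coefficient α)
    nonNeg α with multilinear? d α
    ... | yes ml = proj₁ (positive α ml)
    ... | no ¬ml = ≤-reflexive (≈-sym (proj₁ (coefficient-zero α ¬ml)))

  real-coefficient : ∀ α → proj₂ (coefficient α) ≈ 0#
  real-coefficient α with multilinear? d α
  ... | yes ml = let x , 0<x , eq = coefficient-positive α (proj₂ ml) ml in proj₂ eq
  ... | no ¬ml = proj₂ (coefficient-zero α ¬ml)

  g-isSumOfPowers : ℂ[x].IsSumOfPowers ℝ (complexify ℝ g) (length forms)
  g-isSumOfPowers = (λ i → linearForm (List.lookup forms i)) , λ α →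
    ℂR.trans (≈-refl , ≈-sym (real-coefficient α))
      (ℂR.sym (ℂR.trans (Σₚ-powers (linear ∘ List.lookup forms) (List.lookup forms)
        (λ i → linear-isLinear (List.lookup forms i)) d α)
        (ℂR.reflexive (≡.cong (λ L → ∑ L (λ L → multinomial d α ·ᶜ mon L α)) (List.tabulate-lookup forms)))))

d≤⌈d/k⌉*k : ∀ d k .{{_ : NonZero k}} → d ℕ.≤ ⌈ d / k ⌉ ℕ.* k
d≤⌈d/k⌉*k d (suc k) = ℕ.+-cancelˡ-≤ k _ _ (begin
  k ℕ.+ d                                               ≡⟨ ℕ.+-comm k d ⟩
  d ℕ.+ k                                               ≡⟨ m≡m%n+[m/n]*n (d ℕ.+ k) (suc k) ⟩
  (d ℕ.+ k) % suc k ℕ.+ (d ℕ.+ k) / suc k ℕ.* suc k     ≤⟨ ℕ.+-monoˡ-≤ _ (ℕ.s≤s⁻¹ (m%n<n (d ℕ.+ k) (suc k))) ⟩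
  k ℕ.+ (d ℕ.+ k) / suc k ℕ.* suc k                     ∎)
  where open ℕ.≤-Reasoning

open import Data.Nat.Base using (_+_; _*_; _∸_; _^_; _≤_)

theorem66 : ExcludedMiddle 0ℓ → (ℝ : CompleteOrderedField) →
    (n₀ d₀ : ℕ) .{{_ : NonZero d₀}} → d₀ ≤ n₀ →
    (f : ℝ[x].Form ℝ n₀ d₀) → 𝔈⁺ ℝ n₀ d₀ f →
    (n d : ℕ) → 1 ≤ d → d ≤ n →
    ¬ (n ≡ 1 × d ≡ 1 × d₀ ≡ 1) →
    (r : ℕ) → IsWaringRank ℝ (complexify ℝ f) r →
    (s : ℕ) → Isσ ℝ ((n + ⌈ d / d₀ ⌉ * d₀) ∸ d) (⌈ d / d₀ ⌉ * d₀) n₀ d₀ s →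
    ∃ λ a → IsA⁺ ℝ n d a × a ≤ s * ((d₀ + 1) * r) ^ ⌈ d / d₀ ⌉
theorem66 em ℝ n₀ d₀ d₀≤n₀ f f∈𝔈⁺ n d 1≤d d≤n nondegenerate r (decomposition , _) s isσ =
  let φs , |φs|≡s , covering = coveringFamily
      module C = Construction ℝ em f f∈𝔈⁺ decomposition m n d q {{ℕ.>-nonZero 1≤d}} d+q≡e φs covering
      ρ , isRank , ρ≤ = minimum em (ℂ[x].IsSumOfPowers ℝ (complexify ℝ C.g)) C.g-isSumOfPowers
      a , isA⁺ , a≤ρ = minimum em (λ r → ∃ λ g → 𝔈⁺ ℝ n d g × IsWaringRank ℝ (complexify ℝ g) r)
                         (C.g , C.g∈𝔈⁺ , isRank)
  in a , isA⁺ , ℕ.≤-trans a≤ρ (ℕ.≤-trans ρ≤ (ℕ.≤-reflexive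
       (≡.trans C.length-forms (≡.cong (_* ((d₀ + 1) * r) ^ m) |φs|≡s))))
  where
  m e q : ℕ
  m = ⌈ d / d₀ ⌉
  e = m * d₀
  q = e ∸ d

  d≤e : d ≤ e
  d≤e = d≤⌈d/k⌉*k d d₀

  d+q≡e : d + q ≡ e
  d+q≡e = ℕ.m+[n∸m]≡n d≤e

  1≤m : 1 ≤ m
  1≤m = ℕ.n≢0⇒n>0 λ m≡0 → ℕ.<⇒≱ (ℕ.≤-trans 1≤d d≤e) (ℕ.≤-reflexive (≡.cong (_* d₀) m≡0))

  2≤n+q : 2 ≤ n + q
  2≤n+q with 2 ℕ.≤? n
  ... | yes 2≤n = ℕ.≤-trans 2≤n (ℕ.m≤m+n n q)
  ... | no  2≰n = ≡.subst (λ z → 2 ≤ z + q) (≡.sym n≡1) (s≤s (ℕ.m<n⇒0<n∸m d<e))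
    where
    n≡1 : n ≡ 1
    n≡1 = ℕ.≤-antisym (ℕ.s≤s⁻¹ (ℕ.≰⇒> 2≰n)) (ℕ.≤-trans 1≤d d≤n)
    d≡1 : d ≡ 1
    d≡1 = ℕ.≤-antisym (≡.subst (d ≤_) n≡1 d≤n) 1≤d
    d₀≢1 : d₀ ≢ 1
    d₀≢1 d₀≡1 = nondegenerate (n≡1 , d≡1 , d₀≡1)
    d<e : d ℕ.< e
    d<e = ≡.subst (ℕ._< e) (≡.sym d≡1) (ℕ.≤-trans
      (ℕ.≤∧≢⇒< (ℕ.n≢0⇒n>0 (ℕ.≢-nonZero⁻¹ d₀)) (d₀≢1 ∘ ≡.sym))
      (ℕ.m≤n*m d₀ m {{ℕ.>-nonZero 1≤m}}))

  open CoveringPlacements ℝ em m n₀ d₀ (n + q) d₀≤n₀ 1≤m 2≤n+q s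
    (≡.subst (λ N → Isσ ℝ N e n₀ d₀ s) (ℕ.+-∸-assoc n d≤e) isσ)
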